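{- Let $W$ be any Coxeter group and let $u \leq v$ be elements of $W$ (in Bruhat order). Then $d_{u,v} = g_{u,v}$.
   Context: Let $(W,S)$ be a Coxeter system with length function $\ell$, Bruhat order $\leq$, and set of reflections $T$ (conjugates of elements of $S$); write $\ell(x,y)=\ell(y)-\ell(x)$. The Kazhdan--Lusztig $R$-polynomials $R_{x,y}\in\mathbb{Z}[q]$ are the unique family with: $R_{x,y}=0$ if $x\not\leq y$; $R_{x,x}=1$; and if $x<y$ and $s\in S$ with $sy<y$, then $R_{x,y}=R_{sx,sy}$ if $sx<x$, and $R_{x,y}=(q-1)R_{x,sy}+qR_{sx,sy}$ if $sx>x$. For $u\leq v$, $R_{u,v}$ is monic of degree $\ell(u,v)$, and the $d$-invariant $d_{u,v}\in\mathbb{N}$ is defined by $R_{u,v}=q^{\ell(u,v)}-d_{u,v}q^{\ell(u,v)-1}+\cdots$, i.e. $d_{u,v}=-[q^{\ell(u,v)-1}]R_{u,v}$. The Bruhat graph is the directed graph on $W$ with an edge $x\to y$ whenever $y=tx$ for some $t\in T$ and $\ell(x)<\ell(y)$. Let $\widehat{\Gamma}_{u,v}$ be the underlying undirected graph of the induced subgraph on the Bruhat interval $[u,v]$, and $E_{u,v}$ its edge set. A set $F\subseteq E_{u,v}$ is diamond-closed if, whenever it contains two consecutive edges of a $4$-cycle of $\widehat{\Gamma}_{u,v}$, it also contains the other two edges of that $4$-cycle. The diamond-closure $F^{\diamond}$ is the smallest diamond-closed subset of $E_{u,v}$ containing $F$; $F$ is diamond-generating if $F^{\diamond}=E_{u,v}$.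 Then $g_{u,v}$ is the minimum size of a diamond-generating subset of $E_{u,v}$. -}

module Defs where

open import Level using (Level; _⊔_) renaming (suc to lsuc)
open import Algebra.Bundles using (Group)
open import Data.Nat using (ℕ; zero; suc; _≤_; _<_; _*_; _∸_)
open import Data.Integer using (ℤ; +_; -_; _+_)
open import Data.Maybe using (Maybe; just; nothing)
open import Data.List using (List; []; _∷_; _++_; length; foldr)
open import Data.List.Relation.Unary.All using (All)
open import Data.List.Relation.Unary.Any using (Any)
open import Data.List.Relation.Unary.AllPairs using (AllPairs)
open import Data.Product using (Σ; ∃; _×_; _,_; proj₁; proj₂)
open import Data.Sum using (_⊎_)
open import Relation.Nullary using (¬_)
open import Relation.Binary.PropositionalEquality using (_≡_)
open import Relation.Binary.Construct.Closure.Transitive using (TransClosure)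

-- Coxeter presentations on a set I of generator names.
-- m s t = nothing encodes m(s,t) = ∞.

alt : {I : Set} → I → I → ℕ → List I
alt s t zero    = []
alt s t (suc n) = s ∷ alt t s n

-- the congruence on words (free monoid on I) generated by the Coxeter
-- relations (st)^{m(s,t)} = 1 (this includes s^2 = 1 since m(s,s) = 1)
data CoxEq {I : Set} (m : I → I → Maybe ℕ) : List I → List I → Set where
  ceq-refl  : ∀ w → CoxEq m w w
  ceq-sym   : ∀ {w w'} → CoxEq m w w' → CoxEq m w' w
  ceq-trans : ∀ {w w' w''} → CoxEq m w w' → CoxEq m w' w'' → CoxEq m w w''
  ceq-ctx   : ∀ a b {w w'} → CoxEq m w w' → CoxEq m (a ++ w ++ b) (a ++ w' ++ b)
  ceq-rel   : ∀ s t k → m s t ≡ just k → CoxEq m (alt s t (k * 2)) []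

evalWord : ∀ {c ℓ} (G : Group c ℓ) {I : Set} → (I → Group.Carrier G) → List I → Group.Carrier G
evalWord G gen = foldr (λ i g → gen i ∙ g) ε
  where open Group G

-- A Coxeter system (W,S): a group W with generators S = gen(I) such that
-- W is presented by ⟨ S | (st)^{m(s,t)} = 1 ⟩ for a Coxeter matrix m.
-- "Presented" is stated concretely: every element is a product of
-- generators, and two words have equal products iff they are related by
-- the congruence generated by the Coxeter relations.
record CoxeterSystem (c ℓ : Level) : Set (lsuc (c ⊔ ℓ)) where
  field
    W      : Group c ℓ
    I      : Set
    m      : I → I → Maybe ℕ
    m-diag : ∀ s → m s s ≡ just 1
    m-sym  : ∀ s t → m s t ≡ m t s
    m-off  : ∀ s t → ¬ (s ≡ t) → ∀ k → m s t ≡ just k → 2 ≤ k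
    gen    : I → Group.Carrier W
    generated  : ∀ x → ∃ λ (w : List I) → Group._≈_ W (evalWord W gen w) x
    presented₁ : ∀ w w' → Group._≈_ W (evalWord W gen w) (evalWord W gen w') → CoxEq m w w'
    presented₂ : ∀ w w' → CoxEq m w w' → Group._≈_ W (evalWord W gen w) (evalWord W gen w')

module CS {c ℓ : Level} (C : CoxeterSystem c ℓ) where
  open CoxeterSystem C
  open Group W public using (Carrier; _≈_; _∙_; ε; _⁻¹)

  eval : List I → Carrier
  eval = evalWord W gen

  HasLength : Carrier → ℕ → Set ℓ
  HasLength x n = (∃ λ (w : List I) → eval w ≈ x × length w ≡ n)
                × (∀ (w : List I) → eval w ≈ x → n ≤ length w)

  LenLt : Carrier → Carrier → Set ℓ
  LenLt x y = ∃ λ a → ∃ λ b → HasLength x a × HasLength y b × a < b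

  IsReflection : Carrier → Set (c ⊔ ℓ)
  IsReflection t = ∃ λ (w : Carrier) → ∃ λ (s : I) → t ≈ ((w ∙ gen s) ∙ (w ⁻¹))

  BEdge : Carrier → Carrier → Set (c ⊔ ℓ)
  BEdge x y = (∃ λ t → IsReflection t × y ≈ (t ∙ x)) × LenLt x y

  _≤B_ : Carrier → Carrier → Set (c ⊔ ℓ)
  x ≤B y = x ≈ y ⊎ TransClosure BEdge x y

  _<B_ : Carrier → Carrier → Set (c ⊔ ℓ)
  x <B y = x ≤B y × ¬ (x ≈ y)

  -- R-polynomials, encoded by coefficient functions: R x y k = [q^k] R_{x,y}

  δ0 : ℕ → ℤ
  δ0 zero    = + 1
  δ0 (suc _) = + 0

  -- [q^k] of (q-1) P + q Q
  stepCoeff : (ℕ → ℤ) → (ℕ → ℤ) → ℕ → ℤ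
  stepCoeff P Q zero    = - P zero
  stepCoeff P Q (suc k) = (P k + (- P (suc k))) + Q k

  record IsRFamily (R : Carrier → Carrier → ℕ → ℤ) : Set (c ⊔ ℓ) where
    field
      R-resp  : ∀ {x x' y y'} → x ≈ x' → y ≈ y' → ∀ k → R x y k ≡ R x' y' k
      R-zero  : ∀ x y → ¬ (x ≤B y) → ∀ k → R x y k ≡ + 0
      R-diag  : ∀ x k → R x x k ≡ δ0 k
      R-desc  : ∀ x y (s : I) → x <B y → LenLt (gen s ∙ y) y → LenLt (gen s ∙ x) x →
                ∀ k → R x y k ≡ R (gen s ∙ x) (gen s ∙ y) k
      R-asc   : ∀ x y (s : I) → x <B y → LenLt (gen s ∙ y) y → LenLt x (gen s ∙ x) →
                ∀ k → R x y k ≡ stepCoeff (R x (gen s ∙ y)) (R (gen s ∙ x) (gen s ∙ y)) k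

  -- d_{u,v} = - [q^{ℓ(u,v)-1}] R_{u,v}, with L = ℓ(u,v) (and d = 0 when L = 0)
  dInv : (Carrier → Carrier → ℕ → ℤ) → Carrier → Carrier → ℕ → ℤ
  dInv R u v zero    = + 0
  dInv R u v (suc j) = - R u v j

  module Interval (u v : Carrier) where

    InInt : Carrier → Set (c ⊔ ℓ)
    InInt x = u ≤B x × x ≤B v

    Adj : Carrier → Carrier → Set (c ⊔ ℓ)
    Adj x y = InInt x × InInt y × (BEdge x y ⊎ BEdge y x)

    record IsEdgeSubset (D : Carrier → Carrier → Set (c ⊔ ℓ)) : Set (lsuc (c ⊔ ℓ)) where
      field
        sub  : ∀ x y → D x y → Adj x y
        symm : ∀ x y → D x y → D y x
        resp : ∀ {x x' y y'} → x ≈ x' → y ≈ y' → D x y → D x' y'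

    FourCycle : Carrier → Carrier → Carrier → Carrier → Set (c ⊔ ℓ)
    FourCycle a b c d =
      (Adj a b × Adj b c × Adj c d × Adj d a)
      × (¬ a ≈ b × ¬ a ≈ c × ¬ a ≈ d × ¬ b ≈ c × ¬ b ≈ d × ¬ c ≈ d)

    DiamondClosed : (Carrier → Carrier → Set (c ⊔ ℓ)) → Set (c ⊔ ℓ)
    DiamondClosed D = ∀ a b c d → FourCycle a b c d → D a b → D b c → D c d × D d a

    -- finite edge sets are lists of pairs; a pair (a,b) stands for the edge {a,b}
    SameEdge : Carrier × Carrier → Carrier → Carrier → Set ℓ
    SameEdge (a , b) x y = (a ≈ x × b ≈ y) ⊎ (a ≈ y × b ≈ x)

    -- a finite subset of E_{u,v}: every entry is an edge, no edge listed twice;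
    -- its size is then the length of the list
    ValidEdgeList : List (Carrier × Carrier) → Set (c ⊔ ℓ)
    ValidEdgeList F = All (λ e → Adj (proj₁ e) (proj₂ e)) F
                    × AllPairs (λ e e' → ¬ SameEdge e (proj₁ e') (proj₂ e')) F

    -- F^◇ = E_{u,v}: every diamond-closed subset of E_{u,v} containing F is all of E_{u,v}
    DiamondGenerating : List (Carrier × Carrier) → Set (lsuc (c ⊔ ℓ))
    DiamondGenerating F =
      ∀ (D : Carrier → Carrier → Set (c ⊔ ℓ)) → IsEdgeSubset D → DiamondClosed D →
      All (λ e → D (proj₁ e) (proj₂ e)) F →
      ∀ x y → Adj x y → D x y

    IsG : ℕ → Set (lsuc (c ⊔ ℓ))
    IsG n = (Σ (List (Carrier × Carrier)) λ F → ValidEdgeList F × DiamondGenerating F × length F ≡ n)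
          × (∀ F → ValidEdgeList F → DiamondGenerating F → n ≤ length F)

{-# OPTIONS --safe #-}
-- The lengths, descents and the Bruhat order of W are made decidable by means of
-- the geometric representation over the Cauchy reals.  For a reduced word
-- k w of v, both d and g then obey d(u, k w) = d(u', w) + [u < k u ≰ w] with
-- u' = min(u, k u).
--
-- d: this is the recursion for the two leading coefficients of R.
--
-- g ≤ d: whenever the coatom q = k v lies above u it is made a seed, i.e. the edge
-- q – v is put into the generating set.  The set T of all x such that every edge of
-- [x, v] is already generated is then closed under k, so the problem descends to
-- [u', q].  This uses one seed too many when u' and k u' both lie below q; the
-- excess is recorded as a relation which later makes one seed superfluous, when it
-- has become the statement that q is in T because v is.
--
-- g ≥ d: there is a d-dimensional space, modulo constants, of functions z on [u, v]
-- with values in the reflection representation such that z(x) − z(t x) is a multiple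
-- of the root of t.  If fewer than d edges were generating, a non-constant such z
-- would vanish along all of them; the edges along which z is constant form a
-- diamond-closed set since distinct reflections have independent roots.
module Submission where

open import Defs
open import Level using (Level)
open import Algebra.Bundles using (Group)
open import Data.Nat using (ℕ)
open import Data.Maybe using (Maybe; just)
open import Data.Product using (proj₁)
open import Relation.Nullary using (¬_)
open import Relation.Binary.PropositionalEquality using (_≡_)

-- The generators carry no decidable equality and no classical principle is assumed, so the sign of
-- a real number is never tested. Every sign statement is negative, hence stable under double
-- negation; every decision is taken by recursion on words, and a positive height merely certifies
-- its outcome. This is why a Cauchy modulus known up to double negation is enough.
--
-- The height of a root is the sum of its coefficients on simple roots, so a nonzero multiple of a
-- root never has height zero. One scalar equation per edge therefore expresses that z is constant
-- along it, and fewer than d equations leave a nonzero solution in dimension d.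
--
-- For the upper bound the induction hypothesis has to speak about intervals with outstanding
-- relations: the number of seeds plus the number of relations is at most d. The obstacle is that
-- two relations might offer to replace the same seed. Each relation therefore stores part of its
-- history, namely the letters removed since it was made, and a comparison of histories shows that
-- the labels of relations present at the same time are distinct.

module DoubleNegation where
  open import Level using (Level)
  open import Data.Product using (∃; _,_)
  open import Data.Sum using (_⊎_; inj₁; inj₂)
  open import Relation.Nullary using (¬_)

  private variable
    a b : Level
    A B : Set a

  infixl 1 _>>=_
  _>>=_ : ¬ ¬ A → (A → ¬ ¬ B) → ¬ ¬ B
  (m >>= f) k = m λ x → f x k

  return : A → ¬ ¬ A
  return x k = k x

  lem : ¬ ¬ (A ⊎ ¬ A)
  lem k = k (inj₂ λ x → k (inj₁ x))

  ¬∀⇒¬¬∃¬ : {B : A → Set b} → (∀ x → ¬ ¬ B x → B x) → ¬ (∀ x → B x) → ¬ ¬ (∃ λ x → ¬ B x)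
  ¬∀⇒¬¬∃¬ st f k = f λ x → st x λ nb → k (x , nb)

-- Real numbers as bounded rational sequences, up to double negation.

module Reals where
  open import Level using (0ℓ)
  open import Algebra.Bundles using (CommutativeRing)
  open import Data.Nat as ℕ using (ℕ; zero; suc; _⊔_)
  import Data.Nat.Properties as ℕₚ
  open import Data.Rational using (ℚ; 0ℚ; 1ℚ; ½; _+_; _*_; -_; _-_; _≤_; _≤?_; nonNegative)
  open import Data.Rational.Properties as ℚₚ using (≤-refl; ≤-trans; ≤-reflexive; +-mono-≤; ≰⇒>; <⇒≤)
  open import Data.Rational.Solver using (module +-*-Solver)
  open +-*-Solver using (solve; _:=_; _:+_; _:*_; :-_; con; _:-_)
  open import Data.Product using (∃; _×_; _,_; proj₁; proj₂)
  open import Relation.Nullary using (¬_; yes; no)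
  open import Relation.Binary.PropositionalEquality using (_≡_; refl; sym; trans; cong; cong₂; subst)
  open import Data.Empty using (⊥)
  open DoubleNegation

  0≤sub : ∀ {p q} → p ≤ q → 0ℚ ≤ q - p
  0≤sub {p} {q} h = ≤-trans (≤-reflexive (solve 1 (λ p → con 0ℚ := p :- p) refl p)) (+-mono-≤ h (≤-refl { - p}))

  -- Inequalities are certified by an explicit nonnegative slack `e`, which leaves an identity for
  -- the ring solver.
  ≤by : ∀ {p q} e → 0ℚ ≤ e → q ≡ p + e → p ≤ q
  ≤by {p} {q} e h eq = ≤-trans (≤-reflexive (solve 1 (λ p → p := p :+ con 0ℚ) refl p))
                        (≤-trans (+-mono-≤ (≤-refl {p}) h) (≤-reflexive (sym eq)))

  _⊕_ : ∀ {p q} → 0ℚ ≤ p → 0ℚ ≤ q → 0ℚ ≤ p + q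
  _⊕_ {p} {q} hp hq = +-mono-≤ hp hq

  _⊗_ : ∀ {p q} → 0ℚ ≤ p → 0ℚ ≤ q → 0ℚ ≤ p * q
  _⊗_ {p} {q} hp hq = ≤-trans (≤-reflexive (sym (ℚₚ.*-zeroˡ q))) (ℚₚ.*-monoʳ-≤-nonNeg q {{nonNegative hq}} hp)

  0≤½ : 0ℚ ≤ ½
  0≤½ = ℚₚ.nonNegative⁻¹ ½
  0≤1 : 0ℚ ≤ 1ℚ
  0≤1 = ℚₚ.nonNegative⁻¹ 1ℚ

  -- Bounds are powers 2^k and precisions, given by `w`, are 2^-k, so that rescaling a precision
  -- shifts its index.
  pow : ℕ → ℚ
  pow zero = 1ℚ
  pow (suc k) = pow k + pow k

  w : ℕ → ℚ
  w zero = 1ℚ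
  w (suc k) = ½ * w k

  abstract
    pow≥1 : ∀ k → 1ℚ ≤ pow k
    pow≥1 zero = ≤-refl
    pow≥1 (suc k) = ≤by (1ℚ + ((pow k - 1ℚ) + (pow k - 1ℚ))) (0≤1 ⊕ (0≤sub (pow≥1 k) ⊕ 0≤sub (pow≥1 k)))
      (solve 1 (λ p → p :+ p := con 1ℚ :+ (con 1ℚ :+ ((p :- con 1ℚ) :+ (p :- con 1ℚ)))) refl (pow k))

    0≤pow : ∀ k → 0ℚ ≤ pow k
    0≤pow k = ≤-trans 0≤1 (pow≥1 k)

    0≤w : ∀ k → 0ℚ ≤ w k
    0≤w zero = 0≤1
    0≤w (suc k) = 0≤½ ⊗ 0≤w k

    w+w : ∀ k → w (suc k) + w (suc k) ≡ w k
    w+w k = solve 1 (λ x → con ½ :* x :+ con ½ :* x := x) refl (w k)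

    pow-+ : ∀ i j → pow (i ℕ.+ j) ≡ pow i * pow j
    pow-+ zero j = sym (ℚₚ.*-identityˡ (pow j))
    pow-+ (suc i) j = trans (cong₂ _+_ (pow-+ i j) (pow-+ i j)) (solve 2 (λ a b → a :* b :+ a :* b := (a :+ a) :* b) refl (pow i) (pow j))

    pow*w : ∀ i k → pow i * w (i ℕ.+ k) ≡ w k
    pow*w zero k = ℚₚ.*-identityˡ (w k)
    pow*w (suc i) k = trans (solve 2 (λ a b → (a :+ a) :* (con ½ :* b) := a :* b) refl (pow i) (w (i ℕ.+ k))) (pow*w i k)

    w*w : ∀ i k → w (i ℕ.+ k) ≡ w i * w k
    w*w zero k = sym (ℚₚ.*-identityˡ (w k))
    w*w (suc i) k = trans (cong (½ *_) (w*w i k)) (sym (ℚₚ.*-assoc ½ (w i) (w k)))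

    w-dec : ∀ k → w (suc k) ≤ w k
    w-dec k = ≤by (w (suc k)) (0≤w (suc k)) (sym (w+w k))

    w≤1 : ∀ k → w k ≤ 1ℚ
    w≤1 zero = ≤-refl
    w≤1 (suc k) = ≤-trans (w-dec k) (w≤1 k)

    0<w : ∀ k → ¬ (w k ≤ 0ℚ)
    0<w k h = absurd (≤-trans (≤by (pow k * (0ℚ - w k)) (0≤pow k ⊗ 0≤sub h) eq) (≤-refl {0ℚ}))
      where
      absurd : ¬ (1ℚ ≤ 0ℚ)
      absurd p with ℚₚ.≤⇒≤ᵇ p
      ... | ()
      pw : pow k * w k ≡ 1ℚ
      pw = trans (cong (λ z → pow k * w z) (sym (ℕₚ.+-identityʳ k))) (pow*w k 0)
      eq : 0ℚ ≡ 1ℚ + pow k * (0ℚ - w k)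
      eq = trans (solve 1 (λ a → con 0ℚ := con 1ℚ :+ (:- con 1ℚ)) refl 0ℚ)
             (trans (cong (λ z → 1ℚ + - z) (sym pw)) (solve 2 (λ a b → con 1ℚ :+ (:- (a :* b)) := con 1ℚ :+ a :* (con 0ℚ :- b)) refl (pow k) (w k)))

  Seq : Set
  Seq = ℕ → ℚ

  Eventually : (ℕ → Set) → Set
  Eventually P = ∃ λ N → ∀ n → N ℕ.≤ n → P n

  ev-zip : ∀ {P Q : ℕ → Set} → Eventually P → Eventually Q → Eventually (λ n → P n × Q n)
  ev-zip (N , f) (M , g) = N ⊔ M , λ n h → f n (ℕₚ.≤-trans (ℕₚ.m≤m⊔n N M) h) , g n (ℕₚ.≤-trans (ℕₚ.m≤n⊔m N M) h)

  ev-map : ∀ {P Q : ℕ → Set} → (∀ n → P n → Q n) → Eventually P → Eventually Q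
  ev-map f (N , g) = N , λ n h → f n (g n h)

  -- The index `N` is doubly negated: limits serve only in negative statements, and no approximation
  -- is extracted from it.
  Cauchy : Seq → Set
  Cauchy x = ∀ k → ¬ ¬ (∃ λ N → ∀ m n → N ℕ.≤ m → N ℕ.≤ n → x m - x n ≤ w k)

  Bounded : Seq → Set
  Bounded x = ∃ λ j → ∀ n → (- pow j ≤ x n) × (x n ≤ pow j)

  record ℝ : Set where
    constructor mk
    field
      seq : Seq
      bnd : Bounded seq
      cau : Cauchy seq
  open ℝ public

  NonNegˢ : Seq → Set
  NonNegˢ x = ∀ k → ¬ ¬ Eventually (λ n → - w k ≤ x n)

  nn-+ : ∀ {x y} → NonNegˢ x → NonNegˢ y → NonNegˢ (λ n → x n + y n)
  nn-+ {x} {y} hx hy k = hx (suc k) >>= λ ex → hy (suc k) >>= λ ey → return (ev-map (λ n (p , q) →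
    ≤-trans (≤-reflexive (trans (cong -_ (sym (w+w k))) (ℚₚ.neg-distrib-+ (w (suc k)) (w (suc k))))) (+-mono-≤ p q)) (ev-zip ex ey))

  nn-pointwise : ∀ {x} → (∀ n → 0ℚ ≤ x n) → NonNegˢ x
  nn-pointwise h k = return (0 , λ n _ → ≤-trans (ℚₚ.neg-antimono-≤ (0≤w k)) (h n))

  -- With d = 2^-l the product (x + d)(y + d) is nonnegative up to the sign errors allowed, and its
  -- excess over x y is bounded through d 2^i, d 2^j and d². The index l makes each of these at most
  -- a quarter of `w k`.
  nn-* : ∀ {x y} → Bounded x → Bounded y → NonNegˢ x → NonNegˢ y → NonNegˢ (λ n → x n * y n)
  nn-* {x} {y} (i , bx) (j , by) hx hy k = hx l >>= λ ex → hy l >>= λ ey → return (ev-map body (ev-zip ex ey))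
    where
    l = i ℕ.+ (j ℕ.+ suc (suc k))
    l' = j ℕ.+ suc (suc k)
    δ = w l
    k2 = suc (suc k)
    mono : ∀ j k → w (j ℕ.+ k) ≤ w k
    mono zero k = ≤-refl
    mono (suc j) k = ≤-trans (w-dec (j ℕ.+ k)) (mono j k)
    iδ : pow i * δ ≤ w k2
    iδ = ≤-trans (≤-reflexive (pow*w i l')) (mono j k2)
    jδ : pow j * δ ≤ w k2
    jδ = ≤-trans (≤-reflexive (cong (λ z → pow j * w z) (trans (sym (ℕₚ.+-assoc i j k2)) (trans (cong (ℕ._+ k2) (ℕₚ.+-comm i j)) (ℕₚ.+-assoc j i k2)))))
          (≤-trans (≤-reflexive (pow*w j (i ℕ.+ k2))) (mono i k2))
    δδ : δ * δ ≤ w k2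
    δδ = ≤by ((w k2 - δ) + δ * (1ℚ - δ)) (0≤sub (≤-trans (mono i l') (mono j k2)) ⊕ (0≤w l ⊗ 0≤sub (w≤1 l)))
           (solve 2 (λ v d → v := d :* d :+ ((v :- d) :+ d :* (con 1ℚ :- d))) refl (w k2) δ)
    body : ∀ n → (- δ ≤ x n) × (- δ ≤ y n) → - w k ≤ x n * y n
    body n (p , q) = ≤by _
      (((0≤sub p ⊗ 0≤sub q) ⊕ ((0≤w l ⊗ 0≤sub (proj₂ (bx n))) ⊕ (0≤w l ⊗ 0≤sub (proj₂ (by n))))) ⊕ ((0≤sub iδ ⊕ 0≤sub jδ) ⊕ (0≤sub δδ ⊕ 0≤w k2)))
      (solve 6 (λ x y pi pj d v → x :* y := (:- v) :+
         (((x :- (:- d)) :* (y :- (:- d)) :+ (d :* (pi :- x) :+ d :* (pj :- y)))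
          :+ (((con ½ :* (con ½ :* v) :- pi :* d) :+ (con ½ :* (con ½ :* v) :- pj :* d))
          :+ ((con ½ :* (con ½ :* v) :- d :* d) :+ con ½ :* (con ½ :* v)))))
        refl (x n) (y n) (pow i) (pow j) δ (w k))

  -- If x is not non-negative, it is eventually below some fixed −w k.
  neg-witness : ∀ {x} → Cauchy x → ¬ NonNegˢ x → ¬ ¬ (∃ λ k → Eventually (λ n → x n ≤ - w k))
  neg-witness {x} cx h = ¬∀⇒¬¬∃¬ (λ k ¬¬¬ → λ nz → ¬¬¬ (λ f → f nz)) h >>= λ (k , nb) → cx (suc k) >>= λ (N , c) →
    λ ret → nb λ ne → decide k N c ne ret
    where
    decide : ∀ k N → (∀ m n → N ℕ.≤ m → N ℕ.≤ n → x m - x n ≤ w (suc k)) → ¬ Eventually (λ n → - w k ≤ x n) →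
             ¬ ¬ (∃ λ k → Eventually (λ n → x n ≤ - w k))
    decide k N c ne ret with - w (suc k) ≤? x N
    ... | yes p = ne (N , λ n N≤n → ≤by _ (0≤sub p ⊕ 0≤sub (c N n ℕₚ.≤-refl N≤n))
             (solve 3 (λ a b v → b := (:- v) :+ ((a :- (:- (con ½ :* v))) :+ (con ½ :* v :- (a :- b)))) refl (x N) (x n) (w k)))
    ... | no ¬p = cx (suc (suc k)) λ (M , c') → help M c'
      where
      help : ∀ M → (∀ m n → M ℕ.≤ m → M ℕ.≤ n → x m - x n ≤ w (suc (suc k))) → ⊥
      help M c' with - w (suc k) ≤? x (N ⊔ M)
      ... | yes p = ne (N ⊔ M , λ n N≤n → ≤by _ ((0≤sub p ⊕ 0≤sub (c (N ⊔ M) n (ℕₚ.m≤m⊔n N M) (ℕₚ.≤-trans (ℕₚ.m≤m⊔n N M) N≤n))))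
             (solve 3 (λ a b v → b := (:- v) :+ ((a :- (:- (con ½ :* v))) :+ (con ½ :* v :- (a :- b)))) refl (x (N ⊔ M)) (x n) (w k)))
      ... | no ¬p = ret (suc (suc k) , N ⊔ M , λ n N≤n → ≤by _ (0≤sub (<⇒≤ (≰⇒> ¬p)) ⊕ 0≤sub (c' n (N ⊔ M) (ℕₚ.≤-trans (ℕₚ.m≤n⊔m N M) N≤n) (ℕₚ.m≤n⊔m N M)))
             (solve 3 (λ a b v → :- (con ½ :* (con ½ :* v)) := b :+ ((:- (con ½ :* v) :- a) :+ (con ½ :* (con ½ :* v) :- (b :- a)))) refl (x (N ⊔ M)) (x n) (w k)))

  nn-resp : ∀ {x y : Seq} → (∀ n → x n ≡ y n) → NonNegˢ x → NonNegˢ y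
  nn-resp h p k = p k >>= λ e → return (ev-map (λ n → subst (- w k ≤_) (h n)) e)

  infix 4 _≈_
  record _≈_ (x y : ℝ) : Set where
    constructor eq
    field
      ge : NonNegˢ (λ n → seq x n - seq y n)
      le : NonNegˢ (λ n → seq y n - seq x n)

  pw : ∀ {x y} → (∀ n → seq x n ≡ seq y n) → x ≈ y
  pw {x} {y} h = eq (nn-pointwise λ n → 0≤sub (≤-reflexive (sym (h n)))) (nn-pointwise λ n → 0≤sub (≤-reflexive (h n)))

  ≈-trans : ∀ {x y z} → x ≈ y → y ≈ z → x ≈ z
  ≈-trans {x} {y} {z} (eq a b) (eq c d) = eq
    (nn-resp (λ n → solve 3 (λ x y z → (x :- y) :+ (y :- z) := x :- z) refl (seq x n) (seq y n) (seq z n)) (nn-+ a c))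
    (nn-resp (λ n → solve 3 (λ x y z → (y :- x) :+ (z :- y) := z :- x) refl (seq x n) (seq y n) (seq z n)) (nn-+ b d))

  constS : ℚ → Seq
  constS q _ = q

  bnd-+ : ∀ {x y} → Bounded x → Bounded y → Bounded (λ n → x n + y n)
  bnd-+ {x} {y} (i , bx) (j , by) = suc (i ℕ.+ j) , λ n →
    ≤by _ (((0≤sub (proj₁ (bx n))) ⊕ 0≤sub (proj₁ (by n))) ⊕ cert)
      (trans (solve 4 (λ x y a b → x :+ y := (:- (a :* b :+ a :* b)) :+ (((x :- (:- a)) :+ (y :- (:- b))) :+ ((a :- con 1ℚ) :* b :+ (b :- con 1ℚ) :* a))) refl (x n) (y n) (pow i) (pow j))
        (cong (λ z → (- (z + z)) + (((x n - (- pow i)) + (y n - (- pow j))) + ((pow i - 1ℚ) * pow j + (pow j - 1ℚ) * pow i))) (sym (pow-+ i j)))) ,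
    ≤by _ (((0≤sub (proj₂ (bx n))) ⊕ 0≤sub (proj₂ (by n))) ⊕ cert)
      (trans (cong (λ z → z + z) (pow-+ i j))
        (solve 4 (λ x y a b → (a :* b :+ a :* b) := (x :+ y) :+ (((a :- x) :+ (b :- y)) :+ ((a :- con 1ℚ) :* b :+ (b :- con 1ℚ) :* a))) refl (x n) (y n) (pow i) (pow j)))
    where
    cert : 0ℚ ≤ (pow i - 1ℚ) * pow j + (pow j - 1ℚ) * pow i
    cert = (0≤sub (pow≥1 i) ⊗ 0≤pow j) ⊕ (0≤sub (pow≥1 j) ⊗ 0≤pow i)

  prodBound : ∀ {a b A B} → - A ≤ a → a ≤ A → - B ≤ b → b ≤ B → a * b ≤ A * B
  prodBound {a} {b} {A} {B} a₁ a₂ b₁ b₂ = ≤by _ (0≤½ ⊗ ((0≤sub a₂ ⊗ 0≤sub b₁) ⊕ (0≤sub a₁ ⊗ 0≤sub b₂)))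
    (solve 4 (λ a b A B → A :* B := a :* b :+ con ½ :* ((A :- a) :* (b :- (:- B)) :+ (a :- (:- A)) :* (B :- b))) refl a b A B)

  neg-≤ : ∀ {a A} → - A ≤ a → - a ≤ A
  neg-≤ {a} {A} h = ≤by _ (0≤sub h) (solve 2 (λ a A → A := (:- a) :+ (a :- (:- A))) refl a A)

  neg-≥ : ∀ {a A} → a ≤ A → - A ≤ - a
  neg-≥ = ℚₚ.neg-antimono-≤

  bnd-* : ∀ {x y} → Bounded x → Bounded y → Bounded (λ n → x n * y n)
  bnd-* {x} {y} (i , bx) (j , by) = i ℕ.+ j , λ n →
    subst (λ z → - z ≤ x n * y n) (sym (pow-+ i j)) (≤-trans (neg-≥ (prodBound (neg-≥ (proj₂ (bx n))) (neg-≤ (proj₁ (bx n))) (proj₁ (by n)) (proj₂ (by n))))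
       (≤-reflexive (solve 2 (λ x y → :- ((:- x) :* y) := x :* y) refl (x n) (y n)))) ,
    subst (x n * y n ≤_) (sym (pow-+ i j)) (prodBound (proj₁ (bx n)) (proj₂ (bx n)) (proj₁ (by n)) (proj₂ (by n)))

  infixl 6 _+ᵣ_
  infixl 7 _*ᵣ_
  constR : (q : ℚ) → - 1ℚ ≤ q → q ≤ 1ℚ → ℝ
  constR q a b = mk (constS q) (0 , λ _ → a , b) λ k → return (0 , λ _ _ _ _ → ≤-trans (≤-reflexive (solve 1 (λ q → q :- q := con 0ℚ) refl q)) (0≤w k))

  0ᵣ 1ᵣ : ℝ
  0ᵣ = constR 0ℚ (ℚₚ.nonPositive⁻¹ (- 1ℚ)) 0≤1
  1ᵣ = constR 1ℚ (≤-trans (ℚₚ.nonPositive⁻¹ (- 1ℚ)) 0≤1) ≤-refl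

  _+ᵣ_ : ℝ → ℝ → ℝ
  seq (x +ᵣ y) n = seq x n + seq y n
  bnd (x +ᵣ y) = bnd-+ (bnd x) (bnd y)
  cau (x +ᵣ y) k = cau x (suc k) >>= λ (N , f) → cau y (suc k) >>= λ (M , g) → return (N ⊔ M , λ m n p q →
    ≤by _ (0≤sub (f m n (ℕₚ.≤-trans (ℕₚ.m≤m⊔n N M) p) (ℕₚ.≤-trans (ℕₚ.m≤m⊔n N M) q)) ⊕ 0≤sub (g m n (ℕₚ.≤-trans (ℕₚ.m≤n⊔m N M) p) (ℕₚ.≤-trans (ℕₚ.m≤n⊔m N M) q)))
      (solve 5 (λ a b c d v → v := (a :+ c :- (b :+ d)) :+ ((con ½ :* v :- (a :- b)) :+ (con ½ :* v :- (c :- d)))) refl (seq x m) (seq x n) (seq y m) (seq y n) (w k)))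

  -ᵣ_ : ℝ → ℝ
  seq (-ᵣ x) n = - seq x n
  bnd (-ᵣ x) = proj₁ (bnd x) , λ n → neg-≥ (proj₂ (proj₂ (bnd x) n)) , neg-≤ (proj₁ (proj₂ (bnd x) n))
  cau (-ᵣ x) k = cau x k >>= λ (N , f) → return (N , λ m n p q → ≤-trans (≤-reflexive (solve 2 (λ a b → (:- a) :- (:- b) := b :- a) refl (seq x m) (seq x n))) (f n m q p))

  _*ᵣ_ : ℝ → ℝ → ℝ
  seq (x *ᵣ y) n = seq x n * seq y n
  bnd (x *ᵣ y) = bnd-* (bnd x) (bnd y)
  cau (x *ᵣ y) k with bnd x | bnd y
  ... | i , bx | j , by = cau x (j ℕ.+ suc k) >>= λ (N , f) → cau y (i ℕ.+ suc k) >>= λ (M , g) → return (N ⊔ M , λ m n p q →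
    let p1 = ℕₚ.≤-trans (ℕₚ.m≤m⊔n N M) p ; q1 = ℕₚ.≤-trans (ℕₚ.m≤m⊔n N M) q
        p2 = ℕₚ.≤-trans (ℕₚ.m≤n⊔m N M) p ; q2 = ℕₚ.≤-trans (ℕₚ.m≤n⊔m N M) q
        h1 = prodBound (neg-≥' {seq x n} (f n m q1 p1)) (f m n p1 q1) (proj₁ (by m)) (proj₂ (by m))
        h2 = prodBound (neg-≥' {seq y n} (g n m q2 p2)) (g m n p2 q2) (proj₁ (bx n)) (proj₂ (bx n))
        e1 = trans (ℚₚ.*-comm (w (j ℕ.+ suc k)) (pow j)) (pow*w j (suc k))
        e2 = trans (ℚₚ.*-comm (w (i ℕ.+ suc k)) (pow i)) (pow*w i (suc k))
    in ≤by _ (0≤sub (≤-trans h1 (≤-reflexive e1)) ⊕ 0≤sub (≤-trans h2 (≤-reflexive e2)))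
      (solve 5 (λ a b c d v → v := (a :* c :- b :* d) :+ ((con ½ :* v :- (a :- b) :* c) :+ (con ½ :* v :- (c :- d) :* b))) refl (seq x m) (seq x n) (seq y m) (seq y n) (w k)))
    where
    neg-≥' : ∀ {a b A} → a - b ≤ A → - A ≤ b - a
    neg-≥' {a} {b} {A} h = ≤-trans (neg-≥ h) (≤-reflexive (solve 2 (λ a b → :- (a :- b) := b :- a) refl a b))

  -- The sign of y is unknown, so y is shifted by its bound: z y = z (y + 2^j) + (-z) 2^j is a sum
  -- of products of nonnegative factors.
  null-* : ∀ {z} (y : Seq) → Bounded z → Bounded y → NonNegˢ z → NonNegˢ (λ n → - z n) → NonNegˢ (λ n → z n * y n)
  null-* {z} y (i , bz) (j , by) p q = nn-resp (λ n → solve 3 (λ z y b → z :* (y :- (:- b)) :+ (:- z) :* b := z :* y) refl (z n) (y n) (pow j))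
    (nn-+ (nn-* (i , bz) (bnd-+ {y} {constS (- (- pow j))} (j , by) (j , λ n → pj)) p (nn-pointwise λ n → 0≤sub (proj₁ (by n))))
          (nn-* (i , λ n → neg-≥ (proj₂ (bz n)) , neg-≤ (proj₁ (bz n))) (j , λ n → pj') q (nn-pointwise λ n → 0≤pow j)))
    where
    pj' : (- pow j ≤ pow j) × (pow j ≤ pow j)
    pj' = ≤-trans (neg-≥ (0≤pow j)) (0≤pow j) , ≤-refl
    pj : (- pow j ≤ - (- pow j)) × (- (- pow j) ≤ pow j)
    pj = subst (λ z → (- pow j ≤ z) × (z ≤ pow j)) (solve 1 (λ a → a := :- (:- a)) refl (pow j)) pj'

  *-cong : ∀ {x x' y y'} → x ≈ x' → y ≈ y' → x *ᵣ y ≈ x' *ᵣ y'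
  *-cong {x} {x'} {y} {y'} (eq a b) (eq c d) = eq
    (nn-resp (λ n → e1 (seq x n) (seq x' n) (seq y n) (seq y' n)) (nn-+ (null-* (seq y) (bnd (x +ᵣ (-ᵣ x'))) (bnd y) a (nn-resp (λ n → neg' (seq x n) (seq x' n)) b))
         (null-* (seq x') (bnd (y +ᵣ (-ᵣ y'))) (bnd x') c (nn-resp (λ n → neg' (seq y n) (seq y' n)) d))))
    (nn-resp (λ n → e1 (seq x' n) (seq x n) (seq y' n) (seq y n)) (nn-+ (null-* (seq y') (bnd (x' +ᵣ (-ᵣ x))) (bnd y') b (nn-resp (λ n → neg' (seq x' n) (seq x n)) a))
         (null-* (seq x) (bnd (y' +ᵣ (-ᵣ y))) (bnd x) d (nn-resp (λ n → neg' (seq y' n) (seq y n)) c))))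
    where
    e1 : ∀ a b c d → (a - b) * c + (c - d) * b ≡ a * c - b * d
    e1 = solve 4 (λ a b c d → (a :- b) :* c :+ (c :- d) :* b := a :* c :- b :* d) refl
    neg' : ∀ a b → b - a ≡ - (a - b)
    neg' = solve 2 (λ a b → b :- a := :- (a :- b)) refl

  +-cong : ∀ {x x' y y'} → x ≈ x' → y ≈ y' → x +ᵣ y ≈ x' +ᵣ y'
  +-cong {x} {x'} {y} {y'} (eq a b) (eq c d) = eq
    (nn-resp (λ n → e (seq x n) (seq x' n) (seq y n) (seq y' n)) (nn-+ a c))
    (nn-resp (λ n → e (seq x' n) (seq x n) (seq y' n) (seq y n)) (nn-+ b d))
    where
    e : ∀ a b c d → (a - b) + (c - d) ≡ (a + c) - (b + d)
    e = solve 4 (λ a b c d → (a :- b) :+ (c :- d) := (a :+ c) :- (b :+ d)) refl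

  -‿cong : ∀ {x x'} → x ≈ x' → -ᵣ x ≈ -ᵣ x'
  -‿cong {x} {x'} (eq a b) = eq (nn-resp (λ n → e (seq x n) (seq x' n)) b) (nn-resp (λ n → e (seq x' n) (seq x n)) a)
    where
    e : ∀ a b → b - a ≡ (- a) - (- b)
    e = solve 2 (λ a b → b :- a := (:- a) :- (:- b)) refl

  ringℝ : CommutativeRing 0ℓ 0ℓ
  ringℝ = record
    { Carrier = ℝ ; _≈_ = _≈_ ; _+_ = _+ᵣ_ ; _*_ = _*ᵣ_ ; -_ = -ᵣ_ ; 0# = 0ᵣ ; 1# = 1ᵣ
    ; isCommutativeRing = record
      { isRing = record
        { +-isAbelianGroup = record
          { isGroup = record
            { isMonoid = record
              { isSemigroup = record
                { isMagma = record { isEquivalence = record { refl = pw λ _ → refl ; sym = λ (eq a b) → eq b a ; trans = ≈-trans } ; ∙-cong = +-cong }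
                ; assoc = λ x y z → pw λ n → ℚₚ.+-assoc (seq x n) (seq y n) (seq z n) }
              ; identity = (λ x → pw λ n → ℚₚ.+-identityˡ (seq x n)) , (λ x → pw λ n → ℚₚ.+-identityʳ (seq x n)) }
            ; inverse = (λ x → pw λ n → ℚₚ.+-inverseˡ (seq x n)) , (λ x → pw λ n → ℚₚ.+-inverseʳ (seq x n))
            ; ⁻¹-cong = -‿cong }
          ; comm = λ x y → pw λ n → ℚₚ.+-comm (seq x n) (seq y n) }
        ; *-cong = *-cong
        ; *-assoc = λ x y z → pw λ n → ℚₚ.*-assoc (seq x n) (seq y n) (seq z n)
        ; *-identity = (λ x → pw λ n → ℚₚ.*-identityˡ (seq x n)) , (λ x → pw λ n → ℚₚ.*-identityʳ (seq x n))
        ; distrib = (λ x y z → pw λ n → ℚₚ.*-distribˡ-+ (seq x n) (seq y n) (seq z n)) , (λ x y z → pw λ n → ℚₚ.*-distribʳ-+ (seq x n) (seq y n) (seq z n)) }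
      ; *-comm = λ x y → pw λ n → ℚₚ.*-comm (seq x n) (seq y n) } }

-- Ordered integral domains and Chebyshev values.

module OrderedDomains where
  open import Level using (0ℓ) renaming (suc to lsuc)
  open import Algebra.Bundles using (CommutativeRing)
  open import Data.Nat as ℕ using (ℕ; zero; suc)
  import Data.Nat.Properties as ℕₚ
  open import Data.Integer as ℤ using (ℤ; +_; -[1+_])
  import Data.Integer.Properties as ℤₚ
  open import Data.Product using (Σ; _×_; _,_; proj₁; proj₂)
  open import Data.Sum using (_⊎_; inj₁; inj₂)
  open import Data.Maybe using (Maybe; just; nothing)
  open import Relation.Nullary using (¬_; yes; no)
  import Relation.Binary.PropositionalEquality as ≡
  open ≡ using (_≡_)
  open DoubleNegation
  import Algebra.Solver.Ring as RS
  import Algebra.Solver.Ring.AlmostCommutativeRing as ACR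

  -- The ring solver wants coefficients with a usable equality test; integers provide them for an
  -- arbitrary commutative ring.
  module IntSolver (R : CommutativeRing 0ℓ 0ℓ) where
    open CommutativeRing R hiding (zero)
    open import Algebra.Properties.Semiring.Mult semiring using (×-homo-+; ×1-homo-*) renaming (_×_ to infixr 8 _·_)
    open import Algebra.Properties.Ring ring using (-‿distribˡ-*; -‿distribʳ-*; -‿involutive; -0#≈0#)
    open import Algebra.Properties.AbelianGroup +-abelianGroup using (⁻¹-∙-comm)
    open import Relation.Binary.Reasoning.Setoid setoid

    ι : ℤ → Carrier
    ι (+ n) = n · 1#
    ι (-[1+ n ]) = - (suc n · 1#)

    ι-neg : ∀ i → ι (ℤ.- i) ≈ - ι i
    ι-neg (+ zero) = sym -0#≈0#
    ι-neg (+ suc n) = refl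
    ι-neg (-[1+ n ]) = sym (-‿involutive _)

    cancel-1# : ∀ a b → (1# + a) + - (1# + b) ≈ a + - b
    cancel-1# a b = begin
      (1# + a) + - (1# + b) ≈⟨ +-congˡ (sym (⁻¹-∙-comm 1# b)) ⟩
      (1# + a) + (- 1# + - b) ≈⟨ +-congʳ (+-comm 1# a) ⟩
      (a + 1#) + (- 1# + - b) ≈⟨ +-assoc a 1# _ ⟩
      a + (1# + (- 1# + - b)) ≈⟨ +-congˡ (sym (+-assoc 1# (- 1#) (- b))) ⟩
      a + ((1# + - 1#) + - b) ≈⟨ +-congˡ (+-congʳ (-‿inverseʳ 1#)) ⟩
      a + (0# + - b) ≈⟨ +-congˡ (+-identityˡ _) ⟩
      a + - b ∎

    ι-⊖ : ∀ m n → ι (m ℤ.⊖ n) ≈ m · 1# + - (n · 1#)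
    ι-⊖ m zero = sym (trans (+-congˡ -0#≈0#) (+-identityʳ _))
    ι-⊖ zero (suc n) = sym (+-identityˡ _)
    ι-⊖ (suc m) (suc n) = trans (reflexive (≡.cong ι (ℤₚ.[1+m]⊖[1+n]≡m⊖n m n))) (trans (ι-⊖ m n) (sym (cancel-1# _ _)))

    ι-+ : ∀ i j → ι (i ℤ.+ j) ≈ ι i + ι j
    ι-+ (+ m) (+ n) = ×-homo-+ 1# m n
    ι-+ (+ m) (-[1+ n ]) = ι-⊖ m (suc n)
    ι-+ (-[1+ m ]) (+ n) = trans (ι-⊖ n (suc m)) (+-comm _ _)
    ι-+ (-[1+ m ]) (-[1+ n ]) = begin
      - (suc (suc (m ℕ.+ n)) · 1#) ≈⟨ -‿cong (reflexive (≡.cong (λ k → suc k · 1#) (≡.sym (ℕₚ.+-suc m n)))) ⟩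
      - ((suc m ℕ.+ suc n) · 1#) ≈⟨ -‿cong (×-homo-+ 1# (suc m) (suc n)) ⟩
      - (suc m · 1# + suc n · 1#) ≈⟨ sym (⁻¹-∙-comm _ _) ⟩
      - (suc m · 1#) + - (suc n · 1#) ∎

    ι-*⁺ : ∀ m j → ι (+ m ℤ.* j) ≈ m · 1# * ι j
    ι-*⁺ m (+ n) = trans (reflexive (≡.cong ι (≡.sym (ℤₚ.pos-* m n)))) (×1-homo-* m n)
    ι-*⁺ m (-[1+ n ]) = begin
      ι (+ m ℤ.* -[1+ n ]) ≈⟨ reflexive (≡.cong ι (≡.sym (ℤₚ.neg-distribʳ-* (+ m) (+ suc n)))) ⟩
      ι (ℤ.- (+ m ℤ.* + suc n)) ≈⟨ ι-neg (+ m ℤ.* + suc n) ⟩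
      - ι (+ m ℤ.* + suc n) ≈⟨ -‿cong (ι-*⁺ m (+ suc n)) ⟩
      - (m · 1# * (suc n · 1#)) ≈⟨ -‿distribʳ-* _ _ ⟩
      m · 1# * - (suc n · 1#) ∎

    ι-* : ∀ i j → ι (i ℤ.* j) ≈ ι i * ι j
    ι-* (+ m) j = ι-*⁺ m j
    ι-* (-[1+ m ]) j = begin
      ι (-[1+ m ] ℤ.* j) ≈⟨ reflexive (≡.cong ι (≡.sym (ℤₚ.neg-distribˡ-* (+ suc m) j))) ⟩
      ι (ℤ.- (+ suc m ℤ.* j)) ≈⟨ ι-neg (+ suc m ℤ.* j) ⟩
      - ι (+ suc m ℤ.* j) ≈⟨ -‿cong (ι-*⁺ (suc m) j) ⟩
      - (suc m · 1# * ι j) ≈⟨ -‿distribˡ-* _ _ ⟩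
      - (suc m · 1#) * ι j ∎

    private
      ℤraw = ACR.AlmostCommutativeRing.rawRing (ACR.fromCommutativeRing ℤₚ.+-*-commutativeRing)
      AR = ACR.fromCommutativeRing R
      -- agrees with ι, but sends 0 and 1 definitionally to 0# and 1#
      ι′ : ℤ → Carrier
      ι′ (+ 0) = 0#
      ι′ (+ 1) = 1#
      ι′ (+ suc (suc n)) = ι (+ suc (suc n))
      ι′ (-[1+ n ]) = ι -[1+ n ]
      ι≈ : ∀ i → ι′ i ≈ ι i
      ι≈ (+ 0) = refl
      ι≈ (+ 1) = sym (+-identityʳ 1#)
      ι≈ (+ suc (suc n)) = refl
      ι≈ (-[1+ n ]) = refl
      hom : ℤraw ACR.-Raw-AlmostCommutative⟶ AR
      hom = record
        { ⟦_⟧ = ι′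
        ; +-homo = λ i j → trans (ι≈ (i ℤ.+ j)) (trans (ι-+ i j) (sym (+-cong (ι≈ i) (ι≈ j))))
        ; *-homo = λ i j → trans (ι≈ (i ℤ.* j)) (trans (ι-* i j) (sym (*-cong (ι≈ i) (ι≈ j))))
        ; -‿homo = λ i → trans (ι≈ (ℤ.- i)) (trans (ι-neg i) (sym (-‿cong (ι≈ i))))
        ; 0-homo = refl ; 1-homo = refl }
      dec : ∀ i j → Maybe (ι′ i ≈ ι′ j)
      dec i j with i ℤ.≟ j
      ... | yes p = just (reflexive (≡.cong ι′ p))
      ... | no _ = nothing
    open RS ℤraw AR hom dec public
      using (solve; _:=_; _:+_; _:*_; _:-_; :-_; con; Polynomial)

  chebyshev : (R : CommutativeRing 0ℓ 0ℓ) → CommutativeRing.Carrier R → ℕ → CommutativeRing.Carrier R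
  chebyshev R c zero = CommutativeRing.0# R
  chebyshev R c (suc zero) = CommutativeRing.1# R
  chebyshev R c (suc (suc k)) = c * chebyshev R c (suc k) - chebyshev R c k
    where open CommutativeRing R

  -- `total` is doubly negated because signs of reals are undecidable. `Pos-*` is the domain
  -- property: `nn-*` alone would let a product of positive elements vanish.
  record OrderedDomain : Set₁ where
    field
      ring : CommutativeRing 0ℓ 0ℓ
    open CommutativeRing ring public renaming (Carrier to K; ring to ring')
    field
      NonNeg : K → Set
      nn-stable : ∀ {x} → ¬ ¬ NonNeg x → NonNeg x
      nn-resp : ∀ {x y} → x ≈ y → NonNeg x → NonNeg y
      nn-+ : ∀ {x y} → NonNeg x → NonNeg y → NonNeg (x + y)
      nn-* : ∀ {x y} → NonNeg x → NonNeg y → NonNeg (x * y)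
      nn-1 : NonNeg 1#
      antisym : ∀ {x} → NonNeg x → NonNeg (- x) → x ≈ 0#
      total : ∀ x → ¬ ¬ (NonNeg x ⊎ NonNeg (- x))
      1≉0 : ¬ (1# ≈ 0#)
      half : K
      half+half : half + half ≈ 1#
      Pos-* : ∀ {x y} → ¬ NonNeg (- x) → ¬ NonNeg (- y) → ¬ NonNeg (- (x * y))

  -- The value c = 2 cos(π/n), described by chebyshev c k = sin(kπ/n)/sin(π/n).
  record TwiceCos (D : OrderedDomain) (n : ℕ) : Set where
    open OrderedDomain D
    V : K → ℕ → K
    V = chebyshev ring
    field
      c : K
      V-nn : ∀ k → k ℕ.≤ n → NonNeg (V c k)
      V-n : V c n ≈ 0#

  module OD (D : OrderedDomain) where
    open OrderedDomain D public
    open IntSolver ring public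
    open import Relation.Binary.Reasoning.Setoid setoid

    Pos : K → Set
    Pos x = ¬ NonNeg (- x)

    private
      :0 :1 : ∀ {n} → Polynomial n
      :0 = con (+ 0)
      :1 = con (+ 1)

    nn-0 : NonNeg 0#
    nn-0 = nn-stable λ k → total 0# λ { (inj₁ p) → k p ; (inj₂ p) → k (nn-resp (solve 0 (:- :0 := :0) refl) p) }

    Pos-resp : ∀ {x y} → x ≈ y → Pos x → Pos y
    Pos-resp e p n = p (nn-resp (-‿cong (sym e)) n)

    ≈-stable : ∀ {x y} → ¬ ¬ (x ≈ y) → x ≈ y
    ≈-stable {x} {y} h = begin
      x ≈⟨ solve 2 (λ x y → x := y :+ (x :- y)) refl x y ⟩
      y + (x - y) ≈⟨ +-congˡ z ⟩
      y + 0# ≈⟨ +-identityʳ y ⟩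
      y ∎
      where
      z : x - y ≈ 0#
      z = antisym (nn-stable λ k → h λ e → k (nn-resp (trans (sym (-‿inverseʳ y)) (+-congʳ (sym e))) nn-0))
                  (nn-stable λ k → h λ e → k (nn-resp (trans (solve 1 (λ y → :0 := :- (y :- y)) refl y) (-‿cong (+-congʳ (sym e)))) nn-0))

    Pos⇒NN : ∀ {x} → Pos x → NonNeg x
    Pos⇒NN {x} p = nn-stable λ k → total x λ { (inj₁ q) → k q ; (inj₂ q) → p q }

    Pos⇒≉0 : ∀ {x} → Pos x → ¬ (x ≈ 0#)
    Pos⇒≉0 p e = p (nn-resp (trans (solve 0 (:0 := :- :0) refl) (-‿cong (sym e))) nn-0)

    NN≉0⇒Pos : ∀ {x} → NonNeg x → ¬ (x ≈ 0#) → Pos x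
    NN≉0⇒Pos p h n = h (antisym p n)

    Pos-1 : Pos 1#
    Pos-1 = NN≉0⇒Pos nn-1 1≉0

    Pos-+ : ∀ {x y} → Pos x → NonNeg y → Pos (x + y)
    Pos-+ {x} {y} p q n = p (nn-resp (solve 2 (λ x y → :- (x :+ y) :+ y := :- x) refl x y) (nn-+ n q))

    Pos-neg : ∀ {x} → Pos x → ¬ Pos (- x)
    Pos-neg p q = q (nn-resp (solve 1 (λ x → x := :- (:- x)) refl _) (Pos⇒NN p))

    trichotomy : ∀ x → ¬ ¬ (Pos x ⊎ (x ≈ 0#) ⊎ Pos (- x))
    trichotomy x = total x >>= λ
      { (inj₁ p) → lem >>= λ { (inj₁ z) → return (inj₂ (inj₁ z)) ; (inj₂ nz) → return (inj₁ (NN≉0⇒Pos p nz)) }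
      ; (inj₂ p) → lem >>= λ { (inj₁ z) → return (inj₂ (inj₁ z))
          ; (inj₂ nz) → return (inj₂ (inj₂ (NN≉0⇒Pos p λ e → nz (trans (solve 1 (λ x → x := :- (:- x)) refl x) (trans (-‿cong e) (solve 0 (:- :0 := :0) refl)))))) } }

    *-≉0 : ∀ {x y} → ¬ (x ≈ 0#) → ¬ (y ≈ 0#) → ¬ (x * y ≈ 0#)
    *-≉0 {x} {y} hx hy e = trichotomy x λ
      { (inj₂ (inj₁ z)) → hx z
      ; (inj₁ px) → trichotomy y λ { (inj₂ (inj₁ z)) → hy z ; (inj₁ py) → go px py e
           ; (inj₂ (inj₂ py)) → go px py (neg (solve 2 (λ x y → x :* (:- y) := :- (x :* y)) refl x y)) }
      ; (inj₂ (inj₂ px)) → trichotomy y λ { (inj₂ (inj₁ z)) → hy z ; (inj₁ py) → go px py (neg (solve 2 (λ x y → (:- x) :* y := :- (x :* y)) refl x y))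
           ; (inj₂ (inj₂ py)) → go px py (trans (solve 2 (λ x y → (:- x) :* (:- y) := x :* y) refl x y) e) } }
      where
      go : ∀ {a b} → Pos a → Pos b → ¬ (a * b ≈ 0#)
      go pa pb = Pos⇒≉0 (Pos-* pa pb)
      neg : ∀ {z} → z ≈ - (x * y) → z ≈ 0#
      neg h = trans h (trans (-‿cong e) (solve 0 (:- :0 := :0) refl))

    *-cancel-0 : ∀ {x y} → ¬ (x ≈ 0#) → x * y ≈ 0# → y ≈ 0#
    *-cancel-0 hx e = ≈-stable λ hy → *-≉0 hx hy e

    nn-sum0 : ∀ {x y} → NonNeg x → NonNeg y → x + y ≈ 0# → x ≈ 0#
    nn-sum0 {x} {y} px py e = antisym px (nn-resp y≈ py)
      where
      y≈ : y ≈ - x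
      y≈ = begin
        y ≈⟨ solve 2 (λ x y → y := (x :+ y) :- x) refl x y ⟩
        (x + y) - x ≈⟨ +-congʳ e ⟩
        0# - x ≈⟨ +-identityˡ _ ⟩
        - x ∎

    V : K → ℕ → K
    V = chebyshev ring

    V-cong : ∀ {c c'} → c ≈ c' → ∀ k → V c k ≈ V c' k
    V-cong e zero = refl
    V-cong e (suc zero) = refl
    V-cong e (suc (suc k)) = +-cong (*-cong e (V-cong e (suc k))) (-‿cong (V-cong e k))

    -- This quadratic form in two consecutive values is invariant under the recursion and equals 1
    -- at the start.
    V-det : ∀ c k → V c (suc k) * V c (suc k) - c * V c (suc k) * V c k + V c k * V c k ≈ 1#
    V-det c zero = solve 1 (λ c → :1 :* :1 :- c :* :1 :* :0 :+ :0 :* :0 := :1) refl c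
    V-det c (suc k) = trans (solve 3 (λ c a b → (c :* a :- b) :* (c :* a :- b) :- c :* (c :* a :- b) :* a :+ a :* a := a :* a :- c :* a :* b :+ b :* b) refl c (V c (suc k)) (V c k)) (V-det c k)

    V-not-both : ∀ c k → V c (suc k) ≈ 0# → ¬ (V c k ≈ 0#)
    V-not-both c k p q = 1≉0 (trans (sym (V-det c k)) (trans (+-cong (+-cong (*-cong p p) (-‿cong (*-cong (*-congˡ p) q))) (*-cong q q))
      (solve 1 (λ c → :0 :* :0 :- c :* :0 :* :0 :+ :0 :* :0 := :0) refl c)))

    -- At an interior zero the two neighbours are nonnegative with sum zero, so the left one
    -- vanishes as well, against `V-not-both`.
    V-interior-pos : ∀ c n → (∀ k → k ℕ.≤ n → NonNeg (V c k)) → ¬ (V c n ≈ 0#) → ∀ k → suc k ℕ.≤ n → Pos (V c (suc k))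
    V-interior-pos c n nn nz k h with ℕₚ.m≤n⇒m<n∨m≡n h
    ... | inj₂ ≡.refl = NN≉0⇒Pos (nn n ℕₚ.≤-refl) nz
    ... | inj₁ lt = NN≉0⇒Pos (nn (suc k) h) λ e → V-not-both c k e
         (nn-sum0 (nn k (ℕₚ.≤-trans (ℕₚ.n≤1+n k) h)) (nn (suc (suc k)) lt) (begin
           V c k + (c * V c (suc k) - V c k) ≈⟨ solve 2 (λ v x → v :+ (x :- v) := x) refl (V c k) (c * V c (suc k)) ⟩
           c * V c (suc k) ≈⟨ *-congˡ e ⟩
           c * 0# ≈⟨ zeroʳ c ⟩
           0# ∎))

    -- At c = 2 the recursion counts the natural numbers. This value belongs to infinite order, and
    -- it is also the one that `4-c²` has to exclude.
    V2 : ∀ k → (V (1# + 1#) (suc k) ≈ V (1# + 1#) k + 1#) × NonNeg (V (1# + 1#) k)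
    V2 zero = sym (+-identityˡ 1#) , nn-0
    V2 (suc k) with V2 k
    ... | e , p = (begin
      (1# + 1#) * V (1# + 1#) (suc k) - V (1# + 1#) k ≈⟨ +-congʳ (*-congˡ e) ⟩
      (1# + 1#) * (V (1# + 1#) k + 1#) - V (1# + 1#) k ≈⟨ solve 1 (λ v → (:1 :+ :1) :* (v :+ :1) :- v := (v :+ :1) :+ :1) refl (V (1# + 1#) k) ⟩
      (V (1# + 1#) k + 1#) + 1# ≈⟨ +-congʳ (sym e) ⟩
      V (1# + 1#) (suc k) + 1# ∎) , nn-resp (sym e) (nn-+ p nn-1)

    V2-pos : ∀ k → Pos (V (1# + 1#) (suc k))
    V2-pos k = Pos-resp (trans (+-comm _ _) (sym (proj₁ (V2 k)))) (Pos-+ Pos-1 (proj₂ (V2 k)))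
    module Cos {n : ℕ} (T : TwiceCos D (suc (suc n))) where
      open TwiceCos T public hiding (V)

      c-nn : NonNeg c
      c-nn = nn-resp (solve 1 (λ c → c :* :1 :- :0 := c) refl c) (V-nn 2 (ℕ.s≤s (ℕ.s≤s ℕ.z≤n)))

      -- As the next value vanishes, the invariant of `V-det` reads v² = 1, and v + 1 is positive
      -- because v is nonnegative.
      V-last : V c (suc n) ≈ 1#
      V-last = ≈-stable λ h → *-≉0 {V c (suc n) - 1#} {V c (suc n) + 1#} (λ e → h (begin
          v ≈⟨ solve 1 (λ v → v := (v :- :1) :+ :1) refl v ⟩
          (v - 1#) + 1# ≈⟨ +-congʳ e ⟩
          0# + 1# ≈⟨ +-identityˡ 1# ⟩
          1# ∎))
        (Pos⇒≉0 (Pos-resp (+-comm _ _) (Pos-+ Pos-1 (V-nn (suc n) (ℕₚ.n≤1+n _)))))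
        (begin
          (v - 1#) * (v + 1#) ≈⟨ solve 3 (λ c v u → (v :- :1) :* (v :+ :1) := (u :* u :- c :* u :* v :+ v :* v) :- :1 :- u :* (u :- c :* v)) refl c v u ⟩
          (u * u - c * u * v + v * v) - 1# - u * (u - c * v) ≈⟨ +-cong (+-congʳ (V-det c (suc n))) (-‿cong (*-congʳ V-n)) ⟩
          1# - 1# - 0# * (u - c * v) ≈⟨ solve 1 (λ z → :1 :- :1 :- :0 :* z := :0) refl (u - c * v) ⟩
          0# ∎)
        where v = V c (suc n)
              u = V c (suc (suc n))

      -- Since c is nonnegative, only c = 2 is at stake, and there the value required to vanish is
      -- positive.
      4-c² : ¬ ((1# + 1#) * (1# + 1#) - c * c ≈ 0#)
      4-c² e = Pos⇒≉0 (V2-pos (suc n)) (trans (V-cong (sym c≈2) (suc (suc n))) V-n)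
        where
        P : Pos (1# + 1# + c)
        P = Pos-+ (Pos-+ Pos-1 nn-1) c-nn
        d0 : (1# + 1#) - c ≈ 0#
        d0 = *-cancel-0 {1# + 1# + c} (Pos⇒≉0 P) (trans (solve 1 (λ c → (:1 :+ :1 :+ c) :* ((:1 :+ :1) :- c) := (:1 :+ :1) :* (:1 :+ :1) :- c :* c) refl c) e)
        c≈2 : c ≈ 1# + 1#
        c≈2 = begin
          c ≈⟨ solve 1 (λ c → c := (:1 :+ :1) :- ((:1 :+ :1) :- c)) refl c ⟩
          (1# + 1#) - ((1# + 1#) - c) ≈⟨ +-congˡ (-‿cong d0) ⟩
          (1# + 1#) - 0# ≈⟨ solve 0 ((:1 :+ :1) :- :0 := :1 :+ :1) refl ⟩
          1# + 1# ∎

  OrderedDomainWithCosines : Set₁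
  OrderedDomainWithCosines = Σ OrderedDomain λ D → ∀ n → TwiceCos D (suc (suc n))

open OrderedDomains using (OrderedDomain; OrderedDomainWithCosines)

-- Construction of 2 cos(π/n) by bisection.

module Cosines where
  open import Data.Nat as ℕ using (ℕ; zero; suc; _⊔_)
  import Data.Nat.Properties as ℕₚ
  open import Data.Rational using (ℚ; 0ℚ; 1ℚ; ½; _+_; _*_; -_; _-_; _≤_; _<_; _≤?_)
  open import Data.Rational.Properties as ℚₚ using (≤-refl; ≤-trans; ≤-reflexive; +-mono-≤)
  open import Data.Rational.Solver using (module +-*-Solver)
  open +-*-Solver using (solve; _:=_; _:+_; _:*_; :-_; con; _:-_)
  open import Data.Product using (Σ; _×_; _,_; proj₁; proj₂)
  open import Data.Sum using (_⊎_; inj₁; inj₂)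
  open import Data.Empty using (⊥)
  open import Relation.Nullary using (¬_; Dec; yes; no; ¬?)
  open import Relation.Binary.PropositionalEquality using (_≡_; refl; sym; trans; cong; cong₂; subst)
  open DoubleNegation
  open Reals
  open OrderedDomains

  2ℚ : ℚ
  2ℚ = 1ℚ + 1ℚ

  private
    NN : ℝ → Set
    NN x = NonNegˢ (seq x)

    above-0 : ∀ {a} k → - a ≤ - w k → ¬ (a ≤ 0ℚ)
    above-0 {a} k h g = 0<w k (≤-trans (≤by _ (0≤sub h) (solve 2 (λ a w → a := w :+ ((:- w) :- (:- a))) refl a (w k))) g)

  nn-respᵣ : ∀ {x y} → x ≈ y → NN x → NN y
  nn-respᵣ {x} {y} e p = nn-resp (λ n → solve 2 (λ x y → x :+ (y :- x) := y) refl (seq x n) (seq y n)) (nn-+ p (_≈_.le e))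

  contra : ∀ k {x : Seq} → Eventually (λ n → x n ≤ - w k) → Eventually (λ n → - w (suc k) ≤ x n) → ⊥
  contra k {x} (N , f) (M , g) = 0<w (suc k) (≤by _ (0≤sub (≤-trans (g (N ⊔ M) (ℕₚ.m≤n⊔m N M)) (f (N ⊔ M) (ℕₚ.m≤m⊔n N M))))
    (solve 1 (λ v → con 0ℚ := con ½ :* v :+ ((:- v) :- (:- (con ½ :* v)))) refl (w k)))

  ℝ-domain : OrderedDomain
  ℝ-domain = record
    { ring = ringℝ
    ; NonNeg = NN
    ; nn-stable = λ h k z → h λ p → p k z
    ; nn-resp = λ {x} {y} → nn-respᵣ {x} {y}
    ; nn-+ = nn-+
    ; nn-* = λ {x} {y} → nn-* (bnd x) (bnd y)
    ; nn-1 = nn-pointwise (λ _ → 0≤1)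
    ; antisym = λ {x} p q → eq (nn-resp (λ n → solve 1 (λ x → x := x :- con 0ℚ) refl (seq x n)) p) (nn-resp (λ n → solve 1 (λ x → :- x := con 0ℚ :- x) refl (seq x n)) q)
    ; total = λ x → lem >>= λ { (inj₁ p) → return (inj₁ p)
        ; (inj₂ np) → neg-witness (cau x) np >>= λ (k , N , f) → return (inj₂ λ j → return (N , λ n h →
             ≤by _ (+-mono-≤ (+-mono-≤ (0≤w k) (0≤w j)) (0≤sub (f n h))) (solve 3 (λ x v u → :- x := (:- u) :+ ((v :+ u) :+ ((:- v) :- x))) refl (seq x n) (w k) (w j)))) }
    ; 1≉0 = λ e → _≈_.le e 1 λ ev → contra 0 {λ _ → 0ℚ - 1ℚ} (0 , λ _ _ → ≤-reflexive refl) ev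
    ; half = constR ½ (≤-trans (ℚₚ.nonPositive⁻¹ (- 1ℚ)) (ℚₚ.nonNegative⁻¹ ½)) (≤by ½ (ℚₚ.nonNegative⁻¹ ½) refl)
    ; half+half = pw λ _ → refl
    ; Pos-* = λ {x} {y} hx hy p → neg-witness (cau (-ᵣ x)) hx λ (k , ex) → neg-witness (cau (-ᵣ y)) hy λ (l , ey) →
        p (suc (k ℕ.+ l)) (contra (k ℕ.+ l) {λ n → - (seq x n * seq y n)} (ev-map (λ n (a , b) →
          ≤-trans (≤by _ (cert {seq x n} {seq y n} {k} {l} a b) (solve 4 (λ x y v u → :- (v :* u) := (:- (x :* y)) :+ (((:- v :- (:- x)) :* (:- u :- (:- y))) :+ ((:- v :- (:- x)) :* u :+ (:- u :- (:- y)) :* v))) refl (seq x n) (seq y n) (w k) (w l)))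
            (≤-reflexive (cong -_ (sym (w*w k l))))) (ev-zip ex ey)))
    }
    where
    cert : ∀ {x y k l} → - x ≤ - w k → - y ≤ - w l → 0ℚ ≤ (- w k - (- x)) * (- w l - (- y)) + ((- w k - (- x)) * w l + (- w l - (- y)) * w k)
    cert {x} {y} {k} {l} a b = (0≤sub a ⊗ 0≤sub b) ⊕ ((0≤sub a ⊗ 0≤w l) ⊕ (0≤sub b ⊗ 0≤w k))

  Vq : ℚ → ℕ → ℚ
  Vq x zero = 0ℚ
  Vq x (suc zero) = 1ℚ
  Vq x (suc (suc k)) = x * Vq x (suc k) + - Vq x k

  seq-V : ∀ c k n → seq (chebyshev ringℝ c k) n ≡ Vq (seq c n) k
  seq-V c zero n = refl
  seq-V c (suc zero) n = refl
  seq-V c (suc (suc k)) n = cong₂ (λ a b → seq c n * a + - b) (seq-V c (suc k) n) (seq-V c k n)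

  -- The test asks whether V_2, ..., V_(m+2) are all positive, which is decidable at a rational
  -- point. Right ends pass it, so in the limit all values are nonnegative. If V_(m+2) were nonzero
  -- in the limit, all these values would be positive there, hence also at the left ends from some
  -- index on, although every left end fails the test.
  module Bisection (m : ℕ) where

    Good : ℚ → Set
    Good x = ∀ {j} → j ℕ.< suc m → ¬ (Vq x (suc (suc j)) ≤ 0ℚ)

    abstract
      good? : ∀ x → Dec (Good x)
      good? x = ℕₚ.allUpTo? (λ j → ¬? (Vq x (suc (suc j)) ≤? 0ℚ)) (suc m)

      good-2 : Good 2ℚ
      good-2 {j} _ h = absurd (≤-trans (proj₁ (go (suc j))) (≤-trans (≤-reflexive (sym (step j))) h))
        where
        go : ∀ j → (1ℚ ≤ Vq 2ℚ j + 1ℚ) × (Vq 2ℚ (suc j) ≡ Vq 2ℚ j + 1ℚ)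
        go zero = ≤-refl , refl
        go (suc j) with go j
        ... | p , e = ≤-trans p (≤by 1ℚ (ℚₚ.nonNegative⁻¹ 1ℚ) (cong (_+ 1ℚ) e)) ,
          trans (cong (λ z → 2ℚ * z + - Vq 2ℚ j) e) (trans (solve 1 (λ v → con 2ℚ :* (v :+ con 1ℚ) :+ (:- v) := (v :+ con 1ℚ) :+ con 1ℚ) refl (Vq 2ℚ j)) (cong (_+ 1ℚ) (sym e)))
        step : ∀ j → Vq 2ℚ (suc (suc j)) ≡ Vq 2ℚ (suc j) + 1ℚ
        step j = proj₂ (go (suc j))
        absurd : ¬ (1ℚ ≤ 0ℚ)
        absurd = 0<w 0

      ¬good-0 : ¬ Good 0ℚ
      ¬good-0 g = g {0} (ℕ.s≤s ℕ.z≤n) ≤-refl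

    record State (i : ℕ) : Set where
      constructor st
      field
        lo hi : ℚ
        width : hi ≡ lo + (w i + w i)
        good : Good hi
        bad : ¬ Good lo
        lo≥0 : 0ℚ ≤ lo
        hi≤2 : hi ≤ 2ℚ
    open State

    abstract
      step : ∀ {i} (s : State i) → Σ (State (suc i)) λ s' → (lo s ≤ lo s') × (hi s' ≤ hi s)
      step {i} s with good? (lo s + w i)
      ... | yes g = st (lo s) (lo s + w i) (cong (λ z → lo s + z) (sym (w+w i))) g (bad s) (lo≥0 s) (≤-trans le (hi≤2 s)) , ≤-refl , le
        where le : lo s + w i ≤ hi s
              le = ≤by (w i) (0≤w i) (trans (width s) (sym (ℚₚ.+-assoc (lo s) (w i) (w i))))
      ... | no b = st (lo s + w i) (hi s) (trans (width s) (trans (sym (ℚₚ.+-assoc (lo s) (w i) (w i))) (cong (λ z → lo s + w i + z) (sym (w+w i))))) (good s) b (≤-trans (lo≥0 s) le) (hi≤2 s) , le , ≤-refl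
        where le : lo s ≤ lo s + w i
              le = ≤by (w i) (0≤w i) refl

    states : ∀ i → State i
    states zero = st 0ℚ 2ℚ refl good-2 ¬good-0 ≤-refl ≤-refl
    states (suc i) = proj₁ (step (states i))

    los his : Seq
    los i = lo (states i)
    his i = hi (states i)

    lo≤hi : ∀ i → los i ≤ his i
    lo≤hi i = ≤by (w i + w i) (+-mono-≤ (0≤w i) (0≤w i)) (width (states i))

    mono-lo : ∀ d N → los N ≤ los (d ℕ.+ N)
    mono-lo zero N = ≤-refl
    mono-lo (suc d) N = ≤-trans (mono-lo d N) (proj₁ (proj₂ (step (states (d ℕ.+ N)))))

    mono-hi : ∀ d N → his (d ℕ.+ N) ≤ his N
    mono-hi zero N = ≤-refl
    mono-hi (suc d) N = ≤-trans (proj₂ (proj₂ (step (states (d ℕ.+ N))))) (mono-hi d N)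

    within : ∀ {N n} → N ℕ.≤ n → (los N ≤ los n) × (his n ≤ his N)
    within {N} {n} h = subst (λ z → (los N ≤ los z) × (his z ≤ his N)) (ℕₚ.m∸n+n≡m h) (mono-lo (n ℕ.∸ N) N , mono-hi (n ℕ.∸ N) N)

    close : ∀ k {a b} → los (suc k) ≤ b → a ≤ his (suc k) → a - b ≤ w k
    close k {a} {b} p q = ≤by _ (+-mono-≤ (0≤sub p) (0≤sub q)) (trans (sym (w+w k))
      (trans (solve 4 (λ l v a b → v :+ v := a :- b :+ ((b :- l) :+ ((l :+ (v :+ v)) :- a))) refl (los (suc k)) (w (suc k)) a b)
        (cong (λ z → a - b + ((b - los (suc k)) + (z - a))) (sym (width (states (suc k)))))))

    bounds : ∀ {x} → 0ℚ ≤ x → x ≤ 2ℚ → (- pow 1 ≤ x) × (x ≤ pow 1)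
    bounds p q = ≤-trans (ℚₚ.nonPositive⁻¹ (- pow 1)) p , q

    -- One real number given by two sequences: nonnegativity is read off along the right ends, and
    -- the contradiction arises along the left ends.
    cos' cos : ℝ
    cos = mk his (1 , λ n → bounds (≤-trans (lo≥0 (states n)) (lo≤hi n)) (hi≤2 (states n)))
      λ k → return (suc k , λ m n p q → close k (≤-trans (proj₁ (within q)) (lo≤hi n)) (proj₂ (within p)))
    cos' = mk los (1 , λ n → bounds (lo≥0 (states n)) (≤-trans (lo≤hi n) (hi≤2 (states n))))
      λ k → return (suc k , λ m n p q → close k (proj₁ (within q)) (≤-trans (lo≤hi m) (proj₂ (within p))))

    cos≈cos' : cos ≈ cos'
    cos≈cos' = eq (nn-pointwise λ n → 0≤sub (lo≤hi n)) λ k → return (suc k , λ n h →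
      ≤by _ (0≤sub (close k {his n} {los n} (proj₁ (within h)) (proj₂ (within h)))) (solve 3 (λ l h v → l :- h := (:- v) :+ (v :- (h :- l))) refl (los n) (his n) (w k)))

    open OD ℝ-domain using (Pos; V; V-cong; V-interior-pos; Pos-resp; ≈-stable; 0#)
    open import Algebra.Bundles using (module CommutativeRing)

    V-nonneg : ∀ k → k ℕ.≤ suc (suc m) → NN (V cos k)
    V-nonneg zero _ = nn-pointwise λ _ → ≤-refl
    V-nonneg (suc zero) _ = nn-pointwise λ _ → ℚₚ.nonNegative⁻¹ 1ℚ
    V-nonneg (suc (suc k)) (ℕ.s≤s h) = nn-pointwise λ n → subst (0ℚ ≤_) (sym (seq-V cos (suc (suc k)) n))
      (ℚₚ.<⇒≤ (ℚₚ.≰⇒> (good (states n) h)))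

    module _ (nz : ¬ (V cos (suc (suc m)) ≈ 0#)) where
      V-pos : ∀ k → k ℕ.≤ suc m → Pos (V cos (suc k))
      V-pos k h = V-interior-pos cos (suc (suc m)) V-nonneg nz k (ℕ.s≤s h)

      eventually-good : ∀ J → J ℕ.≤ suc m → ¬ ¬ Eventually (λ n → ∀ {j} → j ℕ.< J → ¬ (Vq (los n) (suc (suc j)) ≤ 0ℚ))
      eventually-good zero _ = return (0 , λ _ _ ())
      eventually-good (suc J) h = eventually-good J (ℕₚ.≤-trans (ℕₚ.n≤1+n J) h) >>= λ e →
        neg-witness (cau (-ᵣ (V cos' (suc (suc J))))) (Pos-resp {V cos (suc (suc J))} {V cos' (suc (suc J))} (V-cong cos≈cos' (suc (suc J))) (V-pos (suc J) h)) >>= λ (k , e') →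
        return (ev-map (λ n (f , g) {j} lt → case n k f g (ℕₚ.m≤n⇒m<n∨m≡n (ℕₚ.≤-pred lt))) (ev-zip e e'))
        where
        case : ∀ n k {j} → (∀ {j} → j ℕ.< J → ¬ (Vq (los n) (suc (suc j)) ≤ 0ℚ)) → - seq (V cos' (suc (suc J))) n ≤ - w k → (j ℕ.< J ⊎ j ≡ J) → ¬ (Vq (los n) (suc (suc j)) ≤ 0ℚ)
        case n k f g (inj₁ lt) = f lt
        case n k f g (inj₂ refl) = above-0 k (subst (λ z → - z ≤ - w k) (seq-V cos' (suc (suc J)) n) g)

      absurd : ⊥
      absurd = eventually-good (suc m) ℕₚ.≤-refl λ (N , f) → bad (states N) (f N ℕₚ.≤-refl)

    twiceCos : TwiceCos ℝ-domain (suc (suc m))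
    twiceCos = record { c = cos ; V-nn = V-nonneg ; V-n = ≈-stable absurd }

  ℝ-with-cosines : OrderedDomainWithCosines
  ℝ-with-cosines = ℝ-domain , Bisection.twiceCos

-- The geometric representation and reduced words.

module GeometricRepresentation (DC : OrderedDomainWithCosines) (I : Set) (m : I → I → Maybe ℕ)
  (m-diag : ∀ s → m s s ≡ just 1) (m-sym : ∀ s t → m s t ≡ m t s)
  (m-off : ∀ s t → ¬ (s ≡ t) → ∀ k → m s t ≡ just k → 2 Data.Nat.≤ k) where
  open import Defs
  open OrderedDomains
  open import Data.Nat as ℕ using (ℕ; zero; suc)
  open import Data.Maybe using (Maybe; just; nothing)
  open import Data.Product using (∃; _×_; _,_; proj₁; proj₂)
  open import Relation.Nullary using (¬_)
  import Relation.Binary.PropositionalEquality as ≡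
  open ≡ using (_≡_)
  import Data.Nat.Properties as ℕₚ
  open import Data.Integer using (+_)
  open import Data.List using (List; []; _∷_; _++_; length; [_])
  import Data.List.Properties as Listₚ
  open import Data.Sum using (_⊎_; inj₁; inj₂)
  open import Data.Empty using (⊥-elim)
  open DoubleNegation
  open OD (proj₁ DC) hiding (zero)

  Word : Set
  Word = List I

  _~_ : Word → Word → Set
  _~_ = CoxEq m
  infix 4 _~_

  module Words where
    ~-refl : ∀ {w} → w ~ w
    ~-refl = ceq-refl _

    ~-reflexive : ∀ {w w'} → w ≡ w' → w ~ w'
    ~-reflexive ≡.refl = ~-refl

    ~-left : ∀ a {w w'} → w ~ w' → a ++ w ~ a ++ w'
    ~-left a {w} {w'} e = ≡.subst₂ (λ x y → a ++ x ~ a ++ y) (Listₚ.++-identityʳ w) (Listₚ.++-identityʳ w') (ceq-ctx a [] e)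

    ~-right : ∀ b {w w'} → w ~ w' → w ++ b ~ w' ++ b
    ~-right b e = ceq-ctx [] b e

    ss : ∀ s w → s ∷ s ∷ w ~ w
    ss s w = ~-right w (ceq-rel s s 1 (m-diag s))

    nth : I → I → ℕ → I
    nth s t zero = s
    nth s t (suc n) = nth t s n

    alt-snoc : ∀ s t n → alt s t (suc n) ≡ alt s t n ++ [ nth s t n ]
    alt-snoc s t zero = ≡.refl
    alt-snoc s t (suc n) = ≡.cong (s ∷_) (alt-snoc t s n)

    nth-even : ∀ s t k → nth s t (k ℕ.* 2) ≡ s
    nth-even s t zero = ≡.refl
    nth-even s t (suc k) = nth-even s t k

    nth-parity : ∀ s t i j k → suc (i ℕ.+ j) ≡ k ℕ.* 2 → nth s t i ≡ nth t s j
    nth-parity s t zero j (suc k) e with ℕₚ.suc-injective e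
    ... | ≡.refl = ≡.sym (nth-even s t k)
    nth-parity s t (suc i) j k e = nth-parity t s i (suc j) k (≡.trans (≡.cong suc (ℕₚ.+-suc i j)) e)

    -- Stripping letters from the right of (st)^k = 1.
    alt-flip : ∀ s t k → alt s t (k ℕ.* 2) ~ [] → ∀ j i → i ℕ.+ j ≡ k ℕ.* 2 → alt s t i ~ alt t s j
    alt-flip s t k h zero i e = ceq-trans (~-reflexive (≡.cong (alt s t) (≡.trans (≡.sym (ℕₚ.+-identityʳ i)) e))) h
    alt-flip s t k h (suc j) i e =
      ceq-trans (~-reflexive (≡.sym (Listₚ.++-identityʳ (alt s t i))))
      (ceq-trans (~-left (alt s t i) (ceq-sym (ss x [])))
      (ceq-trans (~-reflexive (≡.trans (≡.sym (Listₚ.++-assoc (alt s t i) [ x ] [ x ])) (≡.cong (_++ [ x ]) (≡.sym (alt-snoc s t i)))))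
      (ceq-trans (~-right [ x ] (alt-flip s t k h j (suc i) (≡.trans (≡.sym (ℕₚ.+-suc i j)) e)))
        (~-reflexive (≡.trans (≡.cong (λ z → alt t s j ++ [ z ]) (nth-parity s t i j k (≡.trans (≡.sym (ℕₚ.+-suc i j)) e))) (≡.sym (alt-snoc t s j)))))))
      where x = nth s t i

    braid : ∀ s t k → m s t ≡ just k → alt t s k ~ alt s t k
    braid s t k e = ceq-sym (alt-flip s t k (ceq-rel s t k e) k k (≡.trans (≡.cong (k ℕ.+_) (≡.sym (ℕₚ.+-identityʳ k))) (ℕₚ.*-comm 2 k)))

    same-letter : ∀ {s t} → m s t ≡ just 1 → ∀ w → s ∷ w ~ t ∷ w
    same-letter {s} {t} e w = ~-right w (ceq-sym (braid s t 1 e))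

  open Words public

  -- Equality of s and t cannot be tested; `m s t ≡ just 1` takes its place, and `m-diag` and
  -- `m-off` make the two equivalent up to double negation.
  data Order (s t : I) : Set where
    same : m s t ≡ just 1 → Order s t
    fin  : ∀ n → m s t ≡ just (suc (suc n)) → Order s t
    inf  : m s t ≡ nothing → Order s t

  order : ∀ s t → Order s t
  order s t = go (m s t) ≡.refl
    where
    1≢0 : ¬ (just 1 ≡ just 0)
    1≢0 ()
    go : ∀ x → m s t ≡ x → Order s t
    go nothing e = inf e
    go (just 0) e = ⊥-elim (lem {A = s ≡ t} λ { (inj₁ ≡.refl) → 1≢0 (≡.trans (≡.sym (m-diag s)) e) ; (inj₂ n) → ℕₚ.n≮0 (m-off s t n 0 e) })
    go (just 1) e = same e
    go (just (suc (suc n))) e = fin n e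

  private
    :0 :1 : ∀ {n} → Polynomial n
    :0 = con (+ 0)
    :1 = con (+ 1)

  2# : K
  2# = 1# + 1#

  -- This is 2 cos(π/k), with -2 for k = 1 and 2 for infinite order. The value at 0 is a default;
  -- `order` shows that the case does not occur.
  cf : Maybe ℕ → K
  cf nothing = 2#
  cf (just 0) = 0#
  cf (just 1) = - 2#
  cf (just (suc (suc n))) = TwiceCos.c (proj₂ DC n)

  -- Vectors: a height together with the pairings with all simple coroots.
  record Vect : Set where
    constructor ⟨_,_⟩
    field
      ht : K
      pr : I → K
  open Vect public

  infix 4 _≋_
  record _≋_ (x y : Vect) : Set where
    constructor ≋i
    field
      ht≈ : ht x ≈ ht y
      pr≈ : ∀ i → pr x i ≈ pr y i
  open _≋_ public

  ≋-refl : ∀ {x} → x ≋ x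
  ≋-refl = ≋i refl λ _ → refl
  ≋-sym : ∀ {x y} → x ≋ y → y ≋ x
  ≋-sym (≋i a b) = ≋i (sym a) λ i → sym (b i)
  ≋-trans : ∀ {x y z} → x ≋ y → y ≋ z → x ≋ z
  ≋-trans (≋i a b) (≋i c d) = ≋i (trans a c) λ i → trans (b i) (d i)
  ≋-stable : ∀ {x y} → ¬ ¬ (x ≋ y) → x ≋ y
  ≋-stable h = ≋i (≈-stable λ k → h λ e → k (ht≈ e)) λ i → ≈-stable λ k → h λ e → k (pr≈ e i)

  ≡-≋ : ∀ {x y z} → x ≡ y → y ≋ z → x ≋ z
  ≡-≋ ≡.refl e = e

  infixl 6 _⊞_
  infixl 7 _•_
  _⊞_ : Vect → Vect → Vect
  x ⊞ y = ⟨ ht x + ht y , (λ i → pr x i + pr y i) ⟩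
  _•_ : K → Vect → Vect
  k • x = ⟨ k * ht x , (λ i → k * pr x i) ⟩

  ⊞-cong : ∀ {x x' y y'} → x ≋ x' → y ≋ y' → x ⊞ y ≋ x' ⊞ y'
  ⊞-cong (≋i a b) (≋i c d) = ≋i (+-cong a c) λ i → +-cong (b i) (d i)
  •-cong : ∀ {k k' x x'} → k ≈ k' → x ≋ x' → k • x ≋ k' • x'
  •-cong e (≋i a b) = ≋i (*-cong e a) λ i → *-cong e (b i)

  α : I → Vect
  α s = ⟨ 1# , (λ t → - cf (m s t)) ⟩

  act : I → Vect → Vect
  act s z = ⟨ ht z - pr z s , (λ t → pr z t + pr z s * cf (m s t)) ⟩

  act-cong : ∀ s {x y} → x ≋ y → act s x ≋ act s y
  act-cong s (≋i a b) = ≋i (+-cong a (-‿cong (b s))) λ t → +-cong (b t) (*-congʳ (b s))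

  act-⊞ : ∀ s x y → act s (x ⊞ y) ≋ act s x ⊞ act s y
  act-⊞ s x y = ≋i (solve 4 (λ a b c d → (a :+ b) :- (c :+ d) := (a :- c) :+ (b :- d)) refl (ht x) (ht y) (pr x s) (pr y s))
    λ t → solve 5 (λ a b c d e → (a :+ b) :+ (c :+ d) :* e := (a :+ c :* e) :+ (b :+ d :* e)) refl (pr x t) (pr y t) (pr x s) (pr y s) (cf (m s t))

  act-• : ∀ s k x → act s (k • x) ≋ k • act s x
  act-• s k x = ≋i (solve 3 (λ k a b → k :* a :- k :* b := k :* (a :- b)) refl k (ht x) (pr x s))
    λ t → solve 4 (λ k a b c → k :* a :+ k :* b :* c := k :* (a :+ b :* c)) refl k (pr x t) (pr x s) (cf (m s t))

  act-is : ∀ s z → act s z ≋ z ⊞ (- pr z s) • α s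
  act-is s z = ≋i (solve 2 (λ a b → a :- b := a :+ (:- b) :* :1) refl (ht z) (pr z s))
    λ t → solve 3 (λ a b c → a :+ b :* c := a :+ (:- b) :* (:- c)) refl (pr z t) (pr z s) (cf (m s t))

  cf-ss : ∀ s → cf (m s s) ≡ - 2#
  cf-ss s = ≡.cong cf (m-diag s)

  pr-act-s : ∀ s z → pr (act s z) s ≈ - pr z s
  pr-act-s s z = trans (+-congˡ (*-congˡ (reflexive (cf-ss s)))) (solve 1 (λ b → b :+ b :* (:- (:1 :+ :1)) := :- b) refl (pr z s))

  act-invol : ∀ s z → act s (act s z) ≋ z
  act-invol s z = ≋i
    (trans (+-congˡ (-‿cong (pr-act-s s z))) (solve 2 (λ a b → (a :- b) :- (:- b) := a) refl (ht z) (pr z s)))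
    λ t → trans (+-congˡ (*-congʳ (pr-act-s s z))) (solve 3 (λ a b c → (a :+ b :* c) :+ (:- b) :* c := a) refl (pr z t) (pr z s) (cf (m s t)))

  act-α : ∀ s → act s (α s) ≋ (- 1#) • α s
  act-α s = ≋i
    (trans (+-congˡ (-‿cong (-‿cong (reflexive (cf-ss s))))) (solve 0 (:1 :- (:- (:- (:1 :+ :1))) := (:- :1) :* :1) refl))
    λ t → trans (+-congˡ (*-congʳ (-‿cong (reflexive (cf-ss s))))) (solve 1 (λ c → (:- c) :+ (:- (:- (:1 :+ :1))) :* c := (:- :1) :* (:- c)) refl (cf (m s t)))

  infixl 5 _◃_
  -- The head of the word acts first, so this is the action of the inverse of the word: `α s ◃ w` is
  -- the root w⁻¹ α_s, whose sign tells whether s is a left descent of w.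
  _◃_ : Vect → Word → Vect
  z ◃ [] = z
  z ◃ (s ∷ w) = act s z ◃ w

  ◃-cong : ∀ w {x y} → x ≋ y → x ◃ w ≋ y ◃ w
  ◃-cong [] e = e
  ◃-cong (s ∷ w) e = ◃-cong w (act-cong s e)

  ◃-++ : ∀ z a b → z ◃ (a ++ b) ≡ z ◃ a ◃ b
  ◃-++ z [] b = ≡.refl
  ◃-++ z (s ∷ a) b = ◃-++ (act s z) a b

  ◃-⊞ : ∀ w x y → (x ⊞ y) ◃ w ≋ (x ◃ w) ⊞ (y ◃ w)
  ◃-⊞ [] x y = ≋-refl
  ◃-⊞ (s ∷ w) x y = ≋-trans (◃-cong w (act-⊞ s x y)) (◃-⊞ w (act s x) (act s y))

  ◃-• : ∀ w k x → (k • x) ◃ w ≋ k • (x ◃ w)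
  ◃-• [] k x = ≋-refl
  ◃-• (s ∷ w) k x = ≋-trans (◃-cong w (act-• s k x)) (◃-• w k (act s x))

  -- Cramer's rule for the Gram matrix of two simple roots, with diagonal 2, off-diagonal entry -c
  -- and determinant 4 - c².
  eliminate : ∀ c A B → ¬ (2# * 2# - c * c ≈ 0#) → A * 2# - B * c ≈ 0# → B * 2# - A * c ≈ 0# → A ≈ 0#
  eliminate c A B h P Q = *-cancel-0 h (begin
    (2# * 2# - c * c) * A ≈⟨ solve 4 (λ A B c t → (t :* t :- c :* c) :* A := t :* (A :* t :- B :* c) :+ c :* (B :* t :- A :* c)) refl A B c 2# ⟩
    2# * (A * 2# - B * c) + c * (B * 2# - A * c) ≈⟨ +-cong (*-congˡ P) (*-congˡ Q) ⟩
    2# * 0# + c * 0# ≈⟨ solve 2 (λ c t → t :* :0 :+ c :* :0 := :0) refl c 2# ⟩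
    0# ∎)
    where open import Relation.Binary.Reasoning.Setoid setoid

  drop-summand : ∀ {h k} → h + k ≈ h → k ≈ 0#
  drop-summand {h} {k} p = trans (solve 2 (λ h k → k := (h :+ k) :- h) refl h k) (trans (+-congʳ p) (-‿inverseʳ h))

  -- The dihedral relations: the pairings with α_s and α_t evolve by the
  -- antiperiodic Chebyshev recursion, so (st)^k fixes both pairings; it moves the
  -- vector by a combination of α_s and α_t, which then must vanish because c² ≠ 4.
  module Dihedral (s t : I) (n : ℕ) (e : m s t ≡ just (suc (suc n))) where
    open Cos (proj₂ DC n) using (c; V-n; V-last; 4-c²)

    cst : cf (m s t) ≡ c
    cst = ≡.cong cf e
    cts : cf (m t s) ≡ c
    cts = ≡.cong cf (≡.trans (m-sym t s) e)

    module _ (a b : K) where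
      E : ℕ → K
      E zero = a
      E (suc zero) = b
      E (suc (suc k)) = c * E (suc k) - E k

      factor : ∀ b u v → c * (u * b) - v * b ≈ (c * u - v) * b
      factor b u v = solve 4 (λ c b u v → c :* (u :* b) :- v :* b := (c :* u :- v) :* b) refl c b u v

      E-V : ∀ k → E (suc k) ≈ V c (suc k) * b - V c k * a
      E-V zero = solve 2 (λ a b → b := :1 :* b :- :0 :* a) refl a b
      E-V (suc zero) = solve 3 (λ a b c → c :* b :- a := (c :* :1 :- :0) :* b :- :1 :* a) refl a b c
      E-V (suc (suc k)) = trans (+-cong (*-congˡ (E-V (suc k))) (-‿cong (E-V k)))
        (trans (solve 5 (λ c p q r s → c :* (p :- q) :- (r :- s) := (c :* p :- r) :- (c :* q :- s)) refl c (V c (suc (suc k)) * b) (V c (suc k) * a) (V c (suc k) * b) (V c k * a))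
          (+-cong (factor b (V c (suc (suc k))) (V c (suc k))) (-‿cong (factor a (V c (suc k)) (V c k)))))

      M = suc (suc n)
      E-M : E M ≈ - a
      E-M = trans (E-V (suc n)) (trans (+-cong (*-congʳ V-n) (-‿cong (*-congʳ V-last))) (solve 2 (λ a b → :0 :* b :- :1 :* a := :- a) refl a b))
      E-M1 : E (suc M) ≈ - b
      E-M1 = trans (E-V M) (trans (+-cong (*-congʳ (+-cong (*-congˡ V-n) (-‿cong V-last))) (-‿cong (*-congʳ V-n))) (solve 3 (λ a b c → (c :* :0 :- :1) :* b :- :0 :* a := :- b) refl a b c))

      anti : ∀ k → E (k ℕ.+ M) ≈ - E k
      anti zero = E-M
      anti (suc zero) = E-M1
      anti (suc (suc k)) = trans (+-cong (*-congˡ (anti (suc k))) (-‿cong (anti k))) (solve 3 (λ c x y → c :* (:- x) :- (:- y) := :- (c :* x :- y)) refl c (E (suc k)) (E k))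

      periodic : ∀ k → E (k ℕ.+ M ℕ.+ M) ≈ E k
      periodic k = trans (anti (k ℕ.+ M)) (trans (-‿cong (anti k)) (solve 1 (λ x → :- (:- x) := x) refl (E k)))

      double : ∀ k z j → pr z s ≈ E (suc j) → pr z t ≈ - E j →
        (pr (z ◃ alt s t (k ℕ.* 2)) s ≈ E (suc (k ℕ.* 2 ℕ.+ j))) × (pr (z ◃ alt s t (k ℕ.* 2)) t ≈ - E (k ℕ.* 2 ℕ.+ j))
      double zero z j p q = p , q
      double (suc k) z j p q = ≡.subst (λ i → (pr z' s ≈ E (suc i)) × (pr z' t ≈ - E i)) (≡.trans (ℕₚ.+-suc (k ℕ.* 2) (suc j)) (≡.cong suc (ℕₚ.+-suc (k ℕ.* 2) j)))
         (double k (act t (act s z)) (suc (suc j)) P Q)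
        where
        z' = z ◃ alt s t (suc k ℕ.* 2)
        q1 : pr (act s z) t ≈ E (suc (suc j))
        q1 = trans (+-cong q (*-cong p (reflexive cst))) (solve 3 (λ x y c → (:- x) :+ y :* c := c :* y :- x) refl (E j) (E (suc j)) c)
        p1 : pr (act s z) s ≈ - E (suc j)
        p1 = trans (pr-act-s s z) (-‿cong p)
        Q : pr (act t (act s z)) t ≈ - E (suc (suc j))
        Q = trans (pr-act-s t (act s z)) (-‿cong q1)
        P : pr (act t (act s z)) s ≈ E (suc (suc (suc j)))
        P = trans (+-cong p1 (*-cong q1 (reflexive cts))) (solve 3 (λ x y c → (:- x) :+ y :* c := c :* y :- x) refl (E (suc j)) (E (suc (suc j))) c)

    span : ∀ k z → ∃ λ A → ∃ λ B → z ◃ alt s t (k ℕ.* 2) ≋ z ⊞ (A • α s ⊞ B • α t)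
    span zero z = 0# , 0# , ≋i (solve 1 (λ h → h := h :+ (:0 :* :1 :+ :0 :* :1)) refl (ht z)) λ i → solve 3 (λ h a b → h := h :+ (:0 :* a :+ :0 :* b)) refl (pr z i) _ _
    span (suc k) z with span k (act t (act s z))
    ... | A , B , e' = x + A , y + B , ≋-trans e' (≋-trans (⊞-cong (≋-trans (act-is t (act s z)) (⊞-cong (act-is s z) ≋-refl)) ≋-refl)
        (≋i (regroup (ht z) 1# 1#) λ i → regroup (pr z i) (pr (α s) i) (pr (α t) i)))
      where
      x = - pr z s
      y = - pr (act s z) t
      regroup : ∀ h a b → h + x * a + y * b + (A * a + B * b) ≈ h + ((x + A) * a + (y + B) * b)
      regroup h a b = trans (solve 5 (λ h p q r s → h :+ p :+ q :+ (r :+ s) := h :+ ((p :+ r) :+ (q :+ s))) refl h (x * a) (y * b) (A * a) (B * b))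
        (+-congˡ (+-cong (sym (distribʳ a x A)) (sym (distribʳ b y B))))

    closing : ∀ a b N → N ≡ suc (suc n) ℕ.+ suc (suc n) → ∀ {x y} → x ≈ E a b (suc N) → y ≈ - E a b N → (x ≈ b) × (y ≈ - a)
    closing a b N e p q = trans p (trans (reflexive (≡.cong (λ i → E a b (suc i)) e)) (periodic a b 1)) ,
                          trans q (-‿cong (trans (reflexive (≡.cong (E a b) e)) (periodic a b 0)))

    trivial : ∀ k → k ≡ suc (suc n) → ∀ z → z ◃ alt s t (k ℕ.* 2) ≋ z
    trivial k k≡ z with span k z
    ... | A , B , eq = ≋-trans eq (≋i (fix (ht z) 1# 1#) λ i → fix (pr z i) _ _)
      where
      idx : k ℕ.* 2 ℕ.+ 0 ≡ suc (suc n) ℕ.+ suc (suc n)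
      idx = ≡.trans (ℕₚ.+-identityʳ _) (≡.trans (ℕₚ.*-comm k 2) (≡.trans (≡.cong (k ℕ.+_) (ℕₚ.+-identityʳ _)) (≡.cong₂ ℕ._+_ k≡ k≡)))
      x≈-‿-x : pr z t ≈ - (- pr z t)
      x≈-‿-x = solve 1 (λ x → x := :- (:- x)) refl (pr z t)
      fixed = double (- pr z t) (pr z s) k z 0 refl x≈-‿-x
      s-fixed : pr (z ◃ alt s t (k ℕ.* 2)) s ≈ pr z s
      s-fixed = proj₁ (closing _ _ _ idx (proj₁ fixed) (proj₂ fixed))
      t-fixed : pr (z ◃ alt s t (k ℕ.* 2)) t ≈ pr z t
      t-fixed = trans (proj₂ (closing _ _ _ idx (proj₁ fixed) (proj₂ fixed))) (sym x≈-‿-x)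
      P : A * 2# - B * c ≈ 0#
      P = trans (solve 3 (λ A B c → A :* (:1 :+ :1) :- B :* c := A :* (:- (:- (:1 :+ :1))) :+ B :* (:- c)) refl A B c)
           (trans (+-cong (*-congˡ (-‿cong (reflexive (≡.sym (cf-ss s))))) (*-congˡ (-‿cong (reflexive (≡.sym cts))))) (drop-summand (trans (sym (pr≈ eq s)) s-fixed)))
      Q : B * 2# - A * c ≈ 0#
      Q = trans (solve 3 (λ A B c → B :* (:1 :+ :1) :- A :* c := A :* (:- c) :+ B :* (:- (:- (:1 :+ :1)))) refl A B c)
           (trans (+-cong (*-congˡ (-‿cong (reflexive (≡.sym cst)))) (*-congˡ (-‿cong (reflexive (≡.sym (cf-ss t)))))) (drop-summand (trans (sym (pr≈ eq t)) t-fixed)))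
      A0 : A ≈ 0#
      A0 = eliminate c A B 4-c² P Q
      B0 : B ≈ 0#
      B0 = eliminate c B A 4-c² Q P
      fix : ∀ h x y → h + (A * x + B * y) ≈ h
      fix h x y = trans (+-congˡ (+-cong (*-congʳ A0) (*-congʳ B0))) (solve 3 (λ h x y → h :+ (:0 :* x :+ :0 :* y) := h) refl h x y)
  ◃-~ : ∀ {w w'} → w ~ w' → ∀ z → z ◃ w ≋ z ◃ w'
  ◃-~ (ceq-refl w) z = ≋-refl
  ◃-~ (ceq-sym e) z = ≋-sym (◃-~ e z)
  ◃-~ (ceq-trans e e') z = ≋-trans (◃-~ e z) (◃-~ e' z)
  ◃-~ (ceq-ctx a b {w} {w'} e) z = ≡.subst₂ _≋_ (h w) (h w') (◃-cong b (◃-~ e (z ◃ a)))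
    where
    h : ∀ w → z ◃ a ◃ w ◃ b ≡ z ◃ (a ++ w ++ b)
    h w = ≡.sym (≡.trans (◃-++ z a (w ++ b)) (◃-++ (z ◃ a) w b))
  ◃-~ (ceq-rel s t 0 e) z = ≋-refl
  ◃-~ (ceq-rel s t 1 e) z = ≋-stable λ k → lem {A = s ≡ t} λ
    { (inj₁ ≡.refl) → k (act-invol s z) ; (inj₂ ne) → ℕₚ.<⇒≱ (ℕ.s≤s (ℕ.s≤s ℕ.z≤n)) (m-off s t ne 1 e) }
  ◃-~ (ceq-rel s t (suc (suc n)) e) z = Dihedral.trivial s t n e (suc (suc n)) ≡.refl z

  -- `shorter` allows for words that are not reduced, so nothing about lengths has to be known in
  -- advance. `up` records only the sign of a root; `certified-minimal` translates such signs into
  -- lengths.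
  data Outcome (s : I) (w : Word) : Set where
    shorter : ∀ w' → w ~ w' → length w' ℕ.< length w → Outcome s w
    down    : ∀ v → w ~ s ∷ v → suc (length v) ≡ length w → Outcome s w
    up      : Pos (ht (α s ◃ w)) → Outcome s w

  -- The roots of the dihedral subsystem of r and o: their coordinates are consecutive Chebyshev
  -- values.
  Z : K → ℕ → I → I → Vect
  Z c n r o = V c n • α r ⊞ V c (suc n) • α o

  act-Z : ∀ r o n → act r (Z (cf (m r o)) n r o) ≋ Z (cf (m r o)) (suc n) o r
  act-Z r o n = ≋i
    (trans (+-congˡ (-‿cong pr-r)) (solve 3 (λ c a b → (a :* :1 :+ b :* :1) :- (a :* (:1 :+ :1) :- b :* c) := b :* :1 :+ (c :* b :- a) :* :1) refl c a b))
    λ t → trans (+-congˡ (*-congʳ pr-r)) (solve 5 (λ c a b x y → (a :* (:- x) :+ b :* (:- y)) :+ (a :* (:1 :+ :1) :- b :* c) :* x := b :* (:- y) :+ (c :* b :- a) :* (:- x)) refl c a b (cf (m r t)) (cf (m o t)))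
    where
    c = cf (m r o)
    a = V c n
    b = V c (suc n)
    pr-r : pr (Z c n r o) r ≈ a * 2# - b * c
    pr-r = trans (+-cong (*-congˡ (-‿cong (reflexive (cf-ss r)))) (*-congˡ (-‿cong (reflexive (≡.cong cf (m-sym o r))))))
      (solve 3 (λ c a b → a :* (:- (:- (:1 :+ :1))) :+ b :* (:- c) := a :* (:1 :+ :1) :- b :* c) refl c a b)

  combine-pos : ∀ {p q a b} → NonNeg p → NonNeg q → (q ≈ 0# → ¬ (p ≈ 0#)) → Pos a → Pos b → Pos (p * a + q * b)
  combine-pos {p} {q} {a} {b} np nq h pa pb neg = lem {A = q ≈ 0#} λ
    { (inj₁ z) → Pos-+ (Pos-* (NN≉0⇒Pos np (h z)) pa) (nn-* nq (Pos⇒NN pb)) neg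
    ; (inj₂ nz) → Pos-resp (+-comm _ _) (Pos-+ (Pos-* (NN≉0⇒Pos nq nz) pb) (nn-* np (Pos⇒NN pa))) neg }

  α◃alt : ∀ s t n → α s ◃ alt t s n ≋ Z (cf (m s t)) n (nth t s n) (nth s t n)
  α◃alt s t zero = ≋i (solve 0 (:1 := :0 :* :1 :+ :1 :* :1) refl) λ i → solve 2 (λ a b → b := :0 :* a :+ :1 :* b) refl _ _
  α◃alt s t (suc n) = ≡-≋ (≡.trans (≡.cong (α s ◃_) (alt-snoc t s n)) (◃-++ (α s) (alt t s n) [ r ]))
    (≋-trans (act-cong r (α◃alt s t n)) (≡.subst (λ x → act r (Z x n r o) ≋ Z x (suc n) o r) (ceq n) (act-Z r o n)))
    where
    r = nth t s n
    o = nth s t n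
    ceq : ∀ n → cf (m (nth t s n) (nth s t n)) ≡ cf (m s t)
    ceq n = ≡.cong cf (go s t n)
      where
      go : ∀ s t n → m (nth t s n) (nth s t n) ≡ m s t
      go s t zero = m-sym t s
      go s t (suc n) = ≡.trans (go t s n) (m-sym t s)

  module Strip (s t : I) (w : Word) (N : ℕ) (rec : ∀ r v → length v ℕ.≤ N → Outcome r v) where
    open ℕₚ.≤-Reasoning

    lift-shorter : ∀ p {v} v' → w ~ p ++ v → length p ℕ.+ length v ≡ length w → v ~ v' → length v' ℕ.< length v → Outcome s w
    lift-shorter p {v} v' e l f lt = shorter (p ++ v') (ceq-trans e (~-left p f)) (begin-strict
      length (p ++ v') ≡⟨ Listₚ.length-++ p ⟩
      length p ℕ.+ length v' <⟨ ℕₚ.+-monoʳ-< (length p) lt ⟩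
      length p ℕ.+ length v ≡⟨ l ⟩
      length w ∎)

    alt-length : ∀ (s t : I) n → length (alt s t n) ≡ n
    alt-length s t zero = ≡.refl
    alt-length s t (suc n) = ≡.cong suc (alt-length t s n)

    module _ (good : ∀ n → Set) (good-V : ∀ n → good n → NonNeg (V (cf (m s t)) n) × NonNeg (V (cf (m s t)) (suc n)))
             (next : ∀ n → good n → good (suc n) ⊎ alt t s (suc n) ~ alt s t (suc n)) where

      -- The first query concerns the next letter of the alternating pattern. If it is a descent of
      -- v, the prefix grows, or reaches full length and can be rewritten by the braid relation to
      -- begin with s. The second query concerns the last letter of the prefix, which cancels if it
      -- is a descent of v. If both fail, the root is a combination of two positive ones. `M` bounds
      -- the recursion by the length of v.
      loop : ∀ M n v → length v ℕ.≤ M → length v ℕ.≤ N → good (suc n) → w ~ alt t s (suc n) ++ v → suc n ℕ.+ length v ≡ length w → Outcome s w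
      loop M n v lM lN g e l with rec (nth s t n) v lN
      ... | shorter v' f lt = lift-shorter (alt t s (suc n)) v' e (≡.trans (≡.cong (ℕ._+ length v) (alt-length t s (suc n))) l) f lt
      ... | down v' f l' with next (suc n) g
      ...   | inj₂ b = down (alt t s (suc n) ++ v') (ceq-trans e₂ (~-right v' b)) (≡.trans (≡.cong suc (≡.trans (Listₚ.length-++ (alt t s (suc n))) (≡.cong (ℕ._+ length v') (alt-length t s (suc n)))))
                 (≡.trans (≡.sym (ℕₚ.+-suc (suc n) (length v'))) (≡.trans (≡.cong (suc n ℕ.+_) l') l)))
        where
        e₂ : w ~ alt t s (suc (suc n)) ++ v'
        e₂ = ceq-trans e (ceq-trans (~-left (alt t s (suc n)) f) (~-reflexive (≡.trans (≡.sym (Listₚ.++-assoc (alt t s (suc n)) [ nth s t n ] v')) (≡.cong (_++ v') (≡.sym (alt-snoc t s (suc n)))))))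
      loop zero n v lM lN g e l | down v' f l' | inj₁ g' = ⊥-elim (ℕₚ.n≮0 (≡.subst (ℕ._≤ 0) (≡.sym l') lM))
      loop (suc M) n v lM lN g e l | down v' f l' | inj₁ g' = loop M (suc n) v' (ℕₚ.≤-pred (≡.subst (ℕ._≤ suc M) (≡.sym l') lM))
          (ℕₚ.≤-trans (ℕₚ.n≤1+n _) (≡.subst (ℕ._≤ N) (≡.sym l') lN)) g'
          (ceq-trans e (ceq-trans (~-left (alt t s (suc n)) f) (~-reflexive (≡.trans (≡.sym (Listₚ.++-assoc (alt t s (suc n)) [ nth s t n ] v')) (≡.cong (_++ v') (≡.sym (alt-snoc t s (suc n))))))))
          (≡.trans (≡.sym (ℕₚ.+-suc (suc n) (length v'))) (≡.trans (≡.cong (suc n ℕ.+_) l') l))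
      loop M n v lM lN g e l | up h with rec (nth t s n) v lN
      ...   | shorter v' f lt = lift-shorter (alt t s (suc n)) v' e (≡.trans (≡.cong (ℕ._+ length v) (alt-length t s (suc n))) l) f lt
      ...   | down v' f l' = shorter (alt t s n ++ v')
                (ceq-trans e (ceq-trans (~-reflexive (≡.trans (≡.cong (_++ v) (alt-snoc t s n)) (Listₚ.++-assoc (alt t s n) [ nth t s n ] v)))
                  (~-left (alt t s n) (ceq-trans (~-left [ nth t s n ] f) (ss (nth t s n) v')))))
                (begin-strict
                  length (alt t s n ++ v') ≡⟨ Listₚ.length-++ (alt t s n) ⟩
                  length (alt t s n) ℕ.+ length v' ≡⟨ ≡.cong (ℕ._+ length v') (alt-length t s n) ⟩
                  n ℕ.+ length v' <⟨ ℕₚ.+-mono-<-≤ (ℕₚ.n<1+n n) (ℕₚ.≤-trans (ℕₚ.n≤1+n _) (ℕₚ.≤-reflexive l')) ⟩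
                  suc n ℕ.+ length v ≡⟨ l ⟩
                  length w ∎)
      ...   | up h' = up (Pos-resp (sym (ht≈ vec)) (combine-pos (proj₁ (good-V (suc n) g)) (proj₂ (good-V (suc n) g)) (V-not-both c (suc n)) h h'))
        where
        c = cf (m s t)
        r = nth s t n
        o = nth t s n
        vec : α s ◃ w ≋ V c (suc n) • (α r ◃ v) ⊞ V c (suc (suc n)) • (α o ◃ v)
        vec = ≋-trans (◃-~ e (α s)) (≡-≋ (◃-++ (α s) (alt t s (suc n)) v)
          (≋-trans (◃-cong v (α◃alt s t (suc n))) (≋-trans (◃-⊞ v _ _) (⊞-cong (◃-• v _ _) (◃-• v _ _)))))

  -- Decides whether s is a left descent of w, or finds a shorter expression of w:
  -- strip the maximal alternating prefix t s t ⋯ ; if w = (t s t ⋯) v with neither letter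
  -- a descent of v, then α_s ◃ w is a non-negative combination of the positive α_s ◃ v and α_t ◃ v.
  outcome : ∀ N s w → length w ℕ.≤ N → Outcome s w
  outcome N s [] _ = up Pos-1
  outcome (suc N) s (t ∷ w) (ℕ.s≤s l) with order s t
  ... | same e = down w (ceq-sym (same-letter e w)) ≡.refl
  ... | inf e = loop (λ _ → Data.Unit.⊤) (λ n _ → ≡.subst (λ c → NonNeg (V c n) × NonNeg (V c (suc n))) (≡.sym (≡.cong cf e)) (proj₂ (V2 n) , proj₂ (V2 (suc n)))) (λ n _ → inj₁ _)
        (length w) 0 w ℕₚ.≤-refl l _ ~-refl ≡.refl
    where open Strip s t (t ∷ w) N (outcome N)
          import Data.Unit
  ... | fin k e = loop (ℕ._≤ suc k) (λ n h → ≡.subst (λ c → NonNeg (V c n) × NonNeg (V c (suc n))) (≡.sym (≡.cong cf e)) (V-nn n (ℕₚ.≤-trans h (ℕₚ.n≤1+n _)) , V-nn (suc n) (ℕ.s≤s h)))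
        nxt (length w) 0 w ℕₚ.≤-refl l (ℕ.s≤s ℕ.z≤n) ~-refl ≡.refl
    where open Strip s t (t ∷ w) N (outcome N)
          open Cos (proj₂ DC k) using (V-nn)
          nxt : ∀ n → n ℕ.≤ suc k → suc n ℕ.≤ suc k ⊎ alt t s (suc n) ~ alt s t (suc n)
          nxt n h with ℕₚ.m≤n⇒m<n∨m≡n h
          ... | inj₁ lt = inj₁ lt
          ... | inj₂ ≡.refl = inj₂ (braid s t (suc (suc k)) e)

  -- The sign of a root certifies that each letter lengthens the word after it.
  data Certified : Word → Set where
    []  : Certified []
    _∷_ : ∀ {s w} → Pos (ht (α s ◃ w)) → Certified w → Certified (s ∷ w)

  certify : ∀ w → Certified w ⊎ (∃ λ w' → w ~ w' × length w' ℕ.< length w)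
  certify [] = inj₁ []
  certify (s ∷ w) with certify w
  ... | inj₂ (w' , e , l) = inj₂ (s ∷ w' , ~-left [ s ] e , ℕ.s≤s l)
  ... | inj₁ cw with outcome (length w) s w ℕₚ.≤-refl
  ...   | shorter w' e l = inj₂ (s ∷ w' , ~-left [ s ] e , ℕ.s≤s l)
  ...   | down v e l = inj₂ (v , ceq-trans (~-left [ s ] e) (ss s v) , ℕₚ.≤-trans (ℕₚ.≤-reflexive l) (ℕₚ.n≤1+n _))
  ...   | up p = inj₁ (p ∷ cw)

  normalise : ∀ N w → length w ℕ.≤ N → ∃ λ w' → w ~ w' × Certified w' × length w' ℕ.≤ length w
  normalise N w l with certify w
  ... | inj₁ c = w , ~-refl , c , ℕₚ.≤-refl
  normalise zero w l | inj₂ (w' , e , lt) = ⊥-elim (ℕₚ.n≮0 (ℕₚ.≤-trans lt l))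
  normalise (suc N) w l | inj₂ (w' , e , lt) with normalise N w' (ℕₚ.≤-pred (ℕₚ.≤-trans lt l))
  ... | w'' , e' , c , le = w'' , ceq-trans e e' , c , ℕₚ.≤-trans le (ℕₚ.<⇒≤ lt)

  α-∷ : ∀ s w → ht (α s ◃ (s ∷ w)) ≈ - ht (α s ◃ w)
  α-∷ s w = trans (ht≈ (≋-trans (◃-cong w (act-α s)) (◃-• w _ _))) (solve 1 (λ x → (:- :1) :* x := :- x) refl _)

  -- The vector α_s moved by s w has negative height, so on an equal word w' the algorithm cannot
  -- answer `up`. The answer `down` strips s from both words.
  certified-minimal : ∀ N {w} → Certified w → ∀ w' → length w' ℕ.≤ N → w ~ w' → length w ℕ.≤ length w'
  certified-minimal N [] w' l e = ℕ.z≤n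
  certified-minimal N {s ∷ w} (p ∷ c) w' l e with outcome (length w') s w' ℕₚ.≤-refl
  ... | up q = ⊥-elim (Pos-neg p (Pos-resp (trans (sym (ht≈ (◃-~ e (α s)))) (α-∷ s w)) q))
  certified-minimal zero {s ∷ w} (p ∷ c) w' l e | shorter w'' f lt = ⊥-elim (ℕₚ.n≮0 (ℕₚ.≤-trans lt l))
  certified-minimal (suc N) {s ∷ w} (p ∷ c) w' l e | shorter w'' f lt =
    ℕₚ.≤-trans (certified-minimal N (p ∷ c) w'' (ℕₚ.≤-pred (ℕₚ.≤-trans lt l)) (ceq-trans e f)) (ℕₚ.<⇒≤ lt)
  certified-minimal N {s ∷ w} (p ∷ c) w' l e | down v f lv =
    ≡.subst (suc (length w) ℕ.≤_) lv (ℕ.s≤s (certified-minimal N c v (ℕₚ.≤-trans (ℕₚ.n≤1+n _) (≡.subst (ℕ._≤ N) (≡.sym lv) l))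
      (ceq-trans (ceq-sym (ss s w)) (ceq-trans (~-left [ s ] (ceq-trans e f)) (ss s v)))))

-- A solver for group identities with involutions.

module GroupSolver {c ℓ} (G : Group c ℓ) where
  open import Algebra.Bundles using (Group)
  open Group G
  open import Algebra.Properties.Group G using (⁻¹-anti-homo-∙; ⁻¹-involutive; ε⁻¹≈ε)
  open import Data.Nat using (ℕ)
  open import Data.Fin using (Fin; zero; suc; _≟_)
  open import Data.Vec using (Vec; []; _∷_; lookup)
  open import Data.List using (List; []; _∷_)
  open import Data.Product using (Σ; proj₁; proj₂)
  open import Relation.Nullary using (yes; no)
  open import Relation.Binary.PropositionalEquality as ≡ using (_≡_)
  open import Relation.Binary.Reasoning.Setoid setoid

  Involution : Set _
  Involution = Σ Carrier λ s → s ∙ s ≈ ε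

  infixl 7 _⊙_
  data Expr (a b : ℕ) : Set where
    gn : Fin a → Expr a b
    vr : Fin b → Expr a b
    :ε : Expr a b
    _⊙_ : Expr a b → Expr a b → Expr a b
    inv : Expr a b → Expr a b

  private
    data Letter (a b : ℕ) : Set where
      gn : Fin a → Letter a b
      pos neg : Fin b → Letter a b

    push : ∀ {a b} → Letter a b → List (Letter a b) → List (Letter a b)
    push l [] = l ∷ []
    push (gn i) (gn j ∷ w) with i ≟ j
    ... | yes _ = w
    ... | no _ = gn i ∷ gn j ∷ w
    push (pos i) (neg j ∷ w) with i ≟ j
    ... | yes _ = w
    ... | no _ = pos i ∷ neg j ∷ w
    push (neg i) (pos j ∷ w) with i ≟ j
    ... | yes _ = w
    ... | no _ = neg i ∷ pos j ∷ w
    push l w = l ∷ w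

    mutual
      nf nf⁻ : ∀ {a b} → Expr a b → List (Letter a b) → List (Letter a b)
      nf (gn i) w = push (gn i) w
      nf (vr i) w = push (pos i) w
      nf :ε w = w
      nf (x ⊙ y) w = nf x (nf y w)
      nf (inv x) w = nf⁻ x w
      nf⁻ (gn i) w = push (gn i) w
      nf⁻ (vr i) w = push (neg i) w
      nf⁻ :ε w = w
      nf⁻ (x ⊙ y) w = nf⁻ y (nf⁻ x w)
      nf⁻ (inv x) w = nf x w

  module _ {a b : ℕ} (is : Vec Involution a) (xs : Vec Carrier b) where
    ⟦_⟧ : Expr a b → Carrier
    ⟦ gn i ⟧ = proj₁ (lookup is i)
    ⟦ vr i ⟧ = lookup xs i
    ⟦ :ε ⟧ = ε
    ⟦ x ⊙ y ⟧ = ⟦ x ⟧ ∙ ⟦ y ⟧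
    ⟦ inv x ⟧ = ⟦ x ⟧ ⁻¹

    private
      ⟦_⟧ₗ : Letter a b → Carrier
      ⟦ gn i ⟧ₗ = proj₁ (lookup is i)
      ⟦ pos i ⟧ₗ = lookup xs i
      ⟦ neg i ⟧ₗ = lookup xs i ⁻¹

      ⟦_⟧ʷ : List (Letter a b) → Carrier
      ⟦ [] ⟧ʷ = ε
      ⟦ l ∷ w ⟧ʷ = ⟦ l ⟧ₗ ∙ ⟦ w ⟧ʷ

      absorb : ∀ {x y z} → x ∙ y ≈ ε → z ≈ x ∙ (y ∙ z)
      absorb {x} {y} {z} e = trans (sym (identityˡ z)) (trans (∙-congʳ (sym e)) (assoc x y z))

      push-ok : ∀ l w → ⟦ push l w ⟧ʷ ≈ ⟦ l ⟧ₗ ∙ ⟦ w ⟧ʷ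
      push-ok l [] = refl
      push-ok (gn i) (gn j ∷ w) with i ≟ j
      ... | yes ≡.refl = absorb (proj₂ (lookup is i))
      ... | no _ = refl
      push-ok (gn i) (pos j ∷ w) = refl
      push-ok (gn i) (neg j ∷ w) = refl
      push-ok (pos i) (gn j ∷ w) = refl
      push-ok (pos i) (pos j ∷ w) = refl
      push-ok (pos i) (neg j ∷ w) with i ≟ j
      ... | yes ≡.refl = absorb (inverseʳ _)
      ... | no _ = refl
      push-ok (neg i) (gn j ∷ w) = refl
      push-ok (neg i) (neg j ∷ w) = refl
      push-ok (neg i) (pos j ∷ w) with i ≟ j
      ... | yes ≡.refl = absorb (inverseˡ _)
      ... | no _ = refl

      nf-ok : ∀ e w → ⟦ nf e w ⟧ʷ ≈ ⟦ e ⟧ ∙ ⟦ w ⟧ʷ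
      nf⁻-ok : ∀ e w → ⟦ nf⁻ e w ⟧ʷ ≈ ⟦ e ⟧ ⁻¹ ∙ ⟦ w ⟧ʷ
      nf-ok (gn i) w = push-ok (gn i) w
      nf-ok (vr i) w = push-ok (pos i) w
      nf-ok :ε w = sym (identityˡ _)
      nf-ok (x ⊙ y) w = trans (nf-ok x (nf y w)) (trans (∙-congˡ (nf-ok y w)) (sym (assoc _ _ _)))
      nf-ok (inv x) w = nf⁻-ok x w
      nf⁻-ok (gn i) w = trans (push-ok (gn i) w) (∙-congʳ (begin
        s ≈⟨ sym (identityʳ s) ⟩
        s ∙ ε ≈⟨ ∙-congˡ (sym (inverseʳ s)) ⟩
        s ∙ (s ∙ s ⁻¹) ≈⟨ sym (assoc _ _ _) ⟩
        s ∙ s ∙ s ⁻¹ ≈⟨ ∙-congʳ (proj₂ (lookup is i)) ⟩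
        ε ∙ s ⁻¹ ≈⟨ identityˡ _ ⟩
        s ⁻¹ ∎))
        where s = proj₁ (lookup is i)
      nf⁻-ok (vr i) w = push-ok (neg i) w
      nf⁻-ok :ε w = sym (trans (∙-congʳ ε⁻¹≈ε) (identityˡ _))
      nf⁻-ok (x ⊙ y) w = trans (nf⁻-ok y (nf⁻ x w)) (trans (∙-congˡ (nf⁻-ok x w)) (trans (sym (assoc _ _ _)) (∙-congʳ (sym (⁻¹-anti-homo-∙ _ _)))))
      nf⁻-ok (inv x) w = trans (nf-ok x w) (∙-congʳ (sym (⁻¹-involutive _)))

    -- Both sides are normalised by cancellation as in a free product of copies of Z/2 and Z; the
    -- equality of normal forms holds by computation, whence the `≡.refl` at each use.
    grp : ∀ e e' → nf e [] ≡ nf e' [] → ⟦ e ⟧ ≈ ⟦ e' ⟧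
    grp e e' h = trans (sym (trans (nf-ok e []) (identityʳ _))) (trans (reflexive (≡.cong ⟦_⟧ʷ h)) (trans (nf-ok e' []) (identityʳ _)))

  -- Letters of solver expressions: g for involutions, v for arbitrary elements.
  pattern g₀ = gn zero
  pattern g₁ = gn (suc zero)
  pattern g₂ = gn (suc (suc zero))
  pattern v₀ = vr zero
  pattern v₁ = vr (suc zero)
  pattern v₂ = vr (suc (suc zero))
  pattern v₃ = vr (suc (suc (suc zero)))

-- Length, descents and the strong exchange property.

module CoxeterGroups (DC : OrderedDomainWithCosines) {c ℓ : Level} (C : CoxeterSystem c ℓ) where
  open import Defs
  open OrderedDomains
  open import Level using (Level; _⊔_) renaming (suc to lsuc)
  open import Algebra.Bundles using (Group)
  open CoxeterSystem C
  open Group W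
  open CS C using (eval; IsReflection; HasLength)
  open GeometricRepresentation DC I m m-diag m-sym m-off using (Word; _~_; outcome; shorter; down; up; Certified; _∷_; []; normalise; certified-minimal; ss)
  open GroupSolver W
  open import Data.Nat as ℕ using (ℕ; zero; suc; _<_; _≤_)
  import Data.Nat.Properties as ℕₚ
  open import Data.Bool using (Bool; true; false; _xor_; not)
  import Data.Bool.Properties as Boolₚ
  open import Data.Product using (∃; _×_; _,_; proj₁; proj₂)
  open import Data.Sum using (_⊎_; inj₁; inj₂)
  open import Data.Maybe using (just)
  open import Data.Empty using (⊥-elim)
  open import Data.List using (List; []; _∷_; _++_; length; [_]; reverse)
  import Data.List.Properties as Listₚ
  open import Data.Vec using ([]; _∷_)
  open import Relation.Nullary using (¬_; Dec; yes; no; does)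
  open import Relation.Nullary.Decidable using (dec-true; dec-false)
  open import Relation.Binary.PropositionalEquality as ≡ using (_≡_; cong; cong₂)
  open import Relation.Binary.Reasoning.Setoid setoid

  gen² : ∀ s → gen s ∙ gen s ≈ ε
  gen² s = trans (∙-congˡ (sym (identityʳ _))) (presented₂ (s ∷ s ∷ []) [] (ss s []))

  Gen : I → Involution
  Gen s = gen s , gen² s

  eval-++ : ∀ a b → eval (a ++ b) ≈ eval a ∙ eval b
  eval-++ [] b = sym (identityˡ _)
  eval-++ (s ∷ a) b = trans (∙-congˡ (eval-++ a b)) (sym (assoc _ _ _))

  eval-reverse : ∀ a → eval (reverse a) ≈ eval a ⁻¹
  eval-reverse [] = grp [] [] :ε (inv :ε) ≡.refl
  eval-reverse (s ∷ a) = begin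
    eval (reverse (s ∷ a)) ≡⟨ cong eval (Listₚ.unfold-reverse s a) ⟩
    eval (reverse a ++ [ s ]) ≈⟨ eval-++ (reverse a) [ s ] ⟩
    eval (reverse a) ∙ (gen s ∙ ε) ≈⟨ ∙-congʳ (eval-reverse a) ⟩
    eval a ⁻¹ ∙ (gen s ∙ ε) ≈⟨ grp (Gen s ∷ []) (eval a ∷ []) (inv v₀ ⊙ (g₀ ⊙ :ε)) (inv (g₀ ⊙ v₀)) ≡.refl ⟩
    (gen s ∙ eval a) ⁻¹ ∎

  private
    nf : ∀ x → ∃ λ w → proj₁ (generated x) ~ w × Certified w × length w ≤ length (proj₁ (generated x))
    nf x = normalise (length (proj₁ (generated x))) (proj₁ (generated x)) ℕₚ.≤-refl

  abstract
    word : Carrier → Word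
    word x = proj₁ (nf x)

    eval-word : ∀ x → eval (word x) ≈ x
    eval-word x = trans (sym (presented₂ _ _ (proj₁ (proj₂ (nf x))))) (proj₂ (generated x))

    word-certified : ∀ x → Certified (word x)
    word-certified x = proj₁ (proj₂ (proj₂ (nf x)))

  len : Carrier → ℕ
  len x = length (word x)

  len-min : ∀ {x} w → eval w ≈ x → len x ≤ length w
  len-min {x} w e = certified-minimal (length w) (word-certified x) w ℕₚ.≤-refl (presented₁ _ _ (trans (eval-word x) (sym e)))

  len-cong : ∀ {x y} → x ≈ y → len x ≡ len y
  len-cong {x} {y} e = ℕₚ.≤-antisym (len-min (word y) (trans (eval-word y) (sym e))) (len-min (word x) (trans (eval-word x) e))

  len-ε : len ε ≡ 0
  len-ε = ℕₚ.n≤0⇒n≡0 (len-min [] refl)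

  len-0 : ∀ x → len x ≡ 0 → x ≈ ε
  len-0 x e with word x | eval-word x
  ... | [] | p = sym p

  infix 4 _≟_
  abstract
    _≟_ : ∀ x y → Dec (x ≈ y)
    x ≟ y with len (x ∙ y ⁻¹) ℕₚ.≟ 0
    ... | yes e = yes (trans (grp [] (x ∷ y ∷ []) v₀ (v₀ ⊙ inv v₁ ⊙ v₁) ≡.refl) (trans (∙-congʳ (len-0 _ e)) (identityˡ y)))
    ... | no ne = no λ e → ne (≡.trans (len-cong (trans (∙-congʳ e) (inverseʳ y))) len-ε)

  hasLength : ∀ x → HasLength x (len x)
  hasLength x = (word x , eval-word x , ≡.refl) , λ w → len-min w

  hasLength⇒ : ∀ {x n} → HasLength x n → len x ≡ n
  hasLength⇒ {x} ((w , e , l) , mn) = ℕₚ.≤-antisym (≡.subst (len x ≤_) l (len-min w e)) (mn (word x) (eval-word x))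

  abstract
    len-gen : ∀ s x → len (gen s ∙ x) ≡ suc (len x) ⊎ len x ≡ suc (len (gen s ∙ x))
    len-gen s x with outcome (len x) s (word x) ℕₚ.≤-refl
    ... | shorter w' e lt = ⊥-elim (ℕₚ.<⇒≱ lt (len-min w' (trans (sym (presented₂ _ _ e)) (eval-word x))))
    ... | down v e l = inj₂ (ℕₚ.≤-antisym
            (len-min (s ∷ word (gen s ∙ x)) (trans (∙-congˡ (eval-word _)) (grp (Gen s ∷ []) (x ∷ []) (g₀ ⊙ (g₀ ⊙ v₀)) v₀ ≡.refl)))
            (≡.subst (suc (len (gen s ∙ x)) ≤_) l (ℕ.s≤s (len-min v (trans (grp (Gen s ∷ []) (eval v ∷ []) v₀ (g₀ ⊙ (g₀ ⊙ v₀)) ≡.refl) (∙-congˡ (trans (sym (presented₂ _ _ e)) (eval-word x))))))))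
    ... | up p = inj₁ (ℕₚ.≤-antisym (len-min (s ∷ word x) (∙-congˡ (eval-word x)))
            (certified-minimal _ (p ∷ word-certified x) (word (gen s ∙ x)) ℕₚ.≤-refl (presented₁ _ _ (trans (∙-congˡ (eval-word x)) (sym (eval-word _))))))

  descent : ∀ x → ¬ (len x ≡ 0) → ∃ λ s → len x ≡ suc (len (gen s ∙ x))
  descent x h = go (word x) ≡.refl
    where
    go : ∀ w → word x ≡ w → ∃ λ s → len x ≡ suc (len (gen s ∙ x))
    go [] e = ⊥-elim (h (cong length e))
    go (s ∷ w) e with len-gen s x
    ... | inj₂ d = s , d
    ... | inj₁ u = ⊥-elim (ℕₚ.<⇒≱ (ℕ.s≤s (ℕₚ.≤-trans (ℕₚ.n≤1+n (length w)) (ℕₚ.≤-reflexive (≡.sym (cong length e)))))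
        (ℕₚ.≤-trans (ℕₚ.≤-reflexive (≡.sym u)) (len-min w (trans (grp (Gen s ∷ []) (eval w ∷ []) v₀ (g₀ ⊙ (g₀ ⊙ v₀)) ≡.refl)
            (∙-congˡ (trans (reflexive (cong eval (≡.sym e))) (eval-word x)))))))

  len-inv : ∀ x → len (x ⁻¹) ≡ len x
  len-inv x = ℕₚ.≤-antisym (le x) (≡.subst (_≤ len (x ⁻¹)) (len-cong (grp [] (x ∷ []) (inv (inv v₀)) v₀ ≡.refl)) (le (x ⁻¹)))
    where
    le : ∀ x → len (x ⁻¹) ≤ len x
    le x = ≡.subst (len (x ⁻¹) ≤_) (Listₚ.length-reverse (word x)) (len-min (reverse (word x)) (trans (eval-reverse (word x)) (⁻¹-cong (eval-word x))))

  conj : Word → Carrier → Carrier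
  conj [] t = t
  conj (s ∷ w) t = conj w (gen s ∙ t ∙ gen s)

  -- The parity of the number of times t occurs among the reflections s₁, s₁s₂s₁, ... attached to
  -- the letters of a word. By `cnt-eval` it depends only on the group element, and it tells whether
  -- t shortens that element.
  cnt : Word → Carrier → Bool
  cnt [] t = false
  cnt (s ∷ w) t = does (t ≟ gen s) xor cnt w (gen s ∙ t ∙ gen s)

  does-cong : ∀ {x y x' y'} → (x ≈ y → x' ≈ y') → (x' ≈ y' → x ≈ y) → does (x ≟ y) ≡ does (x' ≟ y')
  does-cong {x} {y} {x'} {y'} f g with x ≟ y
  ... | yes p = ≡.sym (dec-true (x' ≟ y') (f p))
  ... | no np = ≡.sym (dec-false (x' ≟ y') λ q → np (g q))

  conj-eval : ∀ w t → conj w t ≈ eval w ⁻¹ ∙ t ∙ eval w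
  conj-eval [] t = grp [] (t ∷ []) v₀ (inv :ε ⊙ v₀ ⊙ :ε) ≡.refl
  conj-eval (s ∷ w) t = trans (conj-eval w _) (grp (Gen s ∷ []) (t ∷ eval w ∷ []) (inv v₁ ⊙ (g₀ ⊙ v₀ ⊙ g₀) ⊙ v₁) (inv (g₀ ⊙ v₁) ⊙ v₀ ⊙ (g₀ ⊙ v₁)) ≡.refl)

  cnt-cong : ∀ w {t t'} → t ≈ t' → cnt w t ≡ cnt w t'
  cnt-cong [] e = ≡.refl
  cnt-cong (s ∷ w) e = cong₂ _xor_ (does-cong (trans (sym e)) (trans e)) (cnt-cong w (∙-congʳ (∙-congˡ e)))

  cnt-++ : ∀ a b t → cnt (a ++ b) t ≡ cnt a t xor cnt b (conj a t)
  cnt-++ [] b t = ≡.refl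
  cnt-++ (s ∷ a) b t = ≡.trans (cong (does (t ≟ gen s) xor_) (cnt-++ a b _)) (≡.sym (Boolₚ.xor-assoc (does (t ≟ gen s)) _ _))

  xors : ℕ → (ℕ → Bool) → Bool
  xors zero f = false
  xors (suc n) f = f 0 xor xors n (λ i → f (suc i))

  xors-cong : ∀ n {f g} → (∀ i → f i ≡ g i) → xors n f ≡ xors n g
  xors-cong zero h = ≡.refl
  xors-cong (suc n) h = cong₂ _xor_ (h 0) (xors-cong n λ i → h (suc i))

  xors-+ : ∀ a b f → xors (a ℕ.+ b) f ≡ xors a f xor xors b (λ i → f (a ℕ.+ i))
  xors-+ zero b f = ≡.refl
  xors-+ (suc a) b f = ≡.trans (cong (f 0 xor_) (xors-+ a b _)) (≡.sym (Boolₚ.xor-assoc (f 0) _ _))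

  -- The reflections met along an alternating word.
  altRefl : I → I → ℕ → Carrier
  altRefl s t zero = gen s
  altRefl s t (suc i) = gen s ∙ altRefl t s i ∙ gen s

  cnt-alt : ∀ n s t τ → cnt (alt s t n) τ ≡ xors n (λ i → does (τ ≟ altRefl s t i))
  cnt-alt zero s t τ = ≡.refl
  cnt-alt (suc n) s t τ = cong (does (τ ≟ gen s) xor_) (≡.trans (cnt-alt n t s _) (xors-cong n λ i → does-cong
    (λ e → trans (grp (Gen s ∷ []) (τ ∷ []) v₀ (g₀ ⊙ (g₀ ⊙ v₀ ⊙ g₀) ⊙ g₀) ≡.refl) (∙-congʳ (∙-congˡ e)))
    (λ e → trans (∙-congʳ (∙-congˡ e)) (grp (Gen s ∷ []) (altRefl t s i ∷ []) (g₀ ⊙ (g₀ ⊙ v₀ ⊙ g₀) ⊙ g₀) v₀ ≡.refl))))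

  alt-slide : ∀ i s t → eval (alt t s (i ℕ.* 2)) ∙ gen t ≈ gen t ∙ eval (alt s t (i ℕ.* 2))
  alt-slide zero s t = trans (identityˡ _) (sym (identityʳ _))
  alt-slide (suc i) s t = begin
    (gen t ∙ (gen s ∙ A)) ∙ gen t ≈⟨ grp [] (gen t ∷ gen s ∷ A ∷ []) (v₀ ⊙ (v₁ ⊙ v₂) ⊙ v₀) (v₀ ⊙ v₁ ⊙ (v₂ ⊙ v₀)) ≡.refl ⟩
    gen t ∙ gen s ∙ (A ∙ gen t) ≈⟨ ∙-congˡ (alt-slide i s t) ⟩
    gen t ∙ gen s ∙ (gen t ∙ B) ≈⟨ grp [] (gen t ∷ gen s ∷ B ∷ []) (v₀ ⊙ v₁ ⊙ (v₀ ⊙ v₂)) (v₀ ⊙ (v₁ ⊙ (v₀ ⊙ v₂))) ≡.refl ⟩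
    gen t ∙ (gen s ∙ (gen t ∙ B)) ∎
    where A = eval (alt t s (i ℕ.* 2))
          B = eval (alt s t (i ℕ.* 2))

  altRefl-eval : ∀ i s t → altRefl s t i ≈ eval (alt s t (i ℕ.* 2)) ∙ gen s
  altRefl-eval zero s t = sym (identityˡ _)
  altRefl-eval (suc i) s t = begin
    gen s ∙ altRefl t s i ∙ gen s ≈⟨ ∙-congʳ (∙-congˡ (trans (altRefl-eval i t s) (alt-slide i s t))) ⟩
    gen s ∙ (gen t ∙ B) ∙ gen s ∎
    where B = eval (alt s t (i ℕ.* 2))

  alt-prefix : ∀ (s t : I) k n → alt s t (k ℕ.* 2 ℕ.+ n) ≡ alt s t (k ℕ.* 2) ++ alt s t n
  alt-prefix s t zero n = ≡.refl
  alt-prefix s t (suc k) n = cong (λ z → s ∷ t ∷ z) (alt-prefix s t k n)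

  -- The reflections met along (st)^k repeat with period k, so those of the second half cancel those
  -- of the first.
  cnt-rel : ∀ s t k → m s t ≡ just k → ∀ τ → cnt (alt s t (k ℕ.* 2)) τ ≡ false
  cnt-rel s t k e τ = ≡.trans (cnt-alt (k ℕ.* 2) s t τ) (≡.trans (cong (λ n → xors n f) (≡.trans (ℕₚ.*-comm k 2) (cong (k ℕ.+_) (ℕₚ.+-identityʳ k))))
    (≡.trans (xors-+ k k f) (≡.trans (cong (xors k f xor_) (xors-cong k per)) (Boolₚ.xor-same (xors k f)))))
    where
    f : ℕ → Bool
    f i = does (τ ≟ altRefl s t i)
    same : ∀ i → altRefl s t (k ℕ.+ i) ≈ altRefl s t i
    same i = trans (altRefl-eval (k ℕ.+ i) s t) (trans (∙-congʳ (begin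
      eval (alt s t ((k ℕ.+ i) ℕ.* 2)) ≡⟨ cong (λ n → eval (alt s t n)) (ℕₚ.*-distribʳ-+ 2 k i) ⟩
      eval (alt s t (k ℕ.* 2 ℕ.+ i ℕ.* 2)) ≡⟨ cong eval (alt-prefix s t k (i ℕ.* 2)) ⟩
      eval (alt s t (k ℕ.* 2) ++ alt s t (i ℕ.* 2)) ≈⟨ eval-++ (alt s t (k ℕ.* 2)) _ ⟩
      eval (alt s t (k ℕ.* 2)) ∙ eval (alt s t (i ℕ.* 2)) ≈⟨ ∙-congʳ (presented₂ _ _ (ceq-rel s t k e)) ⟩
      ε ∙ eval (alt s t (i ℕ.* 2)) ≈⟨ identityˡ _ ⟩
      eval (alt s t (i ℕ.* 2)) ∎)) (sym (altRefl-eval i s t)))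
    per : ∀ i → f (k ℕ.+ i) ≡ f i
    per i = does-cong (λ p → trans p (same i)) (λ p → trans p (sym (same i)))

  cnt-~ : ∀ {w w'} → w ~ w' → ∀ t → cnt w t ≡ cnt w' t
  cnt-~ (ceq-refl w) t = ≡.refl
  cnt-~ (ceq-sym e) t = ≡.sym (cnt-~ e t)
  cnt-~ (ceq-trans e e') t = ≡.trans (cnt-~ e t) (cnt-~ e' t)
  cnt-~ (ceq-rel s t k e) τ = cnt-rel s t k e τ
  cnt-~ (ceq-ctx a b {w} {w'} e) t = ≡.trans (split w) (≡.trans (cong (cnt a t xor_) (cong₂ _xor_ (cnt-~ e (conj a t)) (cnt-cong b
      (trans (conj-eval w _) (trans (∙-cong (∙-congʳ (⁻¹-cong ew)) ew) (sym (conj-eval w' _))))))) (≡.sym (split w')))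
    where
    ew : eval w ≈ eval w'
    ew = presented₂ w w' e
    split : ∀ w → cnt (a ++ w ++ b) t ≡ cnt a t xor (cnt w (conj a t) xor cnt b (conj w (conj a t)))
    split w = ≡.trans (cnt-++ a (w ++ b) t) (cong (cnt a t xor_) (cnt-++ w b _))

  cnt-eval : ∀ w w' t → eval w ≈ eval w' → cnt w t ≡ cnt w' t
  cnt-eval w w' t e = cnt-~ (presented₁ w w' e) t

  -- An odd count requires an occurrence of t, and deleting the letter where it occurs amounts to
  -- multiplication by t.
  cnt-true : ∀ w t → cnt w t ≡ true → ∃ λ w' → length w' < length w × eval w' ≈ t ∙ eval w
  cnt-true (s ∷ w) t h with t ≟ gen s
  ... | yes e = w , ℕₚ.≤-refl , trans (grp (Gen s ∷ []) (eval w ∷ []) v₀ (g₀ ⊙ (g₀ ⊙ v₀)) ≡.refl) (∙-congʳ (sym e))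
  ... | no _ with cnt-true w (gen s ∙ t ∙ gen s) h
  ...   | w' , lt , e = s ∷ w' , ℕ.s≤s lt , trans (∙-congˡ e) (grp (Gen s ∷ []) (t ∷ eval w ∷ []) (g₀ ⊙ (g₀ ⊙ v₀ ⊙ g₀ ⊙ v₁)) (v₀ ⊙ (g₀ ⊙ v₁)) ≡.refl)

  IsRefl : Carrier → Set (c ⊔ ℓ)
  IsRefl = IsReflection

  refl² : ∀ {t} → IsRefl t → t ∙ t ≈ ε
  refl² (w , s , e) = trans (∙-cong e e) (grp (Gen s ∷ []) (w ∷ []) (v₀ ⊙ g₀ ⊙ inv v₀ ⊙ (v₀ ⊙ g₀ ⊙ inv v₀)) :ε ≡.refl)

  -- On the palindrome a s a⁻¹ the middle letter contributes one occurrence, while a and its reverse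
  -- together contribute as much as a a⁻¹ = ε, that is, nothing.
  cnt-self : ∀ {t} → IsRefl t → cnt (word t) t ≡ true
  cnt-self {t} (x , s , e) = ≡.trans (cnt-eval (word t) (a ++ s ∷ b) t (trans (eval-word t) (trans e (sym (trans (eval-++ a (s ∷ b))
      (trans (∙-cong (eval-word x) (∙-congˡ (trans (eval-reverse a) (⁻¹-cong (eval-word x))))) (sym (assoc _ _ _))))))))
    (≡.trans (cnt-++ a (s ∷ b) t) (≡.trans (cong (cnt a t xor_) (cong₂ _xor_ (dec-true (conj a t ≟ gen s) ca) (cnt-cong b scs)))
      (flip (cnt a t) (cnt b (conj a t)) (≡.trans (≡.sym (cnt-++ a b t)) (cnt-eval (a ++ b) [] t (trans (eval-++ a b) (trans (∙-congˡ (eval-reverse a)) (inverseʳ _))))))))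
    where
    a b : Word
    a = word x
    b = reverse a
    ca : conj a t ≈ gen s
    ca = trans (conj-eval a t) (trans (∙-cong (∙-cong (⁻¹-cong (eval-word x)) e) (eval-word x)) (grp [] (x ∷ gen s ∷ []) (inv v₀ ⊙ (v₀ ⊙ v₁ ⊙ inv v₀) ⊙ v₀) v₁ ≡.refl))
    scs : gen s ∙ conj a t ∙ gen s ≈ conj a t
    scs = trans (∙-congʳ (∙-congˡ ca)) (trans (grp (Gen s ∷ []) [] (g₀ ⊙ g₀ ⊙ g₀) g₀ ≡.refl) (sym ca))
    flip : ∀ p q → p xor q ≡ false → p xor (true xor q) ≡ true
    flip false false h = ≡.refl
    flip true true h = ≡.refl

  cnt-true⇒< : ∀ {x t} → cnt (word x) t ≡ true → len (t ∙ x) < len x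
  cnt-true⇒< {x} {t} h with cnt-true (word x) t h
  ... | w' , lt , e = ℕₚ.≤-<-trans (len-min w' (trans e (∙-congˡ (eval-word x)))) lt

  -- Multiplication by t flips the count of t, so t shortens t x.
  cnt-false⇒> : ∀ {x t} → IsRefl t → cnt (word x) t ≡ false → len x < len (t ∙ x)
  cnt-false⇒> {x} {t} r h = ≡.subst (_< len (t ∙ x)) (len-cong (trans (sym (assoc t t x)) (trans (∙-congʳ (refl² r)) (identityˡ x))))
    (cnt-true⇒< {t ∙ x} {t} (≡.trans (cnt-eval (word (t ∙ x)) (word t ++ word x) t (trans (eval-word _) (sym (trans (eval-++ (word t) (word x)) (∙-cong (eval-word t) (eval-word x))))))
      (≡.trans (cnt-++ (word t) (word x) t) (cong₂ _xor_ (cnt-self r) (≡.trans (cnt-cong (word x) (trans (conj-eval (word t) t) (trans (∙-cong (∙-congʳ (⁻¹-cong (eval-word t))) (eval-word t)) (grp [] (t ∷ []) (inv v₀ ⊙ v₀ ⊙ v₀) v₀ ≡.refl)))) h)))))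

  refl-conj : ∀ {t} x → IsRefl t → IsRefl (x ∙ t ∙ x ⁻¹)
  refl-conj x (w , s , e) = x ∙ w , s , trans (∙-congʳ (∙-congˡ e)) (grp [] (x ∷ w ∷ gen s ∷ []) (v₀ ⊙ (v₁ ⊙ v₂ ⊙ inv v₁) ⊙ inv v₀) (v₀ ⊙ v₁ ⊙ v₂ ⊙ inv (v₀ ⊙ v₁)) ≡.refl)

  refl-cong : ∀ {t t'} → t ≈ t' → IsRefl t → IsRefl t'
  refl-cong e (w , s , e') = w , s , trans (sym e) e'

  refl-gen : ∀ s → IsRefl (gen s)
  refl-gen s = ε , s , grp [] (gen s ∷ []) v₀ (:ε ⊙ v₀ ⊙ inv :ε) ≡.refl

  refl-sts : ∀ {t} s → IsRefl t → IsRefl (gen s ∙ t ∙ gen s)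
  refl-sts {t} s r = refl-cong (grp (Gen s ∷ []) (t ∷ []) (g₀ ⊙ v₀ ⊙ inv g₀) (g₀ ⊙ v₀ ⊙ g₀) ≡.refl) (refl-conj (gen s) r)
  -- Prefixing s conjugates the counted reflections by s and flips only the count of s itself. As t
  -- is not s, its conjugate still lengthens s x.
  gen-edge : ∀ {t x} s → IsRefl t → ¬ (t ≈ gen s) → len x < len (t ∙ x) → len (gen s ∙ x) < len (gen s ∙ (t ∙ x))
  gen-edge {t} {x} s r ne lt = ≡.subst (len (gen s ∙ x) <_) (len-cong (grp (Gen s ∷ []) (t ∷ x ∷ []) (g₀ ⊙ v₀ ⊙ g₀ ⊙ (g₀ ⊙ v₁)) (g₀ ⊙ (v₀ ⊙ v₁)) ≡.refl))
    (cnt-false⇒> (refl-sts s r) (≡.trans (cnt-eval (word (gen s ∙ x)) (s ∷ word x) _ (trans (eval-word _) (∙-congˡ (sym (eval-word x)))))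
      (cong₂ _xor_ (dec-false (gen s ∙ t ∙ gen s ≟ gen s) λ e → ne (trans (grp (Gen s ∷ []) (t ∷ []) v₀ (g₀ ⊙ (g₀ ⊙ v₀ ⊙ g₀) ⊙ g₀) ≡.refl) (trans (∙-congʳ (∙-congˡ e)) (grp (Gen s ∷ []) [] (g₀ ⊙ g₀ ⊙ g₀) g₀ ≡.refl))))
        (≡.trans (cnt-cong (word x) (grp (Gen s ∷ []) (t ∷ []) (g₀ ⊙ (g₀ ⊙ v₀ ⊙ g₀) ⊙ g₀) v₀ ≡.refl)) cf))))
    where
    cf : cnt (word x) t ≡ false
    cf with cnt (word x) t in eq
    ... | false = ≡.refl
    ... | true = ⊥-elim (ℕₚ.<-asym lt (cnt-true⇒< eq))

  odd : ℕ → Bool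
  odd zero = false
  odd (suc n) = not (odd n)

  odd-gen : ∀ s x → odd (len (gen s ∙ x)) ≡ not (odd (len x))
  odd-gen s x with len-gen s x
  ... | inj₁ e = cong odd e
  ... | inj₂ e = ≡.trans (≡.sym (Boolₚ.not-involutive _)) (≡.sym (cong (λ n → not (odd n)) e))

  odd-word : ∀ w x → odd (len (eval w ∙ x)) ≡ odd (length w) xor odd (len x)
  odd-word [] x = cong odd (len-cong (identityˡ x))
  odd-word (s ∷ w) x = ≡.trans (cong odd (len-cong (assoc _ _ _))) (≡.trans (odd-gen s _) (≡.trans (cong not (odd-word w x)) (Boolₚ.not-distribˡ-xor (odd (length w)) _)))

  odd-∙ : ∀ x y → odd (len (x ∙ y)) ≡ odd (len x) xor odd (len y)
  odd-∙ x y = ≡.trans (cong odd (len-cong (∙-congʳ (sym (eval-word x))))) (odd-word (word x) y)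

  -- In w s w⁻¹ the outer factors have equal parity, leaving one letter.
  odd-refl : ∀ {t} → IsRefl t → ∀ x → odd (len (t ∙ x)) ≡ not (odd (len x))
  odd-refl {t} (w , s , e) x = ≡.trans (odd-∙ t x) (cong (_xor odd (len x)) (≡.trans (cong odd (len-cong e))
     (≡.trans (odd-∙ (w ∙ gen s) (w ⁻¹)) (≡.trans (cong₂ _xor_ (≡.trans (odd-∙ w (gen s)) (cong (odd (len w) xor_) os)) (cong odd (len-inv w))) (fin (odd (len w)))))))
    where
    os : odd (len (gen s)) ≡ true
    os = ≡.trans (cong odd (len-cong (sym (identityʳ (gen s))))) (≡.trans (odd-gen s ε) (cong (λ n → not (odd n)) len-ε))
    fin : ∀ b → (b xor true) xor b ≡ true
    fin false = ≡.refl
    fin true = ≡.refl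

-- Bruhat order: lifting, diamonds and connectedness of atoms.

module BruhatOrder (DC : OrderedDomainWithCosines) {c ℓ : Level} (C : CoxeterSystem c ℓ) where
  open import Defs
  open OrderedDomains
  open import Level using (Level; _⊔_)
  open import Algebra.Bundles using (Group)
  open CoxeterGroups DC C using (len; len-cong; len-gen; _≟_; descent; IsRefl; refl-gen; refl-sts; gen-edge; Gen)
  open CoxeterSystem C
  open Group W
  open GroupSolver W
  open import Data.Nat as ℕ using (zero; suc; _<_; _≤_; z≤n)
  import Data.Nat.Properties as ℕₚ
  open import Data.Product using (_×_; _,_; proj₁; proj₂)
  open import Data.Sum using (_⊎_; inj₁; inj₂)
  open import Data.Empty using (⊥; ⊥-elim)
  open import Data.Vec using ([]; _∷_)
  open import Relation.Nullary using (¬_; Dec; yes; no)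
  open import Relation.Nullary.Decidable using (map′)
  open import Relation.Binary.PropositionalEquality as ≡ using (_≡_)

  infixr 8 _·_
  _·_ : I → Carrier → Carrier
  s · x = gen s ∙ x

  cancel : ∀ s x → s · s · x ≈ x
  cancel s x = grp (Gen s ∷ []) (x ∷ []) (g₀ ⊙ (g₀ ⊙ v₀)) v₀ ≡.refl

  ·-cong : ∀ s {x y} → x ≈ y → s · x ≈ s · y
  ·-cong s = ∙-congˡ

  ·-swap : ∀ s {x y} → x ≈ s · y → s · x ≈ y
  ·-swap s e = trans (·-cong s e) (cancel s _)

  ·-inj : ∀ s {x y} → s · x ≈ s · y → x ≈ y
  ·-inj s e = trans (sym (cancel s _)) (·-swap s e)

  Up Down : I → Carrier → Set
  Up s x = len (s · x) ≡ suc (len x)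
  Down s x = len x ≡ suc (len (s · x))

  up⊎down : ∀ s x → Up s x ⊎ Down s x
  up⊎down = len-gen

  len-ss : ∀ s x → len (s · s · x) ≡ len x
  len-ss s x = len-cong (cancel s x)

  up⇒down : ∀ {s x} → Up s x → Down s (s · x)
  up⇒down {s} {x} u = ≡.trans u (≡.cong suc (≡.sym (len-ss s x)))

  down⇒up : ∀ {s x} → Down s x → Up s (s · x)
  down⇒up {s} {x} d = ≡.trans (len-ss s x) d

  up-down : ∀ {s x} → Up s x → Down s x → ⊥
  up-down {s} {x} u d = ℕₚ.<-irrefl ≡.refl (ℕₚ.<-trans (ℕₚ.≤-reflexive (≡.sym u)) (ℕₚ.≤-reflexive (≡.sym d)))

  up-cong : ∀ {s x y} → x ≈ y → Up s x → Up s y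
  up-cong {s} e u = ≡.trans (len-cong (·-cong s (sym e))) (≡.trans u (≡.cong suc (len-cong e)))

  down-cong : ∀ {s x y} → x ≈ y → Down s x → Down s y
  down-cong {s} e d = ≡.trans (len-cong (sym e)) (≡.trans d (≡.cong suc (len-cong (·-cong s e))))

  up<  : ∀ {s x} → Up s x → len x < len (s · x)
  up< u = ℕₚ.≤-reflexive (≡.sym u)

  infix 4 _⟶_ _≼_ _⋖_
  record _⟶_ (x y : Carrier) : Set (c ⊔ ℓ) where
    constructor edge
    field
      {t} : Carrier
      refl-t : IsRefl t
      y≈tx : y ≈ t ∙ x
      len< : len x < len y
  open _⟶_ public using (len<)

  ⟶-cong : ∀ {x x' y y'} → x ≈ x' → y ≈ y' → x ⟶ y → x' ⟶ y'
  ⟶-cong e f (edge r p l) = edge r (trans (sym f) (trans p (∙-congˡ e))) (≡.subst₂ _<_ (len-cong e) (len-cong f) l)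

  data _≼_ (x y : Carrier) : Set (c ⊔ ℓ) where
    nil : x ≈ y → x ≼ y
    _◅_ : ∀ {z} → x ⟶ z → z ≼ y → x ≼ y
  infixr 5 _◅_

  ≼-refl : ∀ {x} → x ≼ x
  ≼-refl = nil refl

  ≼-congˡ : ∀ {x x' y} → x ≈ x' → x ≼ y → x' ≼ y
  ≼-congˡ e (nil f) = nil (trans (sym e) f)
  ≼-congˡ e (p ◅ q) = ⟶-cong e refl p ◅ q

  ≼-congʳ : ∀ {x y y'} → y ≈ y' → x ≼ y → x ≼ y'
  ≼-congʳ e (nil f) = nil (trans f e)
  ≼-congʳ e (p ◅ q) = p ◅ ≼-congʳ e q

  ≼-cong : ∀ {x x' y y'} → x ≈ x' → y ≈ y' → x ≼ y → x' ≼ y'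
  ≼-cong e f p = ≼-congˡ e (≼-congʳ f p)

  ≼-trans : ∀ {x y z} → x ≼ y → y ≼ z → x ≼ z
  ≼-trans (nil e) q = ≼-congˡ (sym e) q
  ≼-trans (p ◅ p') q = p ◅ ≼-trans p' q

  ⟶⇒≼ : ∀ {x y} → x ⟶ y → x ≼ y
  ⟶⇒≼ e = e ◅ ≼-refl

  ≼-len : ∀ {x y} → x ≼ y → len x ≤ len y
  ≼-len (nil e) = ℕₚ.≤-reflexive (len-cong e)
  ≼-len (p ◅ q) = ℕₚ.≤-trans (ℕₚ.<⇒≤ (len< p)) (≼-len q)

  ≼-≥ : ∀ {x y} → x ≼ y → len y ≤ len x → x ≈ y
  ≼-≥ (nil e) _ = e
  ≼-≥ (p ◅ q) l = ⊥-elim (ℕₚ.<-irrefl ≡.refl (ℕₚ.≤-trans (len< p) (ℕₚ.≤-trans (≼-len q) l)))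

  ≼-≉⇒< : ∀ {x y} → x ≼ y → ¬ (x ≈ y) → len x < len y
  ≼-≉⇒< (nil e) n = ⊥-elim (n e)
  ≼-≉⇒< (p ◅ q) _ = ℕₚ.<-≤-trans (len< p) (≼-len q)

  up-edge : ∀ {s x} → Up s x → x ⟶ s · x
  up-edge {s} u = edge (refl-gen s) refl (up< u)

  down-edge : ∀ {s x} → Down s x → s · x ⟶ x
  down-edge {s} {x} d = edge (refl-gen s) (sym (cancel s x)) (ℕₚ.≤-reflexive (≡.sym d))

  -- Left multiplication by s reverses only the edges labelled s.
  edge-step : ∀ s {x y} → x ⟶ y → (y ≈ s · x) ⊎ (s · x ⟶ s · y)
  edge-step s {x} {y} (edge {t} r p l) with t ≟ gen s
  ... | yes e = inj₁ (trans p (∙-congʳ e))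
  ... | no n = inj₂ (edge (refl-sts s r) (trans (·-cong s p) (grp (Gen s ∷ []) (t ∷ x ∷ []) (g₀ ⊙ (v₀ ⊙ v₁)) (g₀ ⊙ v₀ ⊙ g₀ ⊙ (g₀ ⊙ v₁)) ≡.refl))
        (≡.subst (len (s · x) <_) (len-cong (·-cong s (sym p))) (gen-edge s r n (≡.subst (len x <_) (len-cong p) l))))
  -- The chain multiplied by s is followed until an edge labelled s, or an element with descent s,
  -- leads back to the original chain.
  lift-up : ∀ s {x y} → x ≼ y → Up s x → Down s y → s · x ≼ y
  lift-up s (nil e) u d = ⊥-elim (up-down (up-cong e u) d)
  lift-up s (_◅_ {z} p q) u d with edge-step s p
  ... | inj₁ e = ≼-congˡ e q
  ... | inj₂ e with up⊎down s z
  ...   | inj₁ uz = e ◅ lift-up s q uz d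
  ...   | inj₂ dz = e ◅ down-edge dz ◅ q

  -- The next two statements need each other, because s may change from ascent to descent and back
  -- along the chain.
  lift-down : ∀ s {x y} → x ≼ y → Up s x → Down s y → x ≼ s · y
  lift-both : ∀ s {x y} → x ≼ y → Down s x → Down s y → s · x ≼ s · y
  lift-down s (nil e) u d = ⊥-elim (up-down (up-cong e u) d)
  lift-down s (_◅_ {z} p q) u d with up⊎down s z
  ... | inj₁ uz = p ◅ lift-down s q uz d
  ... | inj₂ dz with edge-step s p
  ...   | inj₁ e = ≼-congˡ (·-swap s e) (lift-both s q dz d)
  ...   | inj₂ e = up-edge u ◅ e ◅ lift-both s q dz d
  lift-both s (nil e) dx dy = nil (·-cong s e)
  lift-both s (_◅_ {z} p q) dx dy with up⊎down s z
  ... | inj₁ uz = down-edge dx ◅ p ◅ lift-down s q uz dy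
  ... | inj₂ dz with edge-step s p
  ...   | inj₁ e = ⊥-elim (ℕₚ.<-asym (len< p) (≡.subst (_< len _) (≡.sym (len-cong e)) (ℕₚ.≤-reflexive (≡.sym dx))))
  ...   | inj₂ e = e ◅ lift-both s q dz dy

  lift-ups : ∀ s {x y} → x ≼ y → Up s x → Up s y → s · x ≼ s · y
  lift-ups s p ux uy = lift-up s (≼-trans p (⟶⇒≼ (up-edge uy))) ux (up⇒down uy)

  unlift-both : ∀ s {x y} → s · x ≼ s · y → Down s x → Down s y → x ≼ y
  unlift-both s p dx dy = ≼-cong (cancel s _) (cancel s _) (lift-ups s p (down⇒up dx) (down⇒up dy))

  private
    -- A left descent of y is removed from y, and from x too if it is a descent there; the lifting
    -- property makes each step an equivalence.
    dec≼ : ∀ n x y → len y ≤ n → Dec (x ≼ y)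
    dec≼ n x y l with len y ℕₚ.≟ 0
    dec≼ n x y l | yes e = map′ nil (λ p → ≼-≥ p (≡.subst (_≤ len x) (≡.sym e) z≤n)) (x ≟ y)
    dec≼ zero x y l | no ne = ⊥-elim (ne (ℕₚ.n≤0⇒n≡0 l))
    dec≼ (suc n) x y l | no ne with descent y ne
    ... | s , d with up⊎down s x
    ...   | inj₁ u = map′ (λ p → ≼-trans p (⟶⇒≼ (down-edge d))) (λ p → lift-down s p u d) (dec≼ n x (s · y) (ℕₚ.≤-pred (≡.subst (_≤ suc n) d l)))
    ...   | inj₂ dx = map′ (λ p → unlift-both s p dx d) (λ p → lift-both s p dx d) (dec≼ n (s · x) (s · y) (ℕₚ.≤-pred (≡.subst (_≤ suc n) d l)))

  infix 4 _≼?_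
  abstract
    _≼?_ : ∀ x y → Dec (x ≼ y)
    x ≼? y = dec≼ (len y) x y ℕₚ.≤-refl

  record _⋖_ (x y : Carrier) : Set (c ⊔ ℓ) where
    constructor cov
    field
      ⋖⇒⟶ : x ⟶ y
      len-suc : len y ≡ suc (len x)
  open _⋖_ public

  ⋖-cong : ∀ {x x' y y'} → x ≈ x' → y ≈ y' → x ⋖ y → x' ⋖ y'
  ⋖-cong e f (cov p l) = cov (⟶-cong e f p) (≡.trans (len-cong (sym f)) (≡.trans l (≡.cong suc (len-cong e))))

  ⋖⇒≼ : ∀ {x y} → x ⋖ y → x ≼ y
  ⋖⇒≼ p = ⟶⇒≼ (⋖⇒⟶ p)

  ≼⇒⋖ : ∀ {x y} → x ≼ y → len y ≡ suc (len x) → x ⋖ y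
  ≼⇒⋖ {x} (nil e) l = ⊥-elim (ℕₚ.m≢1+n+m (len x) (≡.trans (len-cong e) l))
  ≼⇒⋖ (p ◅ q) l = cov (⟶-cong refl (≼-≥ q (ℕₚ.≤-trans (ℕₚ.≤-reflexive l) (len< p))) p) l

  up-cov : ∀ {s x} → Up s x → x ⋖ s · x
  up-cov u = cov (up-edge u) u

  down-cov : ∀ {s x} → Down s x → s · x ⋖ x
  down-cov d = cov (down-edge d) d

  up≉ : ∀ {s x y} → Up s x → Down s y → ¬ (x ≈ y)
  up≉ u d e = up-down (up-cong e u) d

  -- Otherwise there would be an edge from s x to s y, although s x is the longer of the two.
  cov-exchange : ∀ {s x y} → x ⋖ y → Up s x → Down s y → y ≈ s · x
  cov-exchange {s} {x} {y} (cov p l) u d with edge-step s p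
  ... | inj₁ e = e
  ... | inj₂ e = ⊥-elim (ℕₚ.<⇒≱ (len< e) (ℕₚ.≤-trans (ℕₚ.n≤1+n _) (ℕₚ.≤-reflexive (≡.trans (≡.sym d) (≡.trans l (≡.sym u))))))

  cov-step : ∀ {s x y} → x ⋖ y → ¬ (y ≈ s · x) → len (s · y) ≡ suc (len (s · x)) → s · x ⋖ s · y
  cov-step {s} (cov p l) n h with edge-step s p
  ... | inj₁ e = ⊥-elim (n e)
  ... | inj₂ e = cov e h

  cov-ups : ∀ {s x y} → x ⋖ y → Up s x → Up s y → s · x ⋖ s · y
  cov-ups p ux uy = cov-step p (λ e → up≉ uy (up⇒down ux) e) (≡.trans uy (≡.cong suc (≡.trans (len-suc p) (≡.sym ux))))

  cov-downs : ∀ {s x y} → x ⋖ y → Down s x → Down s y → s · x ⋖ s · y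
  cov-downs p dx dy = cov-step p (λ e → up≉ (down⇒up dx) dy (sym e)) (ℕₚ.suc-injective (≡.trans (≡.sym dy) (≡.trans (len-suc p) (≡.cong suc dx))))

  2-step≼ : ∀ {y x z} → y ⋖ x → x ⋖ z → y ≼ z
  2-step≼ p q = ≼-trans (⋖⇒≼ p) (⋖⇒≼ q)

  len-pred : ∀ {s x n} → Down s x → len x ≡ suc n → len (s · x) ≡ n
  len-pred d e = ℕₚ.suc-injective (≡.trans (≡.sym d) e)

  record Between (y x z : Carrier) : Set (c ⊔ ℓ) where
    constructor btw
    field
      mid : Carrier
      mid≉ : ¬ (mid ≈ x)
      lower : y ⋖ mid
      upper : mid ⋖ z
  -- Induction along a descent k of z. If k is an ascent of y, then k z or k y serves, according to
  -- the position of x. Otherwise the interval is replaced by one that ends in k z, and the middle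
  -- element found there is carried back.
  thin : ∀ n {y x z} → len z ≤ n → y ⋖ x → x ⋖ z → Between y x z
  thin zero l p q = ⊥-elim (ℕₚ.n≮0 (ℕₚ.<-≤-trans (len< (⋖⇒⟶ q)) l))
  thin (suc n) {y} {x} {z} l p q with descent z (λ e → ℕₚ.n≮0 (≡.subst (len x <_) e (len< (⋖⇒⟶ q))))
  ... | k , dz with up⊎down k y | up⊎down k x
  ... | inj₁ uy | inj₂ dx = btw (k · z) (up≉ (down⇒up dz) dx) (≼⇒⋖ (lift-down k (2-step≼ p q) uy dz) (len-pred dz (≡.trans (len-suc q) (≡.cong suc (len-suc p))))) (down-cov dz)
  ... | inj₁ uy | inj₁ ux = btw (k · y) (λ e → up≉ ux (up⇒down uy) (sym e)) (up-cov uy) (≼⇒⋖ (lift-up k (2-step≼ p q) uy dz) (≡.trans (len-suc q) (≡.cong suc (≡.trans (len-suc p) (≡.sym uy)))))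
  ... | inj₂ dy | inj₁ ux with thin n (ℕₚ.≤-pred (≡.subst (_≤ suc n) dz l)) (down-cov dy) (⋖-cong refl (sym (·-swap k (cov-exchange q ux dz))) p)
  ...   | btw p' p'≉ lo up' with up⊎down k p'
  ...     | inj₂ dp = ⊥-elim (p'≉ (trans (cov-exchange lo (down⇒up dy) dp) (cancel k y)))
  ...     | inj₁ up'' = btw (k · p') (λ e → up≉ ux (up⇒down up'') (sym e)) (⋖-cong (cancel k y) refl (cov-ups lo (down⇒up dy) up'')) (⋖-cong refl (cancel k z) (cov-ups up' up'' (down⇒up dz)))
  thin (suc n) {y} {x} {z} l p q | k , dz | inj₂ dy | inj₂ dx with thin n (ℕₚ.≤-pred (≡.subst (_≤ suc n) dz l)) (cov-downs p dy dx) (cov-downs q dx dz)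
  ...   | btw p' p'≉ lo up' with up⊎down k p'
  ...     | inj₁ up'' = btw (k · p') (λ e → p'≉ (sym (·-swap k (sym e)))) (⋖-cong (cancel k y) refl (cov-ups lo (down⇒up dy) up'')) (⋖-cong refl (cancel k z) (cov-ups up' up'' (down⇒up dz)))
  ...     | inj₂ dp = btw (k · z) (up≉ (down⇒up dz) dx) (⋖-cong (trans (cov-exchange lo (down⇒up dy) dp) (cancel k y)) refl up') (down-cov dz)

  other-middle : ∀ {y x z} → y ⋖ x → x ⋖ z → Between y x z
  other-middle = thin _ ℕₚ.≤-refl

  record Path₃ (y x : Carrier) : Set (c ⊔ ℓ) where
    constructor path₃
    field
      {p₁ p₂} : Carrier
      e₁ : y ⟶ p₁
      e₂ : p₁ ⟶ p₂
      e₃ : p₂ ⟶ x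

  -- Together with the edge the path closes a 4-cycle, which is how edges that skip levels are
  -- generated. If k is an ascent of y, the path is y, k y, k x, x. Otherwise a path for k y and k x
  -- is multiplied by k; where an edge labelled k prevents this, the step from k x to x is used
  -- instead.
  long-edge : ∀ n {y x} → len x ≤ n → y ⟶ x → suc (len y) < len x → Path₃ y x
  long-edge n {y} {x} l e lt with descent x (λ z → ℕₚ.n≮0 (≡.subst (_ <_) z lt))
  ... | k , dx with edge-step k e
  ... | inj₁ f = ⊥-elim (ℕₚ.<⇒≱ lt (≡.subst (_≤ suc (len y)) (≡.sym (len-cong f)) ky≤))
    where ky≤ : len (k · y) ≤ suc (len y)
          ky≤ with up⊎down k y
          ... | inj₁ u = ℕₚ.≤-reflexive u
          ... | inj₂ d = ℕₚ.≤-trans (ℕₚ.n≤1+n _) (ℕₚ.≤-trans (ℕₚ.≤-reflexive (≡.sym d)) (ℕₚ.n≤1+n _))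
  ... | inj₂ f with up⊎down k y
  ...   | inj₁ uy = path₃ (up-edge uy) f (down-edge dx)
  long-edge zero {y} {x} l e lt | k , dx | inj₂ f | inj₂ dy = ⊥-elim (ℕₚ.n≮0 (ℕₚ.<-≤-trans lt l))
  long-edge (suc n) {y} {x} l e lt | k , dx | inj₂ f | inj₂ dy with long-edge n (ℕₚ.≤-pred (≡.subst (_≤ suc n) dx l)) f (ℕₚ.≤-pred (≡.subst₂ (λ a b → suc a < b) dy dx lt))
  ...     | path₃ {c₁} {c₂} e₁ e₂ e₃ with edge-step k e₁
  ...       | inj₁ g = path₃ (⟶-cong (trans g (cancel k y)) refl e₂) e₃ (down-edge dx)
  ...       | inj₂ g with edge-step k e₂
  ...         | inj₁ h = path₃ (⟶-cong (cancel k y) (sym h) g) e₃ (down-edge dx)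
  ...         | inj₂ h with edge-step k e₃
  ...           | inj₁ i = ⊥-elim (ℕₚ.<-asym (len< e₃) (≡.subst (len (k · x) <_) (len-cong (·-inj k i)) (ℕₚ.≤-reflexive (≡.sym dx))))
  ...           | inj₂ i = path₃ (⟶-cong (cancel k y) refl g) h (⟶-cong refl (cancel k x) i)

  record JoinClosed {p} (y v : Carrier) (Φ : Carrier → Set p) : Set (c ⊔ ℓ ⊔ p) where
    field
      resp : ∀ {a a'} → a ≈ a' → Φ a → Φ a'
      join : ∀ {a b z} → y ⋖ a → y ⋖ b → a ⋖ z → b ⋖ z → z ≼ v → ¬ (a ≈ b) → Φ a → Φ b
  open JoinClosed
  -- Induction along a descent k of v. If k is an ascent of y, every other atom has a common cover
  -- with k y. If k is a descent of y, the induction is applied to `Φ'` on the atoms e of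
  -- [k y, k v]: an atom other than y stands for k e, and y stands for all atoms of y below k v,
  -- which are connected by a second appeal to the induction.
  atoms-connected : ∀ {p} n {y v} (Φ : Carrier → Set p) → len v ≤ n → JoinClosed y v Φ →
    ∀ {a b} → y ⋖ a → a ≼ v → Φ a → y ⋖ b → b ≼ v → Φ b
  atoms-connected {p} n {y} {v} Φ l J {a} {b} ya av φa yb bv with descent v (λ z → ℕₚ.n≮0 (≡.subst (len y <_) z (ℕₚ.<-≤-trans (len< (⋖⇒⟶ ya)) (≼-len av))))
  ... | k , dv with up⊎down k y
  ... | inj₁ uy = from-ky yb bv (to-ky ya av φa)
    where
    module _ {a} (ya : y ⋖ a) (av : a ≼ v) (a≉ : ¬ (a ≈ k · y)) where
      ua : Up k a
      ua with up⊎down k a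
      ... | inj₁ u = u
      ... | inj₂ d = ⊥-elim (a≉ (cov-exchange ya uy d))
      ka : k · a ≼ v
      ka = lift-up k av ua dv
    to-ky : ∀ {a} → y ⋖ a → a ≼ v → Φ a → Φ (k · y)
    to-ky {a} ya av φ with a ≟ k · y
    ... | yes e = resp J e φ
    ... | no n = join J ya (up-cov uy) (up-cov (ua ya av n)) (cov-ups ya uy (ua ya av n)) (ka ya av n) n φ
    from-ky : ∀ {a} → y ⋖ a → a ≼ v → Φ (k · y) → Φ a
    from-ky {a} ya av φ with a ≟ k · y
    ... | yes e = resp J (sym e) φ
    ... | no n = join J (up-cov uy) ya (cov-ups ya uy (ua ya av n)) (up-cov (ua ya av n)) (ka ya av n) (λ e → n (sym e)) φ
  atoms-connected {p} zero {y} {v} Φ l J {a} {b} ya av φa yb bv | k , dv | inj₂ dy = ⊥-elim (ℕₚ.n≮0 (≡.subst (_≤ 0) dv l))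
  atoms-connected {p} (suc n) {y} {v} Φ l J {a} {b} ya av φa yb bv | k , dv | inj₂ dy = conclude (up⊎down k a) (up⊎down k b)
    where
    l' : len (k · v) ≤ n
    l' = ℕₚ.≤-pred (≡.subst (_≤ suc n) dv l)
    kv≼v : k · v ≼ v
    kv≼v = ⟶⇒≼ (down-edge dv)
    kyu : Up k (k · y)
    kyu = down⇒up dy
    Φ' : Carrier → Set (c ⊔ ℓ ⊔ p)
    Φ' e = (¬ (e ≈ y) → Φ (k · e)) × (e ≈ y → ∀ z → y ⋖ z → z ≼ k · v → Φ z)
    module _ {e} (ye : k · y ⋖ e) (e≉ : ¬ (e ≈ y)) where
      eu : Up k e
      eu with up⊎down k e
      ... | inj₁ u = u
      ... | inj₂ d = ⊥-elim (e≉ (trans (cov-exchange ye kyu d) (cancel k y)))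
      y⋖ke : y ⋖ k · e
      y⋖ke = ⋖-cong (cancel k y) refl (cov-ups ye kyu eu)
    ups-bounded : ∀ {z} → z ≼ k · v → Up k z → k · z ≼ v
    ups-bounded {z} zv u = lift-up k (≼-trans zv kv≼v) u dv
    inner : ∀ {a b} → y ⋖ a → a ≼ k · v → Φ a → y ⋖ b → b ≼ k · v → Φ b
    inner = atoms-connected n Φ l' (record { resp = resp J ; join = λ p q r s z → join J p q r s (≼-trans z kv≼v) })
    J' : JoinClosed (k · y) (k · v) Φ'
    J' .resp e (f , g) = (λ n → resp J (·-cong k e) (f λ h → n (trans (sym e) h))) , (λ h → g (trans e h))
    J' .join {e} {f} {z} ye yf ez fz zv e≉f (φ , ψ) = part₁ , part₂
      where
      part₁ : ¬ (f ≈ y) → Φ (k · f)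
      part₁ f≉ with e ≟ y | up⊎down k z
      ... | no e≉ | inj₁ uz = join J (y⋖ke ye e≉) (y⋖ke yf f≉) (cov-ups ez (eu ye e≉) uz) (cov-ups fz (eu yf f≉) uz) (ups-bounded zv uz) (λ h → e≉f (·-inj k h)) (φ e≉)
      ... | no e≉ | inj₂ dz = ⊥-elim (e≉f (·-inj k (trans (sym (cov-exchange ez (eu ye e≉) dz)) (cov-exchange fz (eu yf f≉) dz))))
      ... | yes e≈ | inj₁ uz = join J (⋖-cong e≈ refl ez) (y⋖ke yf f≉) (up-cov uz) (cov-ups fz (eu yf f≉) uz) (ups-bounded zv uz) (up≉ uz (up⇒down (eu yf f≉))) (ψ e≈ z (⋖-cong e≈ refl ez) zv)
      ... | yes e≈ | inj₂ dz = resp J (cov-exchange fz (eu yf f≉) dz) (ψ e≈ z (⋖-cong e≈ refl ez) zv)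
      part₂ : f ≈ y → ∀ z' → y ⋖ z' → z' ≼ k · v → Φ z'
      part₂ f≈ z' yz' zv' = inner yz zv φz yz' zv'
        where
        e≉ : ¬ (e ≈ y)
        e≉ h = e≉f (trans h (sym f≈))
        yz : y ⋖ z
        yz = ⋖-cong f≈ refl fz
        φz : Φ z
        φz with up⊎down k z
        ... | inj₁ uz = join J (y⋖ke ye e≉) yz (cov-ups ez (eu ye e≉) uz) (up-cov uz) (ups-bounded zv uz) (λ h → up≉ uz (up⇒down (eu ye e≉)) (sym h)) (φ e≉)
        ... | inj₂ dz = resp J (sym (cov-exchange ez (eu ye e≉) dz)) (φ e≉)
    outer : ∀ {a b} → k · y ⋖ a → a ≼ k · v → Φ' a → k · y ⋖ b → b ≼ k · v → Φ' b
    outer = atoms-connected n Φ' l' J'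
    ky⋖y : k · y ⋖ y
    ky⋖y = down-cov dy
    y≼kv : ∀ {a} → y ⋖ a → a ≼ v → Up k a → y ≼ k · v
    y≼kv ya av u = ≼-trans (⋖⇒≼ ya) (lift-down k av u dv)
    Φ'-of-up : ∀ {a} → y ⋖ a → a ≼ v → Up k a → Φ a → Φ' y
    Φ'-of-up ya av u φ = (λ n → ⊥-elim (n refl)) , λ _ z yz zv → inner ya (lift-down k av u dv) φ yz zv
    Φ'-of-down : ∀ {a} → y ⋖ a → a ≼ v → Down k a → Φ a → Φ' (k · a)
    Φ'-of-down {a} ya av d φ = (λ _ → resp J (sym (cancel k a)) φ) , λ e → ⊥-elim (up≉ (down⇒up d) dy e)
    conclude : Up k a ⊎ Down k a → Up k b ⊎ Down k b → Φ b
    conclude (inj₁ ua) (inj₁ ub) = inner ya (lift-down k av ua dv) φa yb (lift-down k bv ub dv)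
    conclude (inj₁ ua) (inj₂ db) = resp J (cancel k b) (proj₁ (outer ky⋖y (y≼kv ya av ua) (Φ'-of-up ya av ua φa) (cov-downs yb dy db) (lift-both k bv db dv)) (up≉ (down⇒up db) dy))
    conclude (inj₂ da) (inj₁ ub) = proj₂ (outer (cov-downs ya dy da) (lift-both k av da dv) (Φ'-of-down ya av da φa) ky⋖y (y≼kv yb bv ub)) refl b yb (lift-down k bv ub dv)
    conclude (inj₂ da) (inj₂ db) = resp J (cancel k b) (proj₁ (outer (cov-downs ya dy da) (lift-both k av da dv) (Φ'-of-down ya av da φa) (cov-downs yb dy db) (lift-both k bv db dv)) (up≉ (down⇒up db) dy))

-- Right cancellation and length-additive products.

module Cancellation (DC : OrderedDomainWithCosines) {c ℓ : Level} (C : CoxeterSystem c ℓ) where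
  open import Defs
  open OrderedDomains
  open import Level using (Level; _⊔_)
  open import Algebra.Bundles using (Group)
  open CoxeterGroups DC C using (len; len-cong; len-0; len-ε; len-inv; len-min; _≟_; IsRefl; refl-conj; refl²; gen²; Gen; word; eval-word; eval-++)
  open BruhatOrder DC C
  open CoxeterSystem C
  open CS C using (eval)
  open Group W
  open GroupSolver W
  open import Data.Nat as ℕ using (suc; _<_; _≤_; z≤n; s≤s; _+_)
  import Data.Nat.Properties as ℕₚ
  open import Data.Product using (∃; _×_; _,_)
  open import Data.Sum using (_⊎_; inj₁; inj₂)
  open import Data.Empty using (⊥; ⊥-elim)
  open import Data.List using (List; []; _∷_; _++_; length)
  import Data.List.Properties as Listₚ
  open import Data.Vec using ([]; _∷_)
  open import Data.List.Relation.Unary.All as All using ([]; _∷_)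
  open import Data.List.Relation.Unary.AllPairs using ([]; _∷_)
  open import Relation.Nullary using (yes; no)
  open import Relation.Binary.PropositionalEquality as ≡ using (_≡_)

  len-∙ : ∀ x y → len (x ∙ y) ≤ len x + len y
  len-∙ x y = ≡.subst (len (x ∙ y) ≤_) (Listₚ.length-++ (word x)) (len-min (word x ++ word y) (trans (eval-++ (word x) (word y)) (∙-cong (eval-word x) (eval-word y))))

  Additive : Carrier → Carrier → Set
  Additive x y = len (x ∙ y) ≡ len x + len y

  left-mul : ∀ s {x y} → x ≼ y → Up s y → s · x ≼ s · y
  left-mul s {x} p uy with up⊎down s x
  ... | inj₁ ux = lift-ups s p ux uy
  ... | inj₂ dx = ≼-trans (⟶⇒≼ (down-edge dx)) (≼-trans p (⟶⇒≼ (up-edge uy)))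

  inv-edge : ∀ {x y} → x ⟶ y → x ⁻¹ ⟶ y ⁻¹
  inv-edge {x} {y} (edge {t} r p l) = edge (refl-conj (x ⁻¹) r)
    (trans (⁻¹-cong p) (trans (grp [] (t ∷ x ∷ []) (inv (v₀ ⊙ v₁)) (inv v₁ ⊙ inv v₀ ⊙ inv (inv v₁) ⊙ inv v₁) ≡.refl)
      (∙-congʳ (∙-congʳ (∙-congˡ t⁻¹)))))
    (≡.subst₂ _<_ (≡.sym (len-inv x)) (≡.sym (len-inv y)) l)
    where t⁻¹ : t ⁻¹ ≈ t
          t⁻¹ = grp ((t , refl² r) ∷ []) [] (inv g₀) g₀ ≡.refl

  inv-≼ : ∀ {x y} → x ≼ y → x ⁻¹ ≼ y ⁻¹
  inv-≼ (nil e) = nil (⁻¹-cong e)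
  inv-≼ (p ◅ q) = inv-edge p ◅ inv-≼ q

  uninv-≼ : ∀ {x y} → x ⁻¹ ≼ y ⁻¹ → x ≼ y
  uninv-≼ {x} {y} p = ≼-cong (inv-inv x) (inv-inv y) (inv-≼ p)
    where inv-inv : ∀ x → x ⁻¹ ⁻¹ ≈ x
          inv-inv x = grp [] (x ∷ []) (inv (inv v₀)) v₀ ≡.refl

  -- Right descents, treated by passing to inverses.
  module _ (k : I) where
    RUp RDown : Carrier → Set
    RUp x = len (x ∙ gen k) ≡ suc (len x)
    RDown x = len x ≡ suc (len (x ∙ gen k))

    swap-inv : ∀ x → k · (x ⁻¹) ≈ (x ∙ gen k) ⁻¹
    swap-inv x = grp (Gen k ∷ []) (x ∷ []) (g₀ ⊙ inv v₀) (inv (v₀ ⊙ g₀)) ≡.refl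

    len-swap : ∀ x → len (k · (x ⁻¹)) ≡ len (x ∙ gen k)
    len-swap x = ≡.trans (len-cong (swap-inv x)) (len-inv _)

    rup⇒ : ∀ {x} → RUp x → Up k (x ⁻¹)
    rup⇒ {x} u = ≡.trans (len-swap x) (≡.trans u (≡.cong suc (≡.sym (len-inv x))))
    rdown⇒ : ∀ {x} → RDown x → Down k (x ⁻¹)
    rdown⇒ {x} d = ≡.trans (len-inv x) (≡.trans d (≡.cong suc (≡.sym (len-swap x))))

    rup⊎rdown : ∀ x → RUp x ⊎ RDown x
    rup⊎rdown x with up⊎down k (x ⁻¹)
    ... | inj₁ u = inj₁ (≡.trans (≡.sym (len-swap x)) (≡.trans u (≡.cong suc (len-inv x))))
    ... | inj₂ d = inj₂ (≡.trans (≡.sym (len-inv x)) (≡.trans d (≡.cong suc (len-swap x))))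

    rup-rdown : ∀ {x} → RUp x → RDown x → ⊥
    rup-rdown u d = up-down (rup⇒ u) (rdown⇒ d)

    rup-cong : ∀ {x y} → x ≈ y → RUp x → RUp y
    rup-cong e u = ≡.trans (len-cong (∙-congʳ (sym e))) (≡.trans u (≡.cong suc (len-cong e)))

    rcancel : ∀ x → x ∙ gen k ∙ gen k ≈ x
    rcancel x = grp (Gen k ∷ []) (x ∷ []) (v₀ ⊙ g₀ ⊙ g₀) v₀ ≡.refl

    rup⇒rdown : ∀ {x} → RUp x → RDown (x ∙ gen k)
    rup⇒rdown {x} u = ≡.trans u (≡.cong suc (≡.sym (len-cong (rcancel x))))
    rdown⇒rup : ∀ {x} → RDown x → RUp (x ∙ gen k)
    rdown⇒rup {x} d = ≡.trans (len-cong (rcancel x)) d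

    rup≼ : ∀ {x} → RUp x → x ≼ x ∙ gen k
    rup≼ {x} u = uninv-≼ (≼-congʳ (swap-inv x) (⟶⇒≼ (up-edge (rup⇒ u))))

    rlift-up : ∀ {x y} → x ≼ y → RUp x → RDown y → x ∙ gen k ≼ y
    rlift-up p u d = uninv-≼ (≼-congˡ (swap-inv _) (lift-up k (inv-≼ p) (rup⇒ u) (rdown⇒ d)))

    rlift-down : ∀ {x y} → x ≼ y → RUp x → RDown y → x ≼ y ∙ gen k
    rlift-down p u d = uninv-≼ (≼-congʳ (swap-inv _) (lift-down k (inv-≼ p) (rup⇒ u) (rdown⇒ d)))

    rlift-both : ∀ {x y} → x ≼ y → RDown x → RDown y → x ∙ gen k ≼ y ∙ gen k
    rlift-both p d d' = uninv-≼ (≼-cong (swap-inv _) (swap-inv _) (lift-both k (inv-≼ p) (rdown⇒ d) (rdown⇒ d')))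

    right-mul : ∀ {x y} → x ≼ y → RUp y → x ∙ gen k ≼ y ∙ gen k
    right-mul p u = uninv-≼ (≼-cong (swap-inv _) (swap-inv _) (left-mul k (inv-≼ p) (rup⇒ u)))

    absorb : ∀ {x y} → x ≼ y → RDown y → x ∙ gen k ≼ y
    absorb {x} p d with rup⊎rdown x
    ... | inj₁ u = rlift-up p u d
    ... | inj₂ d' = ≼-trans (≼-congʳ (rcancel x) (rup≼ (rdown⇒rup d'))) p

    rexchange : ∀ {x y} → x ⋖ y → RUp x → RDown y → y ≈ x ∙ gen k
    rexchange {x} {y} (cov e l) u d = trans (sym ii) (trans (⁻¹-cong (trans (cov-exchange (cov (inv-edge e) (≡.trans (len-inv y) (≡.trans l (≡.cong suc (≡.sym (len-inv x)))))) (rup⇒ u) (rdown⇒ d)) (swap-inv x)))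
        (grp (Gen k ∷ []) (x ∷ []) (inv (inv (v₀ ⊙ g₀))) (v₀ ⊙ g₀) ≡.refl))
      where ii : y ⁻¹ ⁻¹ ≈ y
            ii = grp [] (y ∷ []) (inv (inv v₀)) v₀ ≡.refl
    shr : Carrier → Carrier
    shr y with rup⊎rdown y
    ... | inj₁ _ = y
    ... | inj₂ _ = y ∙ gen k

    data ShrView (y z : Carrier) : Set ℓ where
      stays  : RUp y → z ≈ y → ShrView y z
      shrink : RDown y → z ≈ y ∙ gen k → ShrView y z

    shr-view : ∀ y → ShrView y (shr y)
    shr-view y with rup⊎rdown y
    ... | inj₁ u = stays u refl
    ... | inj₂ d = shrink d refl

  -- Induction on the reduced word of a. Its first letter s is an ascent of both the rest of a and
  -- the rest of the product, so x is lifted down past s and the inequality is multiplied by s again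
  -- if s was a descent of x.
  product-mono : ∀ A {x y z} → let a = eval A in length A ≡ len a → Additive a z → x ≼ a → y ≼ z → x ∙ y ≼ a ∙ z
  product-mono [] {x} {y} {z} _ _ p q = ≼-cong (sym (trans (∙-congʳ (≼-≥ p (ℕₚ.≤-trans (ℕₚ.≤-reflexive len-ε) z≤n))) (identityˡ y))) (sym (identityˡ z)) q
  product-mono (s ∷ A) {x} {y} {z} red ad p q = ≼-congʳ (sym (assoc _ _ _)) main
    where
    a = eval A
    la : len a ≤ length A
    la = len-min A refl
    e1 : len (s · a ∙ z) ≡ suc (length A) + len z
    e1 = ≡.trans ad (≡.cong (_+ len z) (≡.sym red))
    step≤ : ∀ x → len (s · x) ≤ suc (len x)
    step≤ x with up⊎down s x
    ... | inj₁ u = ℕₚ.≤-reflexive u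
    ... | inj₂ d = ℕₚ.≤-trans (ℕₚ.n≤1+n _) (ℕₚ.≤-trans (ℕₚ.≤-reflexive (≡.sym d)) (ℕₚ.n≤1+n _))
    red' : length A ≡ len a
    red' = ℕₚ.≤-antisym (ℕₚ.≤-pred (ℕₚ.≤-trans (ℕₚ.≤-reflexive red) (step≤ a))) la
    ad≥ : length A + len z ≤ len (a ∙ z)
    ad≥ = ℕₚ.≤-pred (ℕₚ.≤-trans (ℕₚ.≤-reflexive (≡.trans (≡.sym e1) (len-cong (assoc _ _ _)))) (step≤ (a ∙ z)))
    ad' : Additive a z
    ad' = ℕₚ.≤-antisym (len-∙ a z) (≡.subst (λ n → n + len z ≤ len (a ∙ z)) red' ad≥)
    ua : Up s a
    ua = ≡.trans (≡.sym red) (≡.cong suc red')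
    uaz : Up s (a ∙ z)
    uaz = ≡.trans (len-cong (sym (assoc _ _ _))) (≡.trans e1 (≡.cong suc (≡.trans (≡.cong (_+ len z) red') (≡.sym ad'))))
    main : x ∙ y ≼ s · (a ∙ z)
    main with up⊎down s x
    ... | inj₁ ux = ≼-trans (product-mono A red' ad' (≼-congʳ (cancel s a) (lift-down s p ux (up⇒down ua))) q) (⟶⇒≼ (up-edge uaz))
    ... | inj₂ dx = ≼-congˡ (trans (sym (assoc _ _ _)) (∙-congʳ (cancel s x))) (left-mul s (product-mono A red' ad' (≼-congʳ (cancel s a) (lift-both s p dx (up⇒down ua))) q) uaz)

  ≼-∙ : ∀ {a x y z} → Additive a z → x ≼ a → y ≼ z → x ∙ y ≼ a ∙ z
  ≼-∙ {a} ad p q = ≼-congʳ (∙-congʳ (eval-word a)) (product-mono (word a) (≡.sym (len-cong (eval-word a)))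
    (≡.trans (len-cong (∙-congʳ (eval-word a))) (≡.trans ad (≡.cong (_+ _) (≡.sym (len-cong (eval-word a)))))) (≼-congʳ (sym (eval-word a)) p) q)

  -- The letters of A either carry the edge upwards one by one, or one of them labels the edge; that
  -- letter is then deleted, as in the exchange condition.
  push-edge : ∀ A {y r} → IsRefl r → len y < len (r ∙ y) →
    (eval A ∙ y ⟶ eval A ∙ (r ∙ y)) ⊎ (∃ λ A' → suc (length A') ≡ length A × eval A ∙ r ≈ eval A')
  push-edge [] {y} {r} ρ l = inj₁ (⟶-cong (sym (identityˡ _)) (sym (identityˡ _)) (edge ρ refl l))
  push-edge (s ∷ A) {y} {r} ρ l with push-edge A ρ l
  ... | inj₂ (A' , e , f) = inj₂ (s ∷ A' , ≡.cong suc e , trans (assoc _ _ _) (∙-congˡ f))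
  ... | inj₁ e with edge-step s e
  ...   | inj₂ e' = inj₁ (⟶-cong (sym (assoc _ _ _)) (sym (assoc _ _ _)) e')
  ...   | inj₁ f = inj₂ (A , ≡.refl , trans (assoc _ _ _) (·-swap s
           (trans (grp [] (eval A ∷ r ∷ y ∷ []) (v₀ ⊙ v₁) (v₀ ⊙ (v₁ ⊙ v₂) ⊙ inv v₂) ≡.refl) (trans (∙-congʳ f) (grp (Gen s ∷ []) (eval A ∷ y ∷ []) (g₀ ⊙ (v₀ ⊙ v₁) ⊙ inv v₁) (g₀ ⊙ v₀) ≡.refl)))))

  -- What remains of x after greedily cancelling the letters of w on the right.
  rem : Carrier → List I → Carrier
  rem x [] = x
  rem x (k ∷ w) = shr k (rem x w)

  record Factored (Q x : Carrier) (w : List I) : Set (c ⊔ ℓ) where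
    constructor factored
    field
      {Q'} : Carrier
      rem≈ : rem (Q ∙ x) w ≈ Q' ∙ rem x w
      Q'≼ : Q' ≼ Q
      additive : Additive Q' (rem x w)

  -- If k cancels from y, additivity makes it cancel from Q' y. If k cancels from Q' y but not from
  -- y, strong exchange deletes a letter of Q', so that Q' shrinks in Bruhat order and y is
  -- untouched.
  rem-factor : ∀ w {Q x} → Additive Q x → Factored Q x w
  rem-factor [] ad = factored refl ≼-refl ad
  rem-factor (k ∷ w) {Q} {x} ad with rem-factor w {Q} {x} ad
  ... | factored {Q'} e le ad' with shr-view k (rem x w) | shr-view k (rem (Q ∙ x) w)
  ...   | stays uy f | stays uz g = factored (trans g (trans e (∙-congˡ (sym f)))) le (≡.trans (len-cong (∙-congˡ f)) (≡.trans ad' (≡.cong (len Q' +_) (len-cong (sym f)))))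
  ...   | shrink dy f | shrink dz g = factored (trans g (trans (∙-congʳ e) (trans (assoc _ _ _) (∙-congˡ (sym f))))) le
          (ℕₚ.suc-injective (≡.trans (≡.cong suc (≡.trans (len-cong (∙-congˡ f)) (len-cong (trans (sym (assoc _ _ _)) (∙-congʳ (sym e)))))) (≡.trans (≡.sym dz) (≡.trans (len-cong e) (≡.trans ad' (≡.trans (≡.cong (len Q' +_) dy) (≡.trans (ℕₚ.+-suc _ _) (≡.cong (λ n → suc (len Q' + n)) (len-cong (sym f))))))))))
  ...   | shrink dy f | stays uz g = ⊥-elim (ℕₚ.<-asym (ℕₚ.≤-reflexive (≡.sym uz)) zk≤)
        where
        y' = rem x w
        z' = rem (Q ∙ x) w
        zk≤ : suc (len (z' ∙ gen k)) ≤ len z'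
        zk≤ = ℕₚ.≤-trans (s≤s (ℕₚ.≤-trans (ℕₚ.≤-reflexive (len-cong (trans (∙-congʳ e) (assoc _ _ _)))) (len-∙ Q' (y' ∙ gen k))))
               (ℕₚ.≤-reflexive (≡.trans (≡.sym (ℕₚ.+-suc _ _)) (≡.trans (≡.cong (len Q' +_) (≡.sym dy)) (≡.trans (≡.sym ad') (len-cong (sym e))))))
  ...   | stays uy f | shrink dz g = result (push-edge (word Q') ρ ry)
        where
        y' = rem x w
        z' = rem (Q ∙ x) w
        r = y' ∙ gen k ∙ y' ⁻¹
        ρ : IsRefl r
        ρ = y' , k , refl
        ry≈ : r ∙ y' ≈ y' ∙ gen k
        ry≈ = grp [] (y' ∷ gen k ∷ []) (v₀ ⊙ v₁ ⊙ inv v₀ ⊙ v₀) (v₀ ⊙ v₁) ≡.refl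
        ry : len y' < len (r ∙ y')
        ry = ≡.subst (len y' <_) (len-cong (sym ry≈)) (ℕₚ.≤-reflexive (≡.sym uy))
        Q'' = Q' ∙ r
        zk : z' ∙ gen k ≈ Q'' ∙ y'
        zk = trans (∙-congʳ e) (trans (assoc _ _ _) (trans (∙-congˡ (sym ry≈)) (sym (assoc _ _ _))))
        result : (eval (word Q') ∙ y' ⟶ eval (word Q') ∙ (r ∙ y')) ⊎ (∃ λ A' → suc (length A') ≡ length (word Q') × eval (word Q') ∙ r ≈ eval A') → Factored Q x (k ∷ w)
        result (inj₁ ed) = ⊥-elim (ℕₚ.<-asym (len< ed') (ℕₚ.≤-reflexive (≡.sym dz)))
          where ed' : z' ⟶ z' ∙ gen k
                ed' = ⟶-cong (trans (∙-congʳ (eval-word Q')) (sym e)) (trans (∙-congʳ (eval-word Q')) (trans (sym (assoc _ _ _)) (sym zk))) ed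
        result (inj₂ (A' , la , ea)) = factored (trans g (trans zk (∙-congˡ (sym f)))) (≼-trans (⟶⇒≼ down) le)
            (ℕₚ.≤-antisym (len-∙ _ _) (ℕₚ.≤-pred (ℕₚ.≤-trans (ℕₚ.+-mono-≤ {suc (len Q'')} lt (ℕₚ.≤-reflexive (len-cong f))) (ℕₚ.≤-reflexive
               (≡.trans (≡.sym ad') (≡.trans (len-cong (sym e)) (≡.trans dz (≡.cong suc (len-cong (trans zk (∙-congˡ (sym f))))))))))))
          where
          lt : suc (len Q'') ≤ len Q'
          lt = ≡.subst (suc (len Q'') ≤_) la (s≤s (len-min A' (trans (sym ea) (∙-congʳ (eval-word Q')))))
          down : Q'' ⟶ Q'
          down = edge (refl-conj Q' ρ) (trans (grp ((r , refl² ρ) ∷ []) (Q' ∷ []) v₀ (v₀ ⊙ g₀ ⊙ inv v₀ ⊙ (v₀ ⊙ g₀)) ≡.refl) refl) lt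

  data Reduced : List I → Set where
    []  : Reduced []
    _∷_ : ∀ {k w} → Up k (eval w) → Reduced w → Reduced (k ∷ w)

  rem-ε-up : ∀ k {y} → y ≈ ε → shr k y ≈ ε
  rem-ε-up k {y} e with shr-view k y
  ... | stays _ f = trans f e
  ... | shrink d f = ⊥-elim (ℕₚ.n≮0 (ℕₚ.≤-trans (ℕₚ.≤-reflexive (≡.sym d)) (ℕₚ.≤-reflexive (≡.trans (len-cong e) len-ε))))

  len-gen1 : ∀ κ → len (gen κ) ≡ 1
  len-gen1 κ with up⊎down κ ε
  ... | inj₁ u = ≡.trans (len-cong (sym (identityʳ _))) (≡.trans u (≡.cong suc len-ε))
  ... | inj₂ d = ⊥-elim (ℕₚ.0≢1+n (≡.trans (≡.sym len-ε) d))

  below-gen : ∀ {Q κ} → Q ≼ gen κ → (Q ≈ ε) ⊎ (Q ≈ gen κ)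
  below-gen {Q} {κ} p with len Q ℕₚ.≟ 0
  ... | yes e = inj₁ (len-0 Q e)
  ... | no n = inj₂ (≼-≥ p (ℕₚ.≤-trans (ℕₚ.≤-reflexive (len-gen1 κ)) (ℕₚ.n≢0⇒n>0 n)))

  gen-additive : ∀ {κ x} → Up κ x → Additive (gen κ) x
  gen-additive {κ} {x} u = ≡.trans u (≡.cong (_+ len x) (≡.sym (len-gen1 κ)))

  rem-cong : ∀ w {x y} → x ≈ y → rem x w ≈ rem y w
  rem-cong [] e = e
  rem-cong (k ∷ w) {x} {y} e with rem-cong w e | shr-view k (rem x w) | shr-view k (rem y w)
  ... | f | stays _ a | stays _ b = trans a (trans f (sym b))
  ... | f | shrink _ a | shrink _ b = trans a (trans (∙-congʳ f) (sym b))
  ... | f | stays u _ | shrink d _ = ⊥-elim (rup-rdown k (rup-cong k f u) d)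
  ... | f | shrink d _ | stays u _ = ⊥-elim (rup-rdown k (rup-cong k (sym f) u) d)

  -- If k is a descent of x, then k x cancels completely against w, so by `rem-factor` what remains
  -- of x is ε or k, and the last cancellation removes k.
  rem-≼ : ∀ w → Reduced w → ∀ {x} → x ≼ eval w → rem x w ≈ ε
  rem-≼ [] _ p = ≼-≥ p (ℕₚ.≤-trans (ℕₚ.≤-reflexive len-ε) z≤n)
  rem-≼ (k ∷ w) (u ∷ r) {x} p with up⊎down k x
  ... | inj₁ ux = rem-ε-up k (rem-≼ w r (≼-congʳ (cancel k _) (lift-down k p ux (up⇒down u))))
  ... | inj₂ dx with rem-factor w {gen k} {k · x} (gen-additive (down⇒up dx)) | rem-≼ w r {k · x} (≼-congʳ (cancel k _) (lift-both k p dx (up⇒down u)))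
  ...   | factored {Q'} e le ad | z = go (below-gen le)
    where
    q≈ : rem x w ≈ Q'
    q≈ = trans (rem-cong w (sym (cancel k x))) (trans e (trans (∙-congˡ z) (identityʳ _)))
    go : (Q' ≈ ε) ⊎ (Q' ≈ gen k) → shr k (rem x w) ≈ ε
    go (inj₁ e) = rem-ε-up k (trans q≈ e)
    go (inj₂ e) with shr-view k (rem x w)
    ... | shrink _ f = trans f (trans (∙-congʳ (trans q≈ e)) (gen² k))
    ... | stays u' _ = ⊥-elim (ℕₚ.0≢1+n (≡.trans (≡.sym len-ε) (≡.trans (len-cong (sym (trans (∙-congʳ (trans q≈ e)) (gen² k)))) u')))

  -- Otherwise x would be the product of y k and k y⁻¹ x, two factors that are both shorter.
  quotient-up : ∀ k {y x} → RDown k y → len x ≡ len y + len (y ⁻¹ ∙ x) → Up k (y ⁻¹ ∙ x)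
  quotient-up k {y} {x} d l with up⊎down k (y ⁻¹ ∙ x)
  ... | inj₁ u' = u'
  ... | inj₂ d' = ⊥-elim (ℕₚ.<-irrefl ≡.refl (ℕₚ.≤-trans (s≤s (ℕₚ.≤-trans (ℕₚ.≤-reflexive (len-cong (grp (Gen k ∷ []) (y ∷ x ∷ []) v₁ (v₀ ⊙ g₀ ⊙ (g₀ ⊙ (inv v₀ ⊙ v₁))) ≡.refl))) (len-∙ (y ∙ gen k) _)))
          (ℕₚ.≤-trans (ℕₚ.+-mono-≤ (ℕₚ.≤-reflexive (≡.sym d)) (ℕₚ.≤-trans (ℕₚ.n≤1+n _) (ℕₚ.≤-reflexive (≡.sym d')))) (ℕₚ.≤-reflexive (≡.sym l)))))

  -- The cancelled letters build up a right factor b of x with lengths adding. A cancelled k is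
  -- prefixed to b; any other k only enlarges the bound `eval w`.
  rem-quotient : ∀ w → Reduced w → ∀ x → let y = rem x w in len x ≡ len y + len (y ⁻¹ ∙ x) × y ⁻¹ ∙ x ≼ eval w
  rem-quotient [] _ x = ≡.trans (≡.sym (ℕₚ.+-identityʳ _)) (≡.cong (len x +_) (≡.sym (≡.trans (len-cong (inverseˡ x)) len-ε))) , nil (inverseˡ x)
  rem-quotient (k ∷ w) (u ∷ r) x with rem-quotient w r x
  ... | l , le with shr-view k (rem x w)
  ...   | stays _ f = ≡.trans l (≡.cong₂ _+_ (len-cong (sym f)) (len-cong (∙-congʳ (⁻¹-cong (sym f))))) , ≼-congˡ (∙-congʳ (⁻¹-cong (sym f))) (≼-trans le (⟶⇒≼ (up-edge u)))
  ...   | shrink d f = ≡.trans l (≡.trans (≡.cong (_+ len (y' ⁻¹ ∙ x)) d) (≡.trans (≡.sym (ℕₚ.+-suc _ _)) (≡.cong₂ _+_ (len-cong (sym f)) (≡.trans (≡.sym up') (len-cong (sym q≈)))))) ,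
          ≼-congˡ (sym q≈) (left-mul k le u)
    where
    y' = rem x w
    q≈ : shr k y' ⁻¹ ∙ x ≈ k · (y' ⁻¹ ∙ x)
    q≈ = trans (∙-congʳ (⁻¹-cong f)) (grp (Gen k ∷ []) (y' ∷ x ∷ []) (inv (v₀ ⊙ g₀) ⊙ v₁) (g₀ ⊙ (inv v₀ ⊙ v₁)) ≡.refl)
    up' = quotient-up k d l

-- Few seeds generate: the percolation argument.

module Percolations (DC : OrderedDomainWithCosines) {c ℓ : Level} (C : CoxeterSystem c ℓ) where
  open import Defs
  open OrderedDomains
  open import Level using (Level; _⊔_)
  open import Algebra.Bundles using (Group)
  open CoxeterGroups DC C using (len; len-cong; len-ε; _≟_; descent; IsRefl; refl-cong; refl-sts; Gen)
  open BruhatOrder DC C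
  open Cancellation DC C
  open CoxeterSystem C
  open CS C using (eval)
  open Group W
  open GroupSolver W
  open import Data.Nat as ℕ using (ℕ; zero; suc; _<_; _≤_; z≤n; s≤s; _+_)
  import Data.Nat.Properties as ℕₚ
  import Data.List.Relation.Unary.All.Properties as AllP
  import Data.List.Properties as Listₚ
  open import Data.Product using (∃; _×_; _,_; proj₁; proj₂)
  open import Data.Sum using (_⊎_; inj₁; inj₂)
  open import Data.Empty using (⊥; ⊥-elim)
  open import Data.List using (List; []; _∷_; length; _++_)
  open import Data.Vec using ([]; _∷_)
  open import Data.List.Relation.Unary.All as All using (All; []; _∷_)
  open import Data.List.Relation.Unary.AllPairs using (AllPairs; []; _∷_)
  open import Relation.Nullary using (¬_; yes; no)
  open import Relation.Binary.PropositionalEquality as ≡ using (_≡_)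

  Cover : Carrier → Carrier → Set (c ⊔ ℓ)
  Cover x v = ∃ λ z → x ⋖ z × z ≼ v

  -- Edges may skip levels, so a cover has to be built: along a descent s of v it is s x, or arises
  -- from covers found below s v, or is v itself.
  cover-above : ∀ n {x v} → len v ≤ n → x ≼ v → ¬ (x ≈ v) → Cover x v
  cover-above zero {x} l p ne = ⊥-elim (ℕₚ.n≮0 (ℕₚ.<-≤-trans (≼-≉⇒< p ne) l))
  cover-above (suc n) {x} {v} l p ne with descent v (λ e → ℕₚ.n≮0 (≡.subst (len x <_) e (≼-≉⇒< p ne)))
  ... | s , dv with up⊎down s x
  ...   | inj₁ ux = s · x , up-cov ux , lift-up s p ux dv
  ...   | inj₂ dx with cover-above n (ℕₚ.≤-pred (≡.subst (_≤ suc n) dv l)) (lift-both s p dx dv) (λ e → ne (·-inj s e))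
  ...     | z , xz , zv with up⊎down s z
  ...       | inj₁ uz = s · z , ⋖-cong (cancel s x) refl (cov-ups xz (down⇒up dx) uz) , lift-up s (≼-trans zv (⟶⇒≼ (down-edge dv))) uz dv
  ...       | inj₂ dz with x ≟ s · v
  ...         | yes e = v , ⋖-cong (sym e) refl (down-cov dv) , ≼-refl
  ...         | no ne' with cover-above n (ℕₚ.≤-pred (≡.subst (_≤ suc n) dv l)) (≼-congˡ (trans (cov-exchange xz (down⇒up dx) dz) (cancel s x)) zv) ne'
  ...           | z' , xz' , zv' = z' , xz' , ≼-trans zv' (⟶⇒≼ (down-edge dv))

  -- If a cover z has k as an ascent, the second middle element between x and k z replaces it.
  down-cover-above : ∀ k {x v} → x ≼ v → ¬ (x ≈ v) → Down k x → Down k v → ∃ λ z → x ⋖ z × z ≼ v × Down k z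
  down-cover-above k {x} {v} p ne dx dv with cover-above (len v) ℕₚ.≤-refl p ne
  ... | z , xz , zv with up⊎down k z
  ...   | inj₂ dz = z , xz , zv , dz
  ...   | inj₁ uz with other-middle xz (up-cov uz)
  ...     | btw m m≉ xm mk with up⊎down k m
  ...       | inj₂ dm = m , xm , ≼-trans (⋖⇒≼ mk) (lift-up k zv uz dv) , dm
  ...       | inj₁ um = ⊥-elim (m≉ (sym (·-inj k (cov-exchange mk um (up⇒down uz)))))

  record Percolating (u v : Carrier) (T : Carrier → Set (c ⊔ ℓ)) : Set (c ⊔ ℓ) where
    field
      resp : ∀ {x y} → x ≈ y → T x → T y
      top : T v
      upper : ∀ {x y} → u ≼ x → x ≼ y → y ≼ v → T x → T y
      diamond : ∀ {y a b z} → u ≼ y → y ⋖ a → y ⋖ b → a ⋖ z → b ⋖ z → z ≼ v → ¬ (a ≈ b) → T a → T b → T z → T y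

  module _ {u v k T} (p : Percolating u v T) (dv : Down k v) (Tq : T (k · v)) where
    open Percolating p

    -- Induction downwards from v, where the claim is `Tq`. Any other x has a cover z with descent
    -- k, and k x is the bottom of the diamond with middle elements x and k z, both in T, and top z.
    stable : ∀ n {x} → len v ≤ n + len x → u ≼ k · x → x ≼ v → Down k x → T x → T (k · x)
    stable n {x} l u≼ x≼v dx tx with x ≟ v
    ... | yes e = resp (·-cong k (sym e)) Tq
    stable zero {x} l u≼ x≼v dx tx | no ne = ⊥-elim (ne (≼-≥ x≼v l))
    stable (suc n) {x} l u≼ x≼v dx tx | no ne with down-cover-above k x≼v ne dx dv
    ... | z , xz , zv , dz = diamond u≼ (down-cov dx) (cov-downs xz dx dz) xz (down-cov dz) zv (λ e → up≉ (down⇒up dz) dx (sym e)) tx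
            (stable n (≡.subst (len v ≤_) (≡.trans (≡.sym (ℕₚ.+-suc n _)) (≡.cong (n +_) (≡.sym (len-suc xz)))) l)
              (≼-trans u≼ (⋖⇒≼ (cov-downs xz dx dz))) zv dz tz) tz
      where tz : T z
            tz = upper (≼-trans u≼ (⟶⇒≼ (down-edge dx))) (⋖⇒≼ xz) zv tx

  d : Carrier → List I → ℕ
  d u [] = 0
  d u (k ∷ w) with up⊎down k u | k · u ≼? eval w
  ... | inj₁ _ | yes _ = d u w
  ... | inj₁ _ | no _ = suc (d u w)
  ... | inj₂ _ | _ = d (k · u) w

  d-in : ∀ {k u} w → Up k u → k · u ≼ eval w → d u (k ∷ w) ≡ d u w
  d-in {k} {u} w up p with up⊎down k u | k · u ≼? eval w
  ... | inj₁ _ | yes _ = ≡.refl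
  ... | inj₁ _ | no n = ⊥-elim (n p)
  ... | inj₂ dn | _ = ⊥-elim (up-down up dn)

  d-out : ∀ {k u} w → Up k u → ¬ (k · u ≼ eval w) → d u (k ∷ w) ≡ suc (d u w)
  d-out {k} {u} w up n with up⊎down k u | k · u ≼? eval w
  ... | inj₁ _ | yes p = ⊥-elim (n p)
  ... | inj₁ _ | no _ = ≡.refl
  ... | inj₂ dn | _ = ⊥-elim (up-down up dn)

  d-down : ∀ {k u} w → Down k u → d u (k ∷ w) ≡ d (k · u) w
  d-down {k} {u} w dn with up⊎down k u | k · u ≼? eval w
  ... | inj₁ up | _ = ⊥-elim (up-down up dn)
  ... | inj₂ _ | _ = ≡.refl

  -- A relation remembers a step at which the bottom U of the interval and its
  -- neighbour κU both lay in the lower half.  Transported to the present interval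
  -- it says that membership passes from t·x down to x for every x ≥ b.
  record Rel (u : Carrier) (w : List I) : Set (c ⊔ ℓ) where
    field
      U P : Carrier
      κ : I
      κ-up : Up κ U
      alive : rem (κ · U) w ≈ rem U w
    y : Carrier
    y = rem U w
    b : Carrier
    b = y ⁻¹ ∙ U
    t : Carrier
    t = y ⁻¹ ∙ (κ · y)
    field
      u≼b : u ≼ b
      κy⋠P : ¬ (κ · y ≼ P)
      y≼P : y ≼ P
      P-add : Additive P (eval w)
      U-add : len U ≡ len (U ∙ u ⁻¹) + len u
      Q≼P : U ∙ u ⁻¹ ≼ P
  open Rel

  -- `P` is the product of the letters removed since a relation was made. Π is the product of those
  -- removed after i was made and up to the making of j, so it ends in the letter κ j.
  record Newer {u w} (j i : Rel u w) : Set (c ⊔ ℓ) where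
    field
      Ui-add : len (U i) ≡ len (U i ∙ U j ⁻¹) + len (U j)
      {Π} : Carrier
      Q≼Π : U i ∙ U j ⁻¹ ≼ Π
      Π-down : RDown (κ j) Π
      Pi≈ : P i ≈ Π ∙ P j
      Π-add : Additive Π (P j)

  t-refl : ∀ {u w} (r : Rel u w) → IsRefl (t r)
  t-refl r = refl-cong (grp (Gen (κ r) ∷ []) (y r ∷ []) (inv v₀ ⊙ g₀ ⊙ inv (inv v₀)) (inv v₀ ⊙ (g₀ ⊙ v₀)) ≡.refl) (y r ⁻¹ , κ r , refl)

  -- Equal labels give κ_i y_i = (Q' κ_j) y_j with Q' κ_j ≼ Π and y_j ≼ P_j. The product then lies
  -- below Π P_j = P_i, against `κy⋠P`.
  labels-distinct : ∀ {u w} {j i : Rel u w} → Newer j i → ¬ (t j ≈ t i)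
  labels-distinct {u} {w} {j} {i} n e with rem-factor w {U i ∙ U j ⁻¹} {U j} (≡.trans (len-cong back) Ui-add)
    where open Newer n
          back : U i ∙ U j ⁻¹ ∙ U j ≈ U i
          back = grp [] (U i ∷ U j ∷ []) (v₀ ⊙ inv v₁ ⊙ v₁) v₀ ≡.refl
  ... | factored {Q'} f le _ = κy⋠P i (≼-cong (sym κy≈) (sym Pi≈) (≼-∙ Π-add (absorb (κ j) (≼-trans le Q≼Π) Π-down) (y≼P j)))
    where
    open Newer n
    yi : y i ≈ Q' ∙ y j
    yi = trans (rem-cong w (grp [] (U i ∷ U j ∷ []) v₀ (v₀ ⊙ inv v₁ ⊙ v₁) ≡.refl)) f
    κy≈ : κ i · y i ≈ Q' ∙ gen (κ j) ∙ y j
    κy≈ = trans (grp (Gen (κ i) ∷ []) (y i ∷ []) (g₀ ⊙ v₀) (v₀ ⊙ (inv v₀ ⊙ (g₀ ⊙ v₀))) ≡.refl) (trans (∙-cong yi (sym e))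
      (grp (Gen (κ j) ∷ []) (Q' ∷ y j ∷ []) (v₀ ⊙ v₁ ⊙ (inv v₁ ⊙ (g₀ ⊙ v₁))) (v₀ ⊙ g₀ ⊙ v₁) ≡.refl))

  gen≉ε : ∀ κ → ¬ (gen κ ≈ ε)
  gen≉ε κ e = ℕₚ.1+n≢0 (≡.trans (≡.sym (len-gen1 κ)) (≡.trans (len-cong e) len-ε))

  data Lower (k : I) (u : Carrier) : Carrier → Set where
    up   : Up k u → Lower k u u
    down : Down k u → Lower k u (k · u)

  module Step {k w} (q-up : Up k (eval w)) (redw : Reduced w) where
    q v : Carrier
    q = eval w
    v = k · q
    private
      red : Reduced (k ∷ w)
      red = q-up ∷ redw
    v-down : Down k v
    v-down = up⇒down q-up
    q≼v : q ≼ v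
    q≼v = ⟶⇒≼ (up-edge q-up)
    to-q : ∀ {x} → x ≼ k · v → x ≼ q
    to-q = ≼-congʳ (cancel k q)

    module _ {u} (r : Rel u (k ∷ w)) where
      y' b' t' : Carrier
      y' = rem (U r) w
      b' = y' ⁻¹ ∙ U r
      t' = y' ⁻¹ ∙ (κ r · y')

      quotient-add : len (U r) ≡ len y' + len b'
      quotient-add = proj₁ (rem-quotient w redw (U r))
      b'≼q : b' ≼ q
      b'≼q = proj₂ (rem-quotient w redw (U r))

      -- Here k cancels from y', so the step conjugates the label by k and moves b to k b. In the
      -- other case, `β`, label and base stay as they are.
      module α (dn : RDown k y') (e : y r ≈ y' ∙ gen k) where
        b≈ : b r ≈ k · b'
        b≈ = trans (∙-congʳ (⁻¹-cong e)) (grp (Gen k ∷ []) (y' ∷ U r ∷ []) (inv (v₀ ⊙ g₀) ⊙ v₁) (g₀ ⊙ (inv v₀ ⊙ v₁)) ≡.refl)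
        b'-up : Up k b'
        b'-up = quotient-up k dn quotient-add
        b-down : Down k (b r)
        b-down = down-cong (sym b≈) (up⇒down b'-up)
        b'≈ : k · b r ≈ b'
        b'≈ = ·-swap k b≈
        t≈ : t r ≈ gen k ∙ t' ∙ gen k
        t≈ = trans (∙-cong (⁻¹-cong e) (∙-congˡ e)) (grp (Gen k ∷ Gen (κ r) ∷ []) (y' ∷ []) (inv (v₀ ⊙ g₀) ⊙ (g₁ ⊙ (v₀ ⊙ g₀))) (g₀ ⊙ (inv v₀ ⊙ (g₁ ⊙ v₀)) ⊙ g₀) ≡.refl)
        y-up : RUp k (y r)
        y-up = rup-cong k (sym e) (rdown⇒rup k dn)
        -- If b were below q, it would cancel completely against w, and what remains of U would lie
        -- below y; but y' is longer than y.
        b⋠q : ¬ (b r ≼ q)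
        b⋠q p with rem-factor w {y r} {b r} (≡.trans (len-cong yb) (proj₁ (rem-quotient (k ∷ w) red (U r))))
          where yb : y r ∙ b r ≈ U r
                yb = grp [] (y r ∷ U r ∷ []) (v₀ ⊙ (inv v₀ ⊙ v₁)) v₁ ≡.refl
        ... | factored {Q'} f le _ = ℕₚ.<⇒≱ (ℕₚ.≤-reflexive (≡.sym (≡.trans dn (≡.cong suc (len-cong (sym e))))))
                (ℕₚ.≤-trans (ℕₚ.≤-reflexive (len-cong y'≈)) (≼-len le))
          where y'≈ : y' ≈ Q'
                y'≈ = trans (rem-cong w (grp [] (y r ∷ U r ∷ []) v₁ (v₀ ⊙ (inv v₀ ⊙ v₁)) ≡.refl)) (trans f (trans (∙-congˡ (rem-≼ w redw p)) (identityʳ Q')))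
        -- Label k would make κ U = y b' shorter than U = y' b', although κ lengthens U.
        t≉k : ¬ (t r ≈ gen k)
        t≉k tk = ℕₚ.<⇒≱ (ℕₚ.≤-reflexive (≡.sym (κ-up r))) (ℕₚ.≤-trans (ℕₚ.≤-trans (ℕₚ.≤-reflexive (len-cong κU)) (len-∙ (y r) b'))
             (ℕₚ.≤-trans (ℕₚ.+-mono-≤ (ℕₚ.≤-trans (ℕₚ.n≤1+n _) (ℕₚ.≤-reflexive (≡.sym (≡.trans dn (≡.cong suc (len-cong (sym e))))))) ℕₚ.≤-refl) (ℕₚ.≤-reflexive (≡.sym quotient-add))))
          where κU : κ r · U r ≈ y r ∙ b'
                κU = trans (grp (Gen (κ r) ∷ []) (y r ∷ U r ∷ []) (g₀ ⊙ v₁) (v₀ ⊙ ((inv v₀ ⊙ (g₀ ⊙ v₀)) ⊙ (inv v₀ ⊙ v₁))) ≡.refl) (∙-congˡ (trans (∙-congʳ tk) b'≈))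

      module β (e : y r ≈ y') where
        b≈ : b r ≈ b'
        b≈ = ∙-congʳ (⁻¹-cong e)
        t≈ : t r ≈ t'
        t≈ = ∙-cong (⁻¹-cong e) (∙-congˡ e)
        b≼q : b r ≼ q
        b≼q = ≼-congˡ (sym b≈) b'≼q

      -- This is what lets a relation pay for a seed: label k moves q to v, and b ≼ q makes the
      -- relation applicable at q.
      label-k⇒b≼q : t r ≈ gen k → b r ≼ q
      label-k⇒b≼q tk with shr-view k y'
      ... | stays _ e = β.b≼q e
      ... | shrink dn e = ⊥-elim (α.t≉k dn e tk)

      P-up : RUp k (P r)
      P-up with rup⊎rdown k (P r)
      ... | inj₁ u' = u'
      ... | inj₂ d' = ⊥-elim (ℕₚ.<⇒≱ (ℕₚ.+-monoˡ-< (len q) (ℕₚ.≤-trans (ℕₚ.≤-reflexive (≡.sym d')) (ℕₚ.n≤1+n _)))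
           (ℕₚ.≤-trans (ℕₚ.≤-reflexive (≡.trans (≡.sym (≡.trans (≡.cong (len (P r) +_) q-up) (ℕₚ.+-suc _ _))) (≡.sym (P-add r))))
             (ℕₚ.≤-trans (ℕₚ.≤-reflexive (len-cong (sym (assoc _ _ _)))) (len-∙ (P r ∙ gen k) q))))

      P'-add : Additive (P r ∙ gen k) q
      P'-add = ≡.trans (len-cong (assoc _ _ _)) (≡.trans (P-add r) (≡.trans (≡.cong (len (P r) +_) q-up) (≡.trans (ℕₚ.+-suc _ _) (≡.cong (_+ len q) (≡.sym P-up)))))

      module Survive (t≉k : ¬ (t r ≈ gen k)) where
        -- What remains of κ U is y' or κ y'. In the second case the two remainders differ, and they
        -- can become equal on cancelling k only if they differ by k on the right, which means label
        -- k.
        alive' : rem (κ r · U r) w ≈ y'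
        alive' with rem-factor w {gen (κ r)} {U r} (gen-additive (κ-up r))
        ... | factored {Q'} f le _ with below-gen le
        ...   | inj₁ e = trans f (trans (∙-congʳ e) (identityˡ _))
        ...   | inj₂ e = ⊥-elim (absurd (shr-view k z') (shr-view k y') (alive r))
          where
          z' = rem (κ r · U r) w
          z≈ : z' ≈ κ r · y'
          z≈ = trans f (∙-congʳ e)
          same : ¬ (z' ≈ y')
          same h = gen≉ε (κ r) (trans (grp [] (gen (κ r) ∷ y' ∷ []) v₀ (v₀ ⊙ v₁ ⊙ inv v₁) ≡.refl) (trans (∙-congʳ (trans (sym z≈) h)) (inverseʳ y')))
          absurd : ∀ {a b} → ShrView k z' a → ShrView k y' b → a ≈ b → ⊥
          absurd (stays _ p) (stays _ q) h = same (trans (sym p) (trans h q))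
          absurd (shrink _ p) (shrink _ q) h = same (trans (sym (rcancel k z')) (trans (∙-congʳ (trans (sym p) (trans h q))) (rcancel k y')))
          absurd (stays _ p) (shrink dn q) h with shr-view k y'
          ... | stays u' _ = rup-rdown k u' dn
          ... | shrink _ q' = t≉k (trans (∙-cong (⁻¹-cong q') (∙-congˡ q')) (trans (grp (Gen k ∷ Gen (κ r) ∷ []) (y' ∷ []) (inv (v₀ ⊙ g₀) ⊙ (g₁ ⊙ (v₀ ⊙ g₀))) (g₀ ⊙ inv v₀ ⊙ (g₁ ⊙ v₀) ⊙ g₀) ≡.refl)
                (trans (∙-congʳ (∙-congˡ (trans (sym z≈) (trans (sym p) (trans h q))))) (grp (Gen k ∷ []) (y' ∷ []) (g₀ ⊙ inv v₀ ⊙ (v₀ ⊙ g₀) ⊙ g₀) g₀ ≡.refl))))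
          absurd (shrink _ p) (stays up' q) h with shr-view k y'
          ... | shrink dn _ = rup-rdown k up' dn
          ... | stays _ q' = t≉k (trans (∙-cong (⁻¹-cong q') (∙-congˡ q')) (trans (∙-congˡ (trans (sym z≈) (trans (sym (rcancel k z')) (∙-congʳ (trans (sym p) (trans h q))))))
                (grp [] (y' ∷ gen k ∷ []) (inv v₀ ⊙ (v₀ ⊙ v₁)) v₁ ≡.refl)))

        -- If κ y is longer than y, a new right descent k gives κ y = y k by exchange, which is
        -- label k. If it is shorter, it lies below y and hence below P, against `κy⋠P`.
        κy-up : RUp k (y r) → RUp k (κ r · y r)
        κy-up uy with rup⊎rdown k (κ r · y r)
        ... | inj₁ u' = u'
        ... | inj₂ d' with up⊎down (κ r) (y r)
        ...   | inj₁ u'' = ⊥-elim (t≉k (trans (∙-congˡ (rexchange k (up-cov u'') uy d')) (grp [] (y r ∷ gen k ∷ []) (inv v₀ ⊙ (v₀ ⊙ v₁)) v₁ ≡.refl)))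
        ...   | inj₂ d'' = ⊥-elim (κy⋠P r (≼-trans (⟶⇒≼ (down-edge d'')) (y≼P r)))

        y'≼P' : y' ≼ P r ∙ gen k
        y'≼P' with shr-view k y'
        ... | stays _ e = ≼-congˡ e (≼-trans (y≼P r) (rup≼ k P-up))
        ... | shrink dn e = ≼-congˡ (trans (∙-congʳ e) (rcancel k y')) (right-mul k (y≼P r) P-up)

        κy'⋠P' : ¬ (κ r · y' ≼ P r ∙ gen k)
        κy'⋠P' p with shr-view k y'
        ... | stays uy e = κy⋠P r (≼-congʳ (rcancel k _) (rlift-down k (≼-congˡ (∙-congˡ (sym e)) p) (κy-up (rup-cong k (sym e) uy)) (rup⇒rdown k P-up)))
        ... | shrink dn e = κy⋠P r (≼-cong (rcancel k _) (rcancel k _) (rlift-both k (≼-congˡ (trans (∙-congˡ (sym (trans (∙-congʳ e) (rcancel k y')))) (sym (assoc _ _ _))) p)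
                (rup⇒rdown k (κy-up (α.y-up dn e))) (rup⇒rdown k P-up)))

        u'≼b' : ∀ {u'} → Lower k u u' → u' ≼ b'
        u'≼b' lo with shr-view k y'
        u'≼b' (up uu) | shrink dn e = ≼-congʳ (α.b'≈ dn e) (lift-down k (u≼b r) uu (α.b-down dn e))
        u'≼b' (down du) | shrink dn e = ≼-congʳ (α.b'≈ dn e) (lift-both k (u≼b r) du (α.b-down dn e))
        u'≼b' (up uu) | stays _ e = ≼-congʳ (β.b≈ e) (u≼b r)
        u'≼b' (down du) | stays _ e = ≼-trans (⟶⇒≼ (down-edge du)) (≼-congʳ (β.b≈ e) (u≼b r))

        Q' : ∀ {u'} → Lower k u u' → len (U r) ≡ len (U r ∙ u' ⁻¹) + len u' × U r ∙ u' ⁻¹ ≼ P r ∙ gen k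
        Q' (up uu) = U-add r , ≼-trans (Q≼P r) (rup≼ k P-up)
        Q' (down du) = ≡.trans (U-add r) (≡.trans (≡.cong (len Q +_) du) (≡.trans (ℕₚ.+-suc _ _) (≡.cong (_+ len (k · u)) (≡.trans (≡.sym Q-up) (len-cong (sym Q≈)))))) , ≼-congˡ (sym Q≈) (right-mul k (Q≼P r) P-up)
          where
          Q = U r ∙ u ⁻¹
          Q≈ : U r ∙ (k · u) ⁻¹ ≈ Q ∙ gen k
          Q≈ = grp (Gen k ∷ []) (U r ∷ u ∷ []) (v₀ ⊙ inv (g₀ ⊙ v₁)) (v₀ ⊙ inv v₁ ⊙ g₀) ≡.refl
          Q-up : RUp k Q
          Q-up with rup⊎rdown k Q
          ... | inj₁ h = h
          ... | inj₂ h = ⊥-elim (ℕₚ.<⇒≱ (ℕₚ.+-mono-< (ℕₚ.≤-reflexive (≡.sym h)) (ℕₚ.≤-reflexive (≡.sym du)))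
                (ℕₚ.≤-trans (ℕₚ.≤-reflexive (≡.sym (U-add r))) (ℕₚ.≤-trans (ℕₚ.≤-reflexive (len-cong (grp (Gen k ∷ []) (U r ∷ u ∷ []) v₀ (v₀ ⊙ inv v₁ ⊙ g₀ ⊙ (g₀ ⊙ v₁)) ≡.refl))) (len-∙ (Q ∙ gen k) (k · u)))))

        next : ∀ {u'} → Lower k u u' → Rel u' w
        next lo = record { U = U r ; P = P r ∙ gen k ; κ = κ r ; κ-up = κ-up r ; alive = alive' ; u≼b = u'≼b' lo ; κy⋠P = κy'⋠P' ; y≼P = y'≼P' ; P-add = P'-add
                         ; U-add = proj₁ (Q' lo) ; Q≼P = proj₂ (Q' lo) }

    -- T is read off at the larger of y and k y, which lies in [u, v] for every y in [u', q].
    Lift : (Carrier → Set (c ⊔ ℓ)) → Carrier → Set (c ⊔ ℓ)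
    Lift T y = (Up k y × T (k · y)) ⊎ (Down k y × T y)

    ∗-up : ∀ {u u'} → Lower k u u' → ∀ {y} → u' ≼ y → Up k y → u ≼ k · y
    ∗-up (up _) h uy = ≼-trans h (⟶⇒≼ (up-edge uy))
    ∗-up {u} (down _) h uy = ≼-congˡ (cancel k u) (left-mul k h uy)

    ∗-down : ∀ {u u'} → Lower k u u' → ∀ {y} → u' ≼ y → Down k y → u ≼ y
    ∗-down (up _) h dy = h
    ∗-down {u} (down du) h dy = ≼-congˡ (cancel k u) (lift-up k h (down⇒up du) dy)

    module _ {u u'} (lo : Lower k u u') where
      module Semantics {T : Carrier → Set (c ⊔ ℓ)} (p : Percolating u v T) (Tq : u ≼ q → T q) where
        open Percolating p

        to-v : ∀ {y} → y ≼ q → k · y ≼ v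
        to-v yq = left-mul k yq q-up

        push-down : ∀ {x} → u ≼ k · x → x ≼ v → Down k x → T x → T (k · x)
        push-down {x} h xv dx = stable p v-down (resp (sym (cancel k q)) (Tq (≼-trans h (to-q (lift-both k xv dx v-down))))) (len v) (ℕₚ.m≤m+n _ _) h xv dx

        drop : ∀ {y} → u ≼ y → y ≼ q → Lift T y → T y
        drop {y} h yq (inj₁ (uy , ty)) = resp (cancel k y) (push-down (≼-congʳ (sym (cancel k y)) h) (to-v yq) (up⇒down uy) ty)
        drop h yq (inj₂ (_ , ty)) = ty

        raise : ∀ {y} → u ≼ y → y ≼ q → T y → Lift T y
        raise {y} h yq ty with up⊎down k y
        ... | inj₁ uy = inj₁ (uy , upper h (⟶⇒≼ (up-edge uy)) (to-v yq) ty)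
        ... | inj₂ dy = inj₂ (dy , ty)

        lift-resp : ∀ {x y} → x ≈ y → Lift T x → Lift T y
        lift-resp e (inj₁ (a , b)) = inj₁ (up-cong e a , resp (·-cong k e) b)
        lift-resp e (inj₂ (a , b)) = inj₂ (down-cong e a , resp e b)

        at-up : ∀ {x} → Up k x → Lift T x → T (k · x)
        at-up ux (inj₁ (_ , h)) = h
        at-up ux (inj₂ (dx , _)) = ⊥-elim (up-down ux dx)

        at-down : ∀ {x} → Down k x → Lift T x → T x
        at-down dx (inj₂ (_ , h)) = h
        at-down dx (inj₁ (ux , _)) = ⊥-elim (up-down ux dx)

        lift-upper : ∀ {x y} → u' ≼ x → x ≼ y → y ≼ q → Lift T x → Lift T y
        lift-upper {x} {y} h xy yq (inj₁ (ux , tx)) with up⊎down k y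
        ... | inj₁ uy = inj₁ (uy , upper (∗-up lo h ux) (lift-ups k xy ux uy) (to-v yq) tx)
        ... | inj₂ dy = inj₂ (dy , upper (∗-up lo h ux) (lift-up k xy ux dy) (≼-trans yq q≼v) tx)
        lift-upper {x} {y} h xy yq (inj₂ (dx , tx)) = raise (≼-trans (∗-down lo h dx) xy) yq (upper (∗-down lo h dx) xy (≼-trans yq q≼v) tx)

        -- If k is a descent of y, T itself is used. If k is an ascent, an atom with descent k
        -- equals k y and settles the claim; failing that, k is an ascent of all four elements and
        -- the diamond is multiplied by k.
        lift-diamond : ∀ {y a b z} → u' ≼ y → y ⋖ a → y ⋖ b → a ⋖ z → b ⋖ z → z ≼ q → ¬ (a ≈ b) → Lift T a → Lift T b → Lift T z → Lift T y
        lift-diamond {y} {a} {b} {z} h ya yb az bz zq ne ta tb tz with up⊎down k y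
        ... | inj₂ dy = inj₂ (dy , diamond uy ya yb az bz (≼-trans zq q≼v) ne (drop (≼-trans uy (⋖⇒≼ ya)) (≼-trans (⋖⇒≼ az) zq) ta) (drop (≼-trans uy (⋖⇒≼ yb)) (≼-trans (⋖⇒≼ bz) zq) tb)
                   (drop (≼-trans uy (2-step≼ ya az)) zq tz))
          where uy = ∗-down lo h dy
        ... | inj₁ uy with up⊎down k a | up⊎down k b
        ...   | inj₂ da | _ = inj₁ (uy , resp (cov-exchange ya uy da) (at-down da ta))
        ...   | inj₁ _ | inj₂ db = inj₁ (uy , resp (cov-exchange yb uy db) (at-down db tb))
        ...   | inj₁ ua | inj₁ ub with up⊎down k z
        ...     | inj₂ dz = ⊥-elim (ne (·-inj k (trans (sym (cov-exchange az ua dz)) (cov-exchange bz ub dz))))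
        ...     | inj₁ uz = inj₁ (uy , diamond (∗-up lo h uy) (cov-ups ya uy ua) (cov-ups yb uy ub) (cov-ups az ua uz) (cov-ups bz ub uz) (to-v zq) (λ e → ne (·-inj k e)) (at-up ua ta) (at-up ub tb) (at-up uz tz))

        lift-percolating : Percolating u' q (Lift T)
        lift-percolating = record { resp = lift-resp ; top = inj₁ (q-up , top) ; upper = lift-upper ; diamond = lift-diamond }

        conclude : ∀ {u'} → Lower k u u' → u' ≼ q → Lift T u' → T u
        conclude (up uu) u'q t' = drop ≼-refl u'q t'
        conclude (down du) u'q t' = resp (cancel k u) (at-up (down⇒up du) t')

    Stable : (z : Carrier) → (Carrier → Set (c ⊔ ℓ)) → Carrier → Carrier → Set (c ⊔ ℓ)
    Stable z T b t = ∀ x → b ≼ x → len x < len (t ∙ x) → t ∙ x ≼ z → T (t ∙ x) → T x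

    module _ {u u'} (lo : Lower k u u') {T : Carrier → Set (c ⊔ ℓ)} (p : Percolating u v T) (Tq : u ≼ q → T q) where
      open Percolating p
      open Semantics lo p Tq

      -- In the unchanged case T and its lift agree on [u, q]. In the other case b ⋠ q forces k to
      -- be an ascent on all of [b', q], so there the lift is T after multiplication by k.
      stable-next : (r : Rel u (k ∷ w)) → ¬ (t r ≈ gen k) → Stable v T (b r) (t r) → Stable q (Lift T) (b' r) (t' r)
      stable-next r t≉k st x bx lt tq ttx with shr-view k (y' r)
      ... | stays _ e = raise (≼-trans ub bx) (≼-trans xtx tq) (st x (≼-congˡ (sym b≈) bx) (≡.subst (len x <_) (len-cong (∙-congʳ (sym t≈))) lt) (≼-trans (≼-congˡ (∙-congʳ (sym t≈)) tq) q≼v)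
             (resp (∙-congʳ (sym t≈)) (drop (≼-trans (≼-trans ub bx) xtx) tq ttx)))
        where
        open β r e
        ub : u ≼ b' r
        ub = ≼-congʳ b≈ (u≼b r)
        xtx : x ≼ t' r ∙ x
        xtx = ⟶⇒≼ (edge (refl-cong t≈ (t-refl r)) refl lt)
      ... | shrink dn e = inj₁ (ux , st (k · x) (≼-congˡ (sym b≈) (left-mul k bx ux)) (≡.subst₂ _<_ (≡.sym ux) (≡.trans (≡.sym utx) (len-cong (sym tkx))) (s≤s lt))
             (≼-congˡ (sym tkx) (to-v tq)) (resp (sym tkx) (at-up utx ttx)))
        where
        open α r dn e
        all-up : ∀ {z} → b' r ≼ z → z ≼ q → Up k z
        all-up {z} h zq with up⊎down k z
        ... | inj₁ uz = uz
        ... | inj₂ dz = ⊥-elim (b⋠q (≼-congˡ (sym b≈) (≼-trans (lift-up k h b'-up dz) zq)))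
        t'≈ : t' r ≈ gen k ∙ t r ∙ gen k
        t'≈ = trans (grp (Gen k ∷ []) (t' r ∷ []) v₀ (g₀ ⊙ (g₀ ⊙ v₀ ⊙ g₀) ⊙ g₀) ≡.refl) (∙-congʳ (∙-congˡ (sym t≈)))
        xtx : x ≼ t' r ∙ x
        xtx = ⟶⇒≼ (edge (refl-cong (sym t'≈) (refl-sts k (t-refl r))) refl lt)
        ux : Up k x
        ux = all-up bx (≼-trans xtx tq)
        utx : Up k (t' r ∙ x)
        utx = all-up (≼-trans bx xtx) tq
        tkx : t r ∙ (k · x) ≈ k · (t' r ∙ x)
        tkx = trans (∙-congʳ t≈) (grp (Gen k ∷ []) (t' r ∷ x ∷ []) (g₀ ⊙ v₀ ⊙ g₀ ⊙ (g₀ ⊙ v₁)) (g₀ ⊙ (v₀ ⊙ v₁)) ≡.refl)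

    lower-up : ∀ {u u'} → Lower k u u' → Up k u'
    lower-up (up uu) = uu
    lower-up (down du) = down⇒up du

    module Fresh {u'} (uu' : Up k u') (u'q : u' ≼ q) (ku'q : k · u' ≼ q) where
      y≈ε : rem u' w ≈ ε
      y≈ε = rem-≼ w redw u'q
      t≈k : rem u' w ⁻¹ ∙ (k · rem u' w) ≈ gen k
      t≈k = trans (∙-cong (⁻¹-cong y≈ε) (∙-congˡ y≈ε)) (grp (Gen k ∷ []) [] (inv :ε ⊙ (g₀ ⊙ :ε)) g₀ ≡.refl)

      fresh : Rel u' w
      fresh = record
        { U = u' ; P = ε ; κ = k ; κ-up = uu' ; alive = trans (rem-≼ w redw ku'q) (sym y≈ε)
        ; u≼b = nil (sym (trans (∙-congʳ (⁻¹-cong y≈ε)) (grp [] (u' ∷ []) (inv :ε ⊙ v₀) v₀ ≡.refl)))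
        ; κy⋠P = λ h → gen≉ε k (≼-≥ (≼-congˡ (trans (∙-congˡ y≈ε) (identityʳ _)) h) (ℕₚ.≤-trans (ℕₚ.≤-reflexive len-ε) z≤n))
        ; y≼P = nil y≈ε
        ; P-add = ≡.trans (len-cong (identityˡ q)) (≡.cong (_+ len q) (≡.sym len-ε))
        ; U-add = ≡.cong (_+ len u') (≡.sym (≡.trans (len-cong (inverseʳ u')) len-ε))
        ; Q≼P = nil (inverseʳ u') }

      -- The lift takes the same value at x and at k x, so the relation with label k holds by
      -- construction.
      fresh-stable : ∀ {u T} (lo : Lower k u u') (p : Percolating u v T) (Tq : u ≼ q → T q) → Stable q (Lift T) (b fresh) (t fresh)
      fresh-stable {T = T} lo p Tq x bx lt tq tt with up⊎down k x
      ... | inj₁ ux = inj₁ (ux , at-down (up⇒down ux) (lift-resp (∙-congʳ t≈k) tt))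
        where open Semantics lo p Tq
      ... | inj₂ dx = ⊥-elim (ℕₚ.<-asym lt (ℕₚ.≤-trans (s≤s (ℕₚ.≤-reflexive (len-cong (∙-congʳ t≈k)))) (ℕₚ.≤-reflexive (≡.sym dx))))

    IsSeed : Carrier → Carrier → Carrier → Set (c ⊔ ℓ)
    IsSeed u z h = h ⋖ z × u ≼ h

    module _ {u u'} (lo : Lower k u u') where
      -- A coatom h with ascent k becomes the coatom k h of v. If k is a descent of h, the second
      -- middle element m between h and v is taken, and the diamond of h, q, m and v brings T down
      -- to h.
      lift-seed : ∀ {h} → IsSeed u' q h → ∃ λ g → IsSeed u v g × (∀ {T} → Percolating u v T → (u ≼ q → T q) → T g → Lift T h)
      lift-seed {h} (hq , u'h) with up⊎down k h
      ... | inj₁ uh = k · h , (cov-ups hq uh q-up , ∗-up lo u'h uh) , λ p Tq tg → inj₁ (uh , tg)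
      ... | inj₂ dh with other-middle hq (up-cov q-up)
      ...   | btw m m≉ hm mv = m , (mv , ≼-trans uh (⋖⇒≼ hm)) , λ p Tq tm → inj₂ (dh , Percolating.diamond p uh hm hq mv (up-cov q-up) ≼-refl m≉ tm (Tq (≼-trans uh (⋖⇒≼ hq))) (Percolating.top p))
        where uh = ∗-down lo u'h dh

      lift-seeds : ∀ {A'} → All (IsSeed u' q) A' → ∃ λ A → All (IsSeed u v) A × length A ≡ length A' × (∀ {T} → Percolating u v T → (u ≼ q → T q) → All T A → All (Lift T) A')
      lift-seeds [] = [] , [] , ≡.refl , λ _ _ _ → []
      lift-seeds (h ∷ hs) with lift-seed h | lift-seeds hs
      ... | g , gs , f | A , As , l , fs = g ∷ A , gs ∷ As , ≡.cong suc l , λ { p Tq (x ∷ xs) → f p Tq x ∷ fs p Tq xs }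

      module _ {r₁ r₂ : Rel u (k ∷ w)} (n₁ : ¬ (t r₁ ≈ gen k)) (n₂ : ¬ (t r₂ ≈ gen k)) (n : Newer r₁ r₂) where
        newer-next : Newer (Survive.next r₁ n₁ lo) (Survive.next r₂ n₂ lo)
        newer-next = record { Ui-add = Newer.Ui-add n ; Π = Newer.Π n ; Q≼Π = Newer.Q≼Π n ; Π-down = Newer.Π-down n
          ; Pi≈ = trans (∙-congʳ (Newer.Pi≈ n)) (assoc _ _ _)
          ; Π-add = ≡.trans (len-cong (trans (sym (assoc _ _ _)) (∙-congʳ (sym (Newer.Pi≈ n))))) (≡.trans (P-up r₂) (≡.trans (≡.cong suc (≡.trans (len-cong (Newer.Pi≈ n)) (Newer.Π-add n)))
                (≡.trans (≡.sym (ℕₚ.+-suc _ _)) (≡.cong (len (Newer.Π n) +_) (≡.sym (P-up r₁)))))) }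

      newer-fresh : (f : Up k u') (g : u' ≼ q) (h : k · u' ≼ q) (r : Rel u (k ∷ w)) (n : ¬ (t r ≈ gen k)) → Newer (Fresh.fresh f g h) (Survive.next r n lo)
      newer-fresh f g h r n = record { Ui-add = U-add r' ; Q≼Π = Q≼P r' ; Π-down = rup⇒rdown k (P-up r)
          ; Pi≈ = sym (identityʳ _) ; Π-add = ≡.trans (len-cong (identityʳ _)) (≡.trans (≡.sym (ℕₚ.+-identityʳ _)) (≡.cong (len (P r') +_) (≡.sym len-ε))) }
        where r' = Survive.next r n lo

      Other : Rel u (k ∷ w) → Set ℓ
      Other r = ¬ (t r ≈ gen k)

      nexts : ∀ {rs} → All Other rs → List (Rel u' w)
      nexts [] = []
      nexts (_∷_ {x = r} n ns) = Survive.next r n lo ∷ nexts ns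

      length-nexts : ∀ {rs} (ns : All Other rs) → length (nexts ns) ≡ length rs
      length-nexts [] = ≡.refl
      length-nexts (_ ∷ ns) = ≡.cong suc (length-nexts ns)

      newer-nexts : ∀ {rs} (ns : All Other rs) → AllPairs Newer rs → AllPairs Newer (nexts ns)
      newer-nexts [] [] = []
      newer-nexts (n ∷ ns) (a ∷ as) = go ns a ∷ newer-nexts ns as
        where
        go : ∀ {rs} (ns : All Other rs) → All (Newer _) rs → All (Newer (Survive.next _ n lo)) (nexts ns)
        go [] [] = []
        go (n' ∷ ns) (x ∷ xs) = newer-next n n' x ∷ go ns xs

      newer-freshs : (f : Up k u') (g : u' ≼ q) (h : k · u' ≼ q) → ∀ {rs} (ns : All Other rs) → All (Newer (Fresh.fresh f g h)) (nexts ns)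
      newer-freshs f g h [] = []
      newer-freshs f g h (n ∷ ns) = newer-fresh f g h _ n ∷ newer-freshs f g h ns

      stable-nexts : ∀ {T} (p : Percolating u v T) (Tq : u ≼ q → T q) → ∀ {rs} (ns : All Other rs) → All (λ r → Stable v T (b r) (t r)) rs → All (λ r → Stable q (Lift T) (b r) (t r)) (nexts ns)
      stable-nexts p Tq [] [] = []
      stable-nexts p Tq (_∷_ {x = r} n ns) (s ∷ ss) = stable-next lo p Tq r n s ∷ stable-nexts p Tq ns ss
  data Extraction {u k w} (rs : List (Rel u (k ∷ w))) : Set (Level.suc (c ⊔ ℓ)) where
    none : All (λ r → ¬ (t r ≈ gen k)) rs → Extraction rs
    one  : ∀ (r : Rel u (k ∷ w)) rs₀ → t r ≈ gen k → All (λ r → ¬ (t r ≈ gen k)) rs₀ → AllPairs Newer rs₀ → length rs ≡ suc (length rs₀) →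
           ({X : Rel u (k ∷ w) → Set (c ⊔ ℓ)} → All X rs → X r × All X rs₀) → Extraction rs

  extract : ∀ {u k w} (rs : List (Rel u (k ∷ w))) → AllPairs Newer rs → Extraction rs
  extract [] [] = none []
  extract {k = k} (r ∷ rs) (n ∷ ns) with t r ≟ gen k
  ... | yes e = one r rs e (All.map (λ nw e' → labels-distinct nw (trans e (sym e'))) n) ns ≡.refl λ { (x ∷ xs) → x , xs }
  ... | no ne with extract rs ns
  ...   | none as = none (ne ∷ as)
  ...   | one r' rs₀ e as ns₀ l f = one r' (r ∷ rs₀) e (ne ∷ as) (proj₂ (f n) ∷ ns₀) (≡.cong suc l) λ { (x ∷ xs) → let a , b = f xs in a , x ∷ b }

  -- Every relation available at the outset saves one seed, so relations count in the bound like
  -- seeds.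
  record Percolation (u : Carrier) (w : List I) (rs : List (Rel u w)) : Set (Level.suc (c ⊔ ℓ)) where
    field
      seeds : List Carrier
      are-seeds : All (λ h → h ⋖ eval w × u ≼ h) seeds
      bound : length seeds + length rs ≤ d u w
      percolates : ∀ {T} → Percolating u (eval w) T → All (λ r → ∀ x → b r ≼ x → len x < len (t r ∙ x) → t r ∙ x ≼ eval w → T (t r ∙ x) → T x) rs → All T seeds → T u
  open Percolation

  percolate : ∀ w → Reduced w → ∀ u → u ≼ eval w → (rs : List (Rel u w)) → AllPairs Newer rs → Percolation u w rs
  percolate [] _ u p [] _ = record { seeds = [] ; are-seeds = [] ; bound = z≤n ; percolates = λ P _ _ → Percolating.resp P (sym (≼-≥ p (ℕₚ.≤-trans (ℕₚ.≤-reflexive len-ε) z≤n))) (Percolating.top P) }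
  -- Without letters nothing is cancelled, and `alive` would identify κ U with U.
  percolate [] _ u p (r ∷ rs) _ = ⊥-elim (gen≉ε (κ r) (trans (grp [] (gen (κ r) ∷ U r ∷ []) v₀ (v₀ ⊙ v₁ ⊙ inv v₁) ≡.refl) (trans (∙-congʳ (alive r)) (inverseʳ _))))
  percolate (k ∷ w) (q-up ∷ redw) u p rs pairs with u ≼? eval w
  ... | no u⋠q = outside (up⊎down k u)
    where
    open Step q-up redw
    outside : Up k u ⊎ Down k u → Percolation u (k ∷ w) rs
    outside (inj₁ uu) = ⊥-elim (u⋠q (to-q (lift-down k p uu v-down)))
    outside (inj₂ du) = record
      { seeds = proj₁ A ; are-seeds = proj₁ (proj₂ A)
      ; bound = ≡.subst₂ _≤_ (≡.cong₂ _+_ (≡.sym (proj₁ (proj₂ (proj₂ A)))) (length-nexts (down du) others)) (≡.sym (d-down w du)) (bound ih)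
      ; percolates = λ {T} P st ta → Semantics.conclude (down du) P (Tq T) (down du) u'q (percolates ih (Semantics.lift-percolating (down du) P (Tq T)) (stable-nexts (down du) P (Tq T) others st) (proj₂ (proj₂ (proj₂ A)) P (Tq T) ta)) }
      where
      u'q : k · u ≼ q
      u'q = to-q (lift-both k p du v-down)
      Tq : ∀ (T : Carrier → Set (c ⊔ ℓ)) → u ≼ q → T q
      Tq T h = ⊥-elim (u⋠q h)
      others : All (λ r → ¬ (t r ≈ gen k)) rs
      others = All.tabulate λ {r} _ e → u⋠q (≼-trans (u≼b r) (label-k⇒b≼q r e))
      ih = percolate w redw (k · u) u'q (nexts (down du) others) (newer-nexts (down du) others pairs)
      A = lift-seeds (down du) (are-seeds ih)
  ... | yes u≼q = choose (up⊎down k u)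
    where
    open Step q-up redw
    module _ {u'} (lo : Lower k u u') (u'q : u' ≼ q) where
      record Reduction : Set (Level.suc (c ⊔ ℓ)) where
        field
          rs₀ : List (Rel u (k ∷ w))
          others : All (λ r → ¬ (t r ≈ gen k)) rs₀
          pairs₀ : AllPairs Newer rs₀
          seeds₀ : List Carrier
          seeds₀-ok : All (IsSeed u v) seeds₀
          count : length seeds₀ + length rs ≡ suc (length rs₀)
          works : ∀ {T} → All (λ r → Stable v T (b r) (t r)) rs → T v → (∀ {x y} → x ≈ y → T x → T y) → All T seeds₀ → T q × All (λ r → Stable v T (b r) (t r)) rs₀
      -- That q is in T follows from the unique relation with label k, if there is one; otherwise q
      -- is taken as a seed. Both ways obey the same `count`.
      reduction : Reduction
      reduction with extract rs pairs
      ... | none ns = record { rs₀ = rs ; others = ns ; pairs₀ = pairs ; seeds₀ = q ∷ [] ; seeds₀-ok = (up-cov q-up , u≼q) ∷ [] ; count = ≡.refl ; works = λ { st _ _ (tq ∷ []) → tq , st } }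
      ... | one r rs₀ e ns ps l f = record { rs₀ = rs₀ ; others = ns ; pairs₀ = ps ; seeds₀ = [] ; seeds₀-ok = [] ; count = l
              ; works = λ { st tv resp [] → proj₁ (f st) q (label-k⇒b≼q r e) (≡.subst (len q <_) (len-cong (∙-congʳ (sym e))) (up< q-up)) (nil (∙-congʳ e)) (resp (∙-congʳ (sym e)) tv) , proj₂ (f st) } }
      open Reduction reduction

      assemble : (new : List (Rel u' w)) → AllPairs Newer (new ++ nexts lo others) →
                 (∀ {T} (P : Percolating u v T) (Tq : u ≼ q → T q) → All (λ r → Stable q (Lift T) (b r) (t r)) new) →
                 suc (d u' w) ≤ d u (k ∷ w) + length new → Percolation u (k ∷ w) rs
      assemble new ps new-stable le = record
        { seeds = seeds₀ ++ proj₁ A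
        ; are-seeds = AllP.++⁺ seeds₀-ok (proj₁ (proj₂ A))
        ; bound = ℕₚ.+-cancelʳ-≤ (length new) _ _ (ℕₚ.≤-trans (ℕₚ.≤-reflexive count') (ℕₚ.≤-trans (s≤s (bound ih)) le))
        ; percolates = λ P st ta →
            let tsplit = AllP.++⁻ seeds₀ ta
                tq , st₀ = works st (Percolating.top P) (Percolating.resp P) (proj₁ tsplit)
                Tq = λ _ → tq
            in Semantics.conclude lo P Tq lo u'q (percolates ih (Semantics.lift-percolating lo P Tq) (AllP.++⁺ (new-stable P Tq) (stable-nexts lo P Tq others st₀)) (proj₂ (proj₂ (proj₂ A)) P Tq (proj₂ tsplit))) }
        where
        ih = percolate w redw u' u'q (new ++ nexts lo others) ps
        A = lift-seeds lo (are-seeds ih)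
        count' : length (seeds₀ ++ proj₁ A) + length rs + length new ≡ suc (length (seeds ih) + length (new ++ nexts lo others))
        count' = ≡.trans (≡.cong (λ n → n + length rs + length new) (≡.trans (Listₚ.length-++ seeds₀) (≡.cong (length seeds₀ +_) (proj₁ (proj₂ (proj₂ A))))))
          (≡.trans (arith (length seeds₀) (length (seeds ih)) (length rs) (length new)) (≡.trans (≡.cong (λ n → n + (length (seeds ih) + length new)) count)
            (≡.cong suc (≡.trans (arith' (length rs₀) (length (seeds ih)) (length new)) (≡.cong (length (seeds ih) +_) (≡.sym (≡.trans (Listₚ.length-++ new) (≡.cong (length new +_) (length-nexts lo others)))))))))
          where
          open import Data.Nat.Solver using (module +-*-Solver)
          open +-*-Solver using (solve; _:=_; _:+_)
          arith : ∀ a b c d → a + b + c + d ≡ (a + c) + (b + d)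
          arith = solve 4 (λ a b c d → a :+ b :+ c :+ d := (a :+ c) :+ (b :+ d)) ≡.refl
          arith' : ∀ a b c → a + (b + c) ≡ b + (c + a)
          arith' = solve 3 (λ a b c → a :+ (b :+ c) := b :+ (c :+ a)) ≡.refl

      with-fresh : k · u' ≼ q → d u (k ∷ w) ≡ d u' w → Percolation u (k ∷ w) rs
      with-fresh h e = assemble (fresh ∷ []) (newer-freshs lo (lower-up lo) u'q h others ∷ newer-nexts lo others pairs₀) (λ P Tq → fresh-stable lo P Tq ∷ [])
        (ℕₚ.≤-reflexive (≡.trans (ℕₚ.+-comm 1 _) (≡.cong (_+ 1) (≡.sym e))))
        where open Fresh (lower-up lo) u'q h

      without-fresh : d u (k ∷ w) ≡ suc (d u' w) → Percolation u (k ∷ w) rs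
      without-fresh e = assemble [] (newer-nexts lo others pairs₀) (λ P Tq → []) (ℕₚ.≤-reflexive (≡.trans (≡.sym e) (≡.sym (ℕₚ.+-identityʳ _))))

    choose : Up k u ⊎ Down k u → Percolation u (k ∷ w) rs
    choose (inj₁ uu) with k · u ≼? eval w
    ... | yes h = with-fresh (up uu) u≼q h (d-in w uu h)
    ... | no h = without-fresh (up uu) u≼q (d-out w uu h)
    -- As k u' = u, both u' and k u' are below q: d stays the same, and the seed or relation just
    -- spent is balanced by a fresh relation.
    choose (inj₂ du) = with-fresh (down du) (≼-trans (⟶⇒≼ (down-edge du)) u≼q) (≼-congˡ (sym (cancel k u)) u≼q) (d-down w du)

-- The two leading coefficients of R.

module RPolynomials (DC : OrderedDomainWithCosines) {c ℓ : Level} (C : CoxeterSystem c ℓ) where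
  open import Defs
  open OrderedDomains
  open import Level using (Level)
  open import Algebra.Bundles using (Group)
  open CoxeterGroups DC C using (len; len-cong; len-ε; len-min; _≟_; hasLength; hasLength⇒; word; eval-word)
  open BruhatOrder DC C
  open Cancellation DC C using (Reduced; []; _∷_)
  open Percolations DC C using (d; d-in; d-out; d-down)
  open CoxeterSystem C
  open CS C using (eval; BEdge; LenLt; _≤B_; IsRFamily; stepCoeff; δ0; dInv)
  open Group W
  open import Data.Nat as ℕ using (ℕ; zero; suc; _<_; _≤_; z≤n; s≤s; _∸_)
  import Data.Nat.Properties as ℕₚ
  open import Data.Integer as ℤ using (ℤ; +_)
  import Data.Integer.Properties as ℤₚ
  open import Data.Product using (_,_)
  open import Data.Sum using (inj₁; inj₂)
  open import Data.Empty using (⊥-elim)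
  open import Data.List using (List; []; _∷_; length)
  open import Relation.Nullary using (¬_; Dec; yes; no)
  open import Relation.Binary.PropositionalEquality as ≡ using (_≡_)
  open import Relation.Binary.Construct.Closure.Transitive using (TransClosure; [_]; _∷_)

  lenLt : ∀ {x y} → len x < len y → LenLt x y
  lenLt {x} {y} h = len x , len y , hasLength x , hasLength y , h

  lenLt⇒ : ∀ {x y} → LenLt x y → len x < len y
  lenLt⇒ (a , b , ha , hb , h) = ≡.subst₂ _<_ (≡.sym (hasLength⇒ ha)) (≡.sym (hasLength⇒ hb)) h

  toB : ∀ {x y} → x ⟶ y → BEdge x y
  toB (edge {t} r p l) = (t , r , p) , lenLt l

  fromB : ∀ {x y} → BEdge x y → x ⟶ y
  fromB ((t , r , p) , l) = edge r p (lenLt⇒ l)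

  ≼⇒≤B : ∀ {x y} → x ≼ y → x ≤B y
  ≼⇒≤B (nil e) = inj₁ e
  ≼⇒≤B (p ◅ q) with ≼⇒≤B q
  ... | inj₁ e = inj₂ [ toB (⟶-cong refl e p) ]
  ... | inj₂ c = inj₂ (toB p ∷ c)

  ≤B⇒≼ : ∀ {x y} → x ≤B y → x ≼ y
  ≤B⇒≼ (inj₁ e) = nil e
  ≤B⇒≼ (inj₂ c) = go c
    where
    go : ∀ {x y} → TransClosure BEdge x y → x ≼ y
    go [ p ] = ⟶⇒≼ (fromB p)
    go (p ∷ c) = fromB p ◅ go c

  reduced-length : ∀ {w} → Reduced w → len (eval w) ≡ length w
  reduced-length [] = len-ε
  reduced-length (u ∷ r) = ≡.trans u (≡.cong suc (reduced-length r))

  minimal⇒reduced : ∀ w → length w ≡ len (eval w) → Reduced w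
  minimal⇒reduced [] _ = []
  minimal⇒reduced (s ∷ w) e with up⊎down s (eval w)
  ... | inj₁ u = u ∷ minimal⇒reduced w (ℕₚ.suc-injective (≡.trans e u))
  ... | inj₂ dn = ⊥-elim (ℕₚ.<⇒≱ (ℕₚ.≤-trans (ℕₚ.≤-reflexive (≡.sym dn)) (len-min w refl)) (ℕₚ.≤-trans (ℕₚ.n≤1+n _) (ℕₚ.≤-reflexive e)))

  module _ {R : Carrier → Carrier → ℕ → ℤ} (F : IsRFamily R) where
    open IsRFamily F

    -- For n = 0 there is no second coefficient; `degenerate` gives d = 0 there, which matches the
    -- default value of `dInv`.
    record Leading (u : Carrier) (w : List I) (n : ℕ) : Set where
      field
        above : ∀ k → n < k → R u (eval w) k ≡ + 0
        lead : R u (eval w) n ≡ + 1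
        second : ∀ j → n ≡ suc j → R u (eval w) j ≡ ℤ.- (+ d u w)
        degenerate : n ≡ 0 → d u w ≡ 0
    open Leading

    δ0-above : ∀ k → 0 < k → δ0 k ≡ + 0
    δ0-above (suc k) _ = ≡.refl

    leading : ∀ w → Reduced w → ∀ u n → u ≼ eval w → n ℕ.+ len u ≡ length w → Leading u w n
    leading [] _ u n p e = record
      { above = λ k h → ≡.trans (R-resp u≈ refl k) (≡.trans (R-diag ε k) (δ0-above k (ℕₚ.≤-<-trans z≤n h)))
      ; lead = ≡.trans (R-resp u≈ refl n) (≡.trans (R-diag ε n) (≡.cong δ0 n≡0))
      ; second = λ j h → ⊥-elim (ℕₚ.0≢1+n (≡.trans (≡.sym n≡0) h))
      ; degenerate = λ _ → ≡.refl }
      where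
      n≡0 : n ≡ 0
      n≡0 = ℕₚ.n≤0⇒n≡0 (≡.subst (n ≤_) e (ℕₚ.m≤m+n n (len u)))
      u≈ : u ≈ ε
      u≈ = ≼-≥ p (ℕₚ.≤-trans (ℕₚ.≤-reflexive len-ε) z≤n)
    leading (k ∷ w) (q-up ∷ red) u n p e with u ≟ eval (k ∷ w) | up⊎down k u
    ... | yes u≈ | inj₁ uu = ⊥-elim (up≉ uu (up⇒down q-up) u≈)
    ... | yes u≈ | inj₂ du = record
      { above = λ i h → ≡.trans (R-resp u≈ refl i) (≡.trans (R-diag _ i) (δ0-above i (ℕₚ.≤-<-trans z≤n h)))
      ; lead = ≡.trans (R-resp u≈ refl n) (≡.trans (R-diag _ n) (≡.cong δ0 n≡0))
      ; second = λ j h → ⊥-elim (ℕₚ.0≢1+n (≡.trans (≡.sym n≡0) h))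
      ; degenerate = λ h → ≡.trans (d-down w du) (degenerate (leading w red (k · u) n (≼-congʳ (cancel k _) (lift-both k p du (up⇒down q-up))) (ℕₚ.suc-injective (≡.trans (≡.sym (ℕₚ.+-suc n _)) (≡.trans (≡.cong (n ℕ.+_) (≡.sym du)) e)))) h) }
      where
      n≡0 : n ≡ 0
      n≡0 = ℕₚ.+-cancelʳ-≡ (len u) n 0 (≡.trans e (≡.trans (≡.sym (reduced-length (q-up ∷ red))) (len-cong (sym u≈))))
    ... | no u≉ | inj₂ du = record
      { above = λ i h → ≡.trans (same i) (above ih i h)
      ; lead = ≡.trans (same n) (lead ih)
      ; second = λ j h → ≡.trans (same j) (≡.trans (second ih j h) (≡.cong (λ x → ℤ.- (+ x)) (≡.sym (d-down w du))))
      ; degenerate = λ h → ≡.trans (d-down w du) (degenerate ih h) }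
      where
      ih = leading w red (k · u) n (≼-congʳ (cancel k _) (lift-both k p du (up⇒down q-up))) (ℕₚ.suc-injective (≡.trans (≡.sym (ℕₚ.+-suc n _)) (≡.trans (≡.cong (n ℕ.+_) (≡.sym du)) e)))
      same : ∀ i → R u (eval (k ∷ w)) i ≡ R (k · u) (eval w) i
      same i = ≡.trans (R-desc u (eval (k ∷ w)) k (≼⇒≤B p , u≉) (lenLt (len< (down-edge (up⇒down q-up)))) (lenLt (len< (down-edge du))) i) (R-resp refl (cancel k _) i)
    leading (k ∷ w) (q-up ∷ red) u zero p e | no u≉ | inj₁ uu = ⊥-elim (ℕₚ.<-irrefl (≡.trans e (≡.sym (reduced-length (q-up ∷ red)))) (≼-≉⇒< p u≉))
    leading (k ∷ w) (q-up ∷ red) u (suc n) p e | no u≉ | inj₁ uu = record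
      { above = λ { zero () ; (suc i) (s≤s h) → ≡.trans (rec (suc i)) (≡.trans (≡.cong₂ (λ a b → (a ℤ.+ (ℤ.- b)) ℤ.+ Q i) (above ih i h) (above ih (suc i) (ℕₚ.≤-trans h (ℕₚ.n≤1+n i)))) (≡.trans (ℤₚ.+-identityˡ (Q i)) (Q-above i (ℕₚ.<⇒≤ h)))) }
      ; lead = ≡.trans (rec (suc n)) (≡.trans (≡.cong₂ (λ a b → (a ℤ.+ (ℤ.- b)) ℤ.+ Q n) (lead ih) (above ih (suc n) ℕₚ.≤-refl)) (≡.cong (λ z → + 1 ℤ.+ z) (Q-above n ℕₚ.≤-refl)))
      ; second = λ { j ≡.refl → ≡.trans (rec n) second' }
      ; degenerate = λ () }
      where
      q = eval w
      u≼q : u ≼ q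
      u≼q = ≼-congʳ (cancel k q) (lift-down k p uu (up⇒down q-up))
      e' : n ℕ.+ len u ≡ length w
      e' = ℕₚ.suc-injective e
      ih : Leading u w n
      ih = leading w red u n u≼q e'
      P Q : ℕ → ℤ
      P = R u q
      Q = R (k · u) q
      rec : ∀ i → R u (eval (k ∷ w)) i ≡ stepCoeff P Q i
      rec i = ≡.trans (R-asc u (eval (k ∷ w)) k (≼⇒≤B p , u≉) (lenLt (len< (down-edge (up⇒down q-up)))) (lenLt (len< (up-edge uu))) i) (stepCong i)
        where
        stepCong : ∀ i → stepCoeff (R u (gen k ∙ eval (k ∷ w))) (R (k · u) (gen k ∙ eval (k ∷ w))) i ≡ stepCoeff P Q i
        stepCong zero = ≡.cong ℤ.-_ (R-resp refl (cancel k q) 0)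
        stepCong (suc i) = ≡.cong₂ ℤ._+_ (≡.cong₂ (λ a b → a ℤ.+ (ℤ.- b)) (R-resp refl (cancel k q) i) (R-resp refl (cancel k q) (suc i))) (R-resp refl (cancel k q) i)
      ih-Q : ∀ n' → n ≡ suc n' → k · u ≼ q → Leading (k · u) w n'
      ih-Q n' h pk = leading w red (k · u) n' pk (≡.trans (≡.cong (n' ℕ.+_) uu) (≡.trans (ℕₚ.+-suc n' (len u)) (≡.trans (≡.cong (ℕ._+ len u) (≡.sym h)) e')))
      Q-above : ∀ i → n ≤ i → Q i ≡ + 0
      Q-above i h with k · u ≼? q
      ... | no np = R-zero (k · u) q (λ b → np (≤B⇒≼ b)) i
      ... | yes pk = pos n ≡.refl h
        where
        pos : ∀ m → n ≡ m → m ≤ i → Q i ≡ + 0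
        pos zero z _ = ⊥-elim (ℕₚ.<⇒≱ (up< uu) (ℕₚ.≤-trans (≼-len pk) (ℕₚ.≤-reflexive (≡.trans (reduced-length red) (≡.trans (≡.sym e') (≡.cong (ℕ._+ len u) z))))))
        pos (suc n') z l = above (ih-Q n' z pk) i l
      second' : stepCoeff P Q n ≡ ℤ.- (+ d u (k ∷ w))
      second' = go n ≡.refl
        where
        go : ∀ n' → n ≡ n' → stepCoeff P Q n ≡ ℤ.- (+ d u (k ∷ w))
        -- Here u equals q, and the constant term of q - 1 demands d = 1; indeed k u is too long to
        -- lie below q.
        go zero z = ≡.trans (≡.cong (stepCoeff P Q) z) (≡.trans (≡.cong ℤ.-_ (≡.trans (≡.cong P (≡.sym z)) (lead ih))) (≡.cong (λ x → ℤ.- (+ x)) (≡.sym (≡.trans (d-out w uu nk) (≡.cong suc (degenerate ih z))))))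
          where nk : ¬ (k · u ≼ q)
                nk pk = ℕₚ.<⇒≱ (up< uu) (ℕₚ.≤-trans (≼-len pk) (ℕₚ.≤-reflexive (≡.trans (reduced-length red) (≡.trans (≡.sym e') (≡.cong (ℕ._+ len u) z)))))
        -- The coefficient is -d - 1 plus that of Q, whose leading 1 cancels the -1 exactly when k u
        -- ≼ q.
        go (suc i) z = ≡.trans (≡.cong (stepCoeff P Q) z) (≡.trans (≡.cong₂ (λ a b → (a ℤ.+ (ℤ.- b)) ℤ.+ Q i) (second ih i z) (≡.trans (≡.cong P (≡.sym z)) (lead ih))) (fin (k · u ≼? q)))
          where
          fin : Dec (k · u ≼ q) → ((ℤ.- (+ d u w)) ℤ.+ (ℤ.- (+ 1))) ℤ.+ Q i ≡ ℤ.- (+ d u (k ∷ w))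
          fin (yes pk) = ≡.trans (≡.cong (λ x → ((ℤ.- (+ d u w)) ℤ.+ (ℤ.- (+ 1))) ℤ.+ x) (lead (ih-Q i z pk))) (≡.trans (ℤₚ.+-assoc (ℤ.- (+ d u w)) (ℤ.- (+ 1)) (+ 1)) (≡.trans (ℤₚ.+-identityʳ _) (≡.cong (λ x → ℤ.- (+ x)) (≡.sym (d-in w uu pk)))))
          fin (no np) = ≡.trans (≡.cong (λ x → ((ℤ.- (+ d u w)) ℤ.+ (ℤ.- (+ 1))) ℤ.+ x) (R-zero (k · u) q (λ b → np (≤B⇒≼ b)) i)) (≡.trans (ℤₚ.+-identityʳ _)
               (≡.trans (≡.sym (ℤₚ.neg-distrib-+ (+ d u w) (+ 1))) (≡.cong (λ x → ℤ.- x) (≡.trans (≡.cong +_ (ℕₚ.+-comm (d u w) 1)) (≡.cong +_ (≡.sym (d-out w uu np)))))))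

    dInv≡d : ∀ {u v} → u ≼ v → dInv R u v (len v ∸ len u) ≡ + d u (word v)
    dInv≡d {u} {v} p = go (len v ∸ len u) ≡.refl
      where
      w = word v
      L : Leading u w (len v ∸ len u)
      L = leading w (minimal⇒reduced w (len-cong (sym (eval-word v)))) u _ (≼-congʳ (sym (eval-word v)) p) (ℕₚ.m∸n+n≡m (≼-len p))
      go : ∀ n → len v ∸ len u ≡ n → dInv R u v n ≡ + d u w
      go zero z = ≡.cong +_ (≡.sym (degenerate L z))
      go (suc j) z = ≡.trans (≡.cong ℤ.-_ (≡.trans (R-resp refl (sym (eval-word v)) j) (second L j z))) (ℤₚ.neg-involutive (+ d u w))

-- Root lines as eigenspaces of reflections.

module Eigenspaces (DC : OrderedDomainWithCosines) {c ℓ : Level} (C : CoxeterSystem c ℓ) where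
  open import Defs
  open OrderedDomains
  open import Level using (Level; _⊔_)
  open import Algebra.Bundles using (Group)
  open import Data.Product using (_,_; proj₁)
  open CoxeterSystem C hiding (W)
  open CS C using (eval; _⁻¹; Carrier; _∙_; ε) renaming (_≈_ to _≈ᴳ_)
  private module G = Group (CoxeterSystem.W C)
  open CoxeterGroups DC C using (len; len-cong; len-inv; len-min; word; eval-word; eval-++; IsRefl; refl-conj; Gen)
  open BruhatOrder DC C hiding (nil)
  open Cancellation DC C using (swap-inv)
  open GeometricRepresentation DC I m m-diag m-sym m-off
  open OD (proj₁ DC) hiding (zero)
  open GroupSolver (CoxeterSystem.W C) using (grp; inv; _⊙_; :ε; g₀; v₀; v₁)
  open import Data.Nat as ℕ using (zero; suc)
  import Data.Nat.Properties as ℕₚ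
  open import Data.Integer using (+_)
  open import Data.Sum using (inj₁; inj₂)
  open import Data.Empty using (⊥-elim)
  open import Data.List using ([]; _∷_; _++_)
  open import Data.Vec using ([]; _∷_)
  open import Relation.Nullary using (¬_)
  import Relation.Binary.PropositionalEquality as ≡
  open ≡ using (_≡_)
  open DoubleNegation

  private
    :0 :1 : ∀ {n} → Polynomial n
    :0 = con (+ 0)
    :1 = con (+ 1)

  infixr 7 _▹_
  abstract
    -- `◃` acts by the inverse of a word, so a word of g⁻¹ yields the left action of g.
    _▹_ : Carrier → Vect → Vect
    g ▹ z = z ◃ word (g ⁻¹)

    ▹-word : ∀ {g} w → eval w ≈ᴳ g ⁻¹ → ∀ z → g ▹ z ≋ z ◃ w
    ▹-word {g} w e z = ◃-~ (presented₁ (word (g ⁻¹)) w (G.trans (eval-word _) (G.sym e))) z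

    ▹-cong : ∀ {g g' z z'} → g ≈ᴳ g' → z ≋ z' → g ▹ z ≋ g' ▹ z'
    ▹-cong {g} {g'} {z} e f = ≋-trans (▹-word (word (g' ⁻¹)) (G.trans (eval-word _) (G.⁻¹-cong (G.sym e))) z) (◃-cong (word (g' ⁻¹)) f)

    ▹-gen : ∀ s z → gen s ▹ z ≋ act s z
    ▹-gen s z = ▹-word (s ∷ []) (grp (Gen s ∷ []) [] (g₀ ⊙ :ε) (inv g₀) ≡.refl) z

    ▹-ε : ∀ z → ε ▹ z ≋ z
    ▹-ε z = ▹-word [] (grp [] [] :ε (inv :ε) ≡.refl) z

    ▹-∙ : ∀ g h z → (g ∙ h) ▹ z ≋ g ▹ h ▹ z
    ▹-∙ g h z = ≋-trans (▹-word (word (h ⁻¹) ++ word (g ⁻¹)) (G.trans (eval-++ (word (h ⁻¹)) _) (G.trans (G.∙-cong (eval-word _) (eval-word _))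
        (grp [] (g ∷ h ∷ []) (inv v₁ ⊙ inv v₀) (inv (v₀ ⊙ v₁)) ≡.refl))) z) (≡-≋ (◃-++ z (word (h ⁻¹)) (word (g ⁻¹))) ≋-refl)

    ▹-⊞ : ∀ g x y → g ▹ (x ⊞ y) ≋ (g ▹ x) ⊞ (g ▹ y)
    ▹-⊞ g x y = ◃-⊞ (word (g ⁻¹)) x y

    ▹-• : ∀ g k x → g ▹ (k • x) ≋ k • (g ▹ x)
    ▹-• g k x = ◃-• (word (g ⁻¹)) k x

  ▹-inv : ∀ g z → g ▹ g ⁻¹ ▹ z ≋ z
  ▹-inv g z = ≋-trans (≋-sym (▹-∙ g (g ⁻¹) z)) (≋-trans (▹-cong (G.inverseʳ g) ≋-refl) (▹-ε z))

  𝟘 : Vect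
  𝟘 = ⟨ 0# , (λ _ → 0#) ⟩

  infixl 6 _⊟_
  _⊟_ : Vect → Vect → Vect
  x ⊟ y = x ⊞ (- 1#) • y

  0•≋ : ∀ {k} x → k ≈ 0# → k • x ≋ 𝟘
  0•≋ x e = ≋i (trans (*-congʳ e) (zeroˡ _)) λ i → trans (*-congʳ e) (zeroˡ _)

  ▹-𝟘 : ∀ g → g ▹ 𝟘 ≋ 𝟘
  ▹-𝟘 g = ≋-trans (▹-cong G.refl (≋-sym (0•≋ 𝟘 refl))) (≋-trans (▹-• g 0# 𝟘) (0•≋ (g ▹ 𝟘) refl))

  -- The condition that z - z' is negated by t, with the terms in z and those in z' on separate
  -- sides.
  Compat : Carrier → Vect → Vect → Set
  Compat t z z' = (t ▹ z) ⊞ z ≋ (t ▹ z') ⊞ z'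

  -- The (−1)-eigenspace of t.
  E : Carrier → Vect → Set
  E t z = (t ▹ z) ⊞ z ≋ 𝟘

  E-cong : ∀ {t t' z z'} → t ≈ᴳ t' → z ≋ z' → E t z → E t' z'
  E-cong e f h = ≋-trans (⊞-cong (▹-cong (G.sym e) (≋-sym f)) (≋-sym f)) h

  E-conj : ∀ {t z} g → E t z → E (g ∙ t ∙ g ⁻¹) (g ▹ z)
  E-conj {t} {z} g h = ≋-trans (⊞-cong (≋-trans (≋-sym (▹-∙ _ g z)) (≋-trans (▹-cong (grp [] (g ∷ t ∷ []) (v₀ ⊙ v₁ ⊙ inv v₀ ⊙ v₀) (v₀ ⊙ v₁) ≡.refl) ≋-refl) (▹-∙ g t z))) ≋-refl)
    (≋-trans (≋-sym (▹-⊞ g _ _)) (≋-trans (▹-cong G.refl h) (▹-𝟘 g)))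

  Compat⇒E : ∀ {t z z'} → Compat t z z' → E t (z ⊟ z')
  Compat⇒E {t} {z} {z'} h = ≋-trans (⊞-cong (≋-trans (▹-⊞ t z _) (⊞-cong ≋-refl (▹-• t _ z'))) ≋-refl)
    (≋i (k (ht (t ▹ z)) (ht z) (ht (t ▹ z')) (ht z') (ht≈ h)) λ i → k (pr (t ▹ z) i) (pr z i) (pr (t ▹ z') i) (pr z' i) (pr≈ h i))
    where
    k : ∀ a b c d → a + b ≈ c + d → (a + (- 1#) * c) + (b + (- 1#) * d) ≈ 0#
    k a b c d e = trans (solve 4 (λ a b c d → (a :+ (:- :1) :* c) :+ (b :+ (:- :1) :* d) := (a :+ b) :- (c :+ d)) refl a b c d) (trans (+-congʳ e) (-‿inverseʳ _))

  E-⊟ : ∀ {t z z'} → E t z → E t z' → E t (z ⊟ z')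
  E-⊟ h h' = Compat⇒E (≋-trans h (≋-sym h'))

  ⊟-0 : ∀ {x y} → x ⊟ y ≋ 𝟘 → x ≋ y
  ⊟-0 {x} {y} h = ≋i (k (ht x) (ht y) (ht≈ h)) λ i → k (pr x i) (pr y i) (pr≈ h i)
    where
    k : ∀ a b → a + (- 1#) * b ≈ 0# → a ≈ b
    k a b e = trans (solve 2 (λ a b → a := (a :+ (:- :1) :* b) :+ b) refl a b) (trans (+-congʳ e) (+-identityˡ b))

  E-gen : ∀ s z → E (gen s) z → z ≋ (half * pr z s) • α s
  E-gen s z h = ≋i (k (ht z) 1# (ht≈ h')) λ i → k (pr z i) (pr (α s) i) (pr≈ h' i)
    where
    h' : (z ⊞ (- pr z s) • α s) ⊞ z ≋ 𝟘
    h' = ≋-trans (⊞-cong (≋-sym (≋-trans (▹-gen s z) (act-is s z))) ≋-refl) h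
    p = pr z s
    k : ∀ x a → (x + (- p) * a) + x ≈ 0# → x ≈ half * p * a
    k x a e = trans (trans (sym (*-identityˡ x)) (*-congʳ (sym half+half))) (trans (solve 4 (λ x a p h → (h :+ h) :* x := h :* ((x :+ (:- p) :* a) :+ x) :+ h :* p :* a) refl x a p half)
       (trans (+-congʳ (trans (*-congˡ e) (zeroʳ half))) (+-identityˡ _)))

  α-E : ∀ s → E (gen s) (α s)
  α-E s = ≋-trans (⊞-cong (≋-trans (▹-gen s (α s)) (act-α s)) ≋-refl) (≋i (solve 0 ((:- :1) :* :1 :+ :1 := :0) refl) λ i → solve 1 (λ x → (:- :1) :* x :+ x := :0) refl (pr (α s) i))

  -- On a word of minimal length the other two answers of `outcome` would contradict the length.
  up-pos : ∀ {s x} → Up s x → Pos (ht (x ⁻¹ ▹ α s))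
  up-pos {s} {x} u with outcome (len x) s (word x) ℕₚ.≤-refl
  ... | up p = Pos-resp (sym (ht≈ (▹-word (word x) (G.trans (eval-word x) (grp [] (x ∷ []) v₀ (inv (inv v₀)) ≡.refl)) (α s)))) p
  ... | shorter w' e lt = ⊥-elim (ℕₚ.<⇒≱ lt (len-min w' (G.trans (G.sym (presented₂ (word x) _ e)) (eval-word x))))
  ... | down v e l = ⊥-elim (ℕₚ.<⇒≱ (up< u) (ℕₚ.≤-trans (len-min v (·-swap-ev)) (ℕₚ.≤-trans (ℕₚ.n≤1+n _) (ℕₚ.≤-reflexive l))))
    where ·-swap-ev : eval v ≈ᴳ s · x
          ·-swap-ev = G.trans (G.sym (cancel s (eval v))) (·-cong s (G.trans (G.sym (presented₂ (word x) _ e)) (eval-word x)))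

  record Normal (t : Carrier) : Set (c ⊔ ℓ) where
    constructor normal
    field
      w : Carrier
      s : I
      t≈ : t ≈ᴳ w ∙ gen s ∙ w ⁻¹
      w-up : Up s (w ⁻¹)

  -- The choice of w with w s longer than w makes w α_s a root of positive height.
  normalForm : ∀ {t} → IsRefl t → Normal t
  normalForm {t} (w , s , e) with up⊎down s (w ⁻¹)
  ... | inj₁ u = normal w s e u
  ... | inj₂ dn = normal (w ∙ gen s) s (G.trans e (grp (Gen s ∷ []) (w ∷ []) (v₀ ⊙ g₀ ⊙ inv v₀) (v₀ ⊙ g₀ ⊙ g₀ ⊙ inv (v₀ ⊙ g₀)) ≡.refl)) (up-cong (swap-inv s w) (down⇒up dn))

  module Root {t} (n : Normal t) where
    open Normal n
    root : Vect
    root = w ▹ α s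
    root-pos : Pos (ht root)
    root-pos = Pos-resp (ht≈ (▹-cong (grp [] (w ∷ []) (inv (inv v₀)) v₀ ≡.refl) ≋-refl)) (up-pos w-up)
    module _ {z} (h : E t z) where
      coeff : K
      coeff = half * pr (w ⁻¹ ▹ z) s
      pulled : w ⁻¹ ▹ z ≋ coeff • α s
      pulled = E-gen s (w ⁻¹ ▹ z) (E-cong (G.trans (G.∙-congʳ (G.∙-congˡ t≈)) (grp [] (w ∷ gen s ∷ []) (inv v₀ ⊙ (v₀ ⊙ v₁ ⊙ inv v₀) ⊙ inv (inv v₀)) v₁ ≡.refl)) ≋-refl (E-conj (w ⁻¹) h))
      multiple : z ≋ coeff • root
      multiple = ≋-trans (≋-sym (▹-inv w z)) (≋-trans (▹-cong G.refl pulled) (▹-• w coeff (α s)))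

  -- The eigenspace is spanned by a root of positive height, so the height alone detects its nonzero
  -- vectors.
  E-ht : ∀ {t z} → IsRefl t → E t z → ht z ≈ 0# → z ≋ 𝟘
  E-ht {t} {z} r h e = ≋-trans (multiple h) (0•≋ root (*-cancel-0 (Pos⇒≉0 root-pos) (trans (*-comm _ _) (trans (sym (ht≈ (multiple h))) e))))
    where open Root (normalForm r)

  -- With t = w s' w⁻¹ in normal form, w⁻¹ α_s is a positive multiple of α_s'. Hence s is an ascent
  -- of w and a descent of w s', and exchange gives w s' = s w.
  E-simple : ∀ {t s} → IsRefl t → E t (α s) → t ≈ᴳ gen s
  E-simple {t} {s} r h = G.trans t≈ (G.trans (G.∙-congʳ (cov-exchange cover w-s-up ws'-s-down)) (grp [] (gen s ∷ w ∷ []) (v₀ ⊙ v₁ ⊙ inv v₁) v₀ ≡.refl))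
    where
    n = normalForm r
    open Normal n renaming (s to s')
    open Root n
    f = coeff h
    f-pos : Pos f
    f-pos neg = Pos-1 (nn-resp (trans (solve 2 (λ f x → (:- f) :* x := :- (f :* x)) refl f (ht root)) (-‿cong (sym (ht≈ (multiple h))))) (nn-* neg (Pos⇒NN root-pos)))
    w-s-up : Up s w
    w-s-up with up⊎down s w
    ... | inj₁ u = u
    ... | inj₂ dn = ⊥-elim (Pos-neg f-pos (Pos-resp eq (up-pos (down⇒up dn))))
      where eq : ht ((s · w) ⁻¹ ▹ α s) ≈ - f
            eq = trans (ht≈ (≋-trans (▹-cong (grp (Gen s ∷ []) (w ∷ []) (inv (g₀ ⊙ v₀)) (inv v₀ ⊙ g₀) ≡.refl) ≋-refl) (≋-trans (▹-∙ (w ⁻¹) (gen s) (α s)) (≋-trans (▹-cong G.refl (≋-trans (▹-gen s (α s)) (act-α s)))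
                  (≋-trans (▹-• (w ⁻¹) (- 1#) (α s)) (•-cong refl (pulled h)))))))
                  (solve 1 (λ f → (:- :1) :* (f :* :1) := :- f) refl f)
    ws'-s-down : Down s (w ∙ gen s')
    ws'-s-down with up⊎down s (w ∙ gen s')
    ... | inj₂ dn = dn
    ... | inj₁ u = ⊥-elim (Pos-neg f-pos (Pos-resp eq (up-pos u)))
      where eq : ht ((w ∙ gen s') ⁻¹ ▹ α s) ≈ - f
            eq = trans (ht≈ (≋-trans (▹-cong (G.sym (swap-inv s' w)) ≋-refl) (≋-trans (▹-∙ (gen s') (w ⁻¹) (α s)) (≋-trans (▹-cong G.refl (pulled h)) (≋-trans (▹-• (gen s') f (α s')) (•-cong refl (≋-trans (▹-gen s' (α s')) (act-α s'))))))))
                  (solve 1 (λ f → f :* ((:- :1) :* :1) := :- f) refl f)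
    l : len (w ∙ gen s') ≡ suc (len w)
    l = ≡.trans (≡.sym (≡.trans (len-cong (swap-inv s' w)) (len-inv _))) (≡.trans w-up (≡.cong suc (len-inv w)))
    cover : w ⋖ w ∙ gen s'
    cover = cov (edge r (G.trans (grp [] (w ∷ gen s' ∷ []) (v₀ ⊙ v₁) (v₀ ⊙ v₁ ⊙ inv v₀ ⊙ v₀) ≡.refl) (G.∙-congʳ (G.sym t≈))) (ℕₚ.≤-reflexive (≡.sym l))) l

  -- Conjugation turns t into a simple reflection s; a common nonzero vector becomes a multiple of
  -- α_s, and `E-simple` identifies the conjugate of t' with s.
  E-disjoint : ∀ {t t' z} → IsRefl t → IsRefl t' → ¬ (t ≈ᴳ t') → E t z → E t' z → z ≋ 𝟘
  E-disjoint {t} {t'} {z} r r' ne h h' = ≋-stable λ k → lem {A = coeff h ≈ 0#} λ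
    { (inj₁ e) → k (≋-trans (multiple h) (0•≋ root e))
    ; (inj₂ n) → ne (G.sym (conclude n)) }
    where
    open Normal (normalForm r)
    open Root (normalForm r)
    f = coeff h
    t″ = w ⁻¹ ∙ t' ∙ w ⁻¹ ⁻¹
    E″ : E t″ (f • α s)
    E″ = E-cong G.refl (pulled h) (E-conj (w ⁻¹) h')
    conclude : ¬ (f ≈ 0#) → t' ≈ᴳ t
    conclude n = G.trans (grp [] (w ∷ t' ∷ []) v₁ (v₀ ⊙ (inv v₀ ⊙ v₁ ⊙ inv (inv v₀)) ⊙ inv v₀) ≡.refl) (G.trans (G.∙-congʳ (G.∙-congˡ
        (E-simple {t″} {s} (refl-conj (w ⁻¹) r') (≋i (cancel-f (ht≈ E″) (ht≈ (▹-• t″ f (α s)))) λ i → cancel-f (pr≈ E″ i) (pr≈ (▹-• t″ f (α s)) i))))) (G.sym t≈))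
      where
      cancel-f : ∀ {x y a} → x + f * a ≈ 0# → x ≈ f * y → y + a ≈ 0#
      cancel-f {x} {y} {a} e e' = *-cancel-0 n (trans (distribˡ f y a) (trans (+-congʳ (sym e')) e))

-- Homogeneous linear systems over an ordered domain.

module LinearAlgebra (D : OrderedDomain) where
  open OrderedDomains
  open OD D hiding (zero)
  open import Data.Nat as ℕ using (ℕ; zero; suc)
  import Data.Nat.Properties as ℕₚ
  open import Data.Integer using (+_)
  open import Data.Product using (∃; _×_; _,_; proj₁; proj₂)
  open import Data.Sum using (inj₁; inj₂)
  open import Data.Unit using (⊤; tt)
  open import Data.List using (List; []; _∷_; length; map)
  import Data.List.Properties as Listₚ
  open import Data.List.Relation.Unary.All as All using (All; []; _∷_)
  import Data.List.Relation.Unary.All.Properties as Allₚ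
  open import Relation.Nullary using (¬_)
  import Relation.Binary.PropositionalEquality as ≡
  open ≡ using (_≡_)
  open DoubleNegation

  KV : ℕ → Set
  KV zero = ⊤
  KV (suc n) = K × KV n

  infix 4 _≈ᵛ_
  _≈ᵛ_ : ∀ {n} → KV n → KV n → Set
  _≈ᵛ_ {zero} _ _ = ⊤
  _≈ᵛ_ {suc n} (a , x) (b , y) = (a ≈ b) × (x ≈ᵛ y)

  infixl 6 _+ᵛ_
  infixl 7 _*ᵛ_
  _+ᵛ_ : ∀ {n} → KV n → KV n → KV n
  _+ᵛ_ {zero} _ _ = tt
  _+ᵛ_ {suc n} (a , x) (b , y) = a + b , x +ᵛ y

  _*ᵛ_ : ∀ {n} → K → KV n → KV n
  _*ᵛ_ {zero} _ _ = tt
  _*ᵛ_ {suc n} k (a , x) = k * a , k *ᵛ x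

  0ᵛ : ∀ {n} → KV n
  0ᵛ {zero} = tt
  0ᵛ {suc n} = 0# , 0ᵛ

  ≈ᵛ-refl : ∀ {n} {x : KV n} → x ≈ᵛ x
  ≈ᵛ-refl {zero} = tt
  ≈ᵛ-refl {suc n} = refl , ≈ᵛ-refl

  *ᵛ-cancel : ∀ {n k} {x : KV n} → ¬ (k ≈ 0#) → k *ᵛ x ≈ᵛ 0ᵛ → x ≈ᵛ 0ᵛ
  *ᵛ-cancel {zero} _ _ = tt
  *ᵛ-cancel {suc n} h (e , es) = *-cancel-0 h e , *ᵛ-cancel h es

  0≈*0 : ∀ {n} k → 0ᵛ {n} ≈ᵛ k *ᵛ 0ᵛ
  0≈*0 {zero} k = tt
  0≈*0 {suc n} k = sym (zeroʳ k) , 0≈*0 k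

  0≈0+0 : ∀ {n} → 0ᵛ {n} ≈ᵛ 0ᵛ +ᵛ 0ᵛ
  0≈0+0 {zero} = tt
  0≈0+0 {suc n} = sym (+-identityˡ 0#) , 0≈0+0

  record Functional (n : ℕ) : Set where
    field
      fn : KV n → K
      fn-cong : ∀ {x y} → x ≈ᵛ y → fn x ≈ fn y
      fn-+ : ∀ x y → fn (x +ᵛ y) ≈ fn x + fn y
      fn-* : ∀ k x → fn (k *ᵛ x) ≈ k * fn x
  open Functional

  e₀ : ∀ {n} → KV (suc n)
  e₀ = 1# , 0ᵛ

  -- Eliminating the first coordinate with the help of a functional φ that does not kill e₀.
  module Pivot {n} (φ : Functional (suc n)) where
    c : K
    c = fn φ e₀

    -- A parametrisation of the kernel of φ that avoids division: (0, x) is scaled by c, and the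
    -- first coordinate corrects the value.
    B : KV n → KV (suc n)
    B x = - fn φ (0# , x) , c *ᵛ x

    0+x : ∀ {n} {x : KV n} → x ≈ᵛ 0ᵛ +ᵛ x
    0+x {zero} = tt
    0+x {suc n} = sym (+-identityˡ _) , 0+x

    split : ∀ a x → fn φ (a , x) ≈ a * c + fn φ (0# , x)
    split a x = trans (fn-cong φ (trans (sym (*-identityʳ a)) (sym (+-identityʳ _)) , decompose x)) (trans (fn-+ φ (a *ᵛ e₀) (0# , x)) (+-congʳ (fn-* φ a e₀)))
      where
      decompose : ∀ {n} (x : KV n) → x ≈ᵛ a *ᵛ 0ᵛ +ᵛ x
      decompose {zero} x = tt
      decompose {suc n} (b , x) = sym (trans (+-congʳ (zeroʳ a)) (+-identityˡ b)) , decompose x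

    φB : ∀ x → fn φ (B x) ≈ 0#
    φB x = trans (split (- fn φ (0# , x)) (c *ᵛ x)) (trans (+-congˡ (trans (fn-cong φ (sym (zeroʳ c) , ≈ᵛ-refl)) (fn-* φ c (0# , x))))
       (solve 2 (λ a b → (:- a) :* b :+ b :* a := con (+ 0)) refl (fn φ (0# , x)) c))
    pull : Functional (suc n) → Functional n
    pull ψ = record
      { fn = λ x → fn ψ (B x)
      ; fn-cong = λ e → fn-cong ψ (-‿cong (fn-cong φ (refl , e)) , scale e)
      ; fn-+ = λ x y → trans (fn-cong ψ (trans (-‿cong (trans (fn-cong φ (sym (+-identityʳ 0#) , ≈ᵛ-refl)) (fn-+ φ (0# , x) (0# , y)))) (solve 2 (λ a b → :- (a :+ b) := (:- a) :+ (:- b)) refl _ _) , dist x y)) (fn-+ ψ (B x) (B y))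
      ; fn-* = λ k x → trans (fn-cong ψ (trans (-‿cong (trans (fn-cong φ (sym (zeroʳ k) , ≈ᵛ-refl)) (fn-* φ k (0# , x)))) (solve 2 (λ k a → :- (k :* a) := k :* (:- a)) refl _ _) , swap k x)) (fn-* ψ k (B x)) }
      where
      scale : ∀ {n} {x y : KV n} → x ≈ᵛ y → c *ᵛ x ≈ᵛ c *ᵛ y
      scale {zero} _ = tt
      scale {suc n} (e , es) = *-congˡ e , scale es
      dist : ∀ {n} (x y : KV n) → c *ᵛ (x +ᵛ y) ≈ᵛ c *ᵛ x +ᵛ c *ᵛ y
      dist {zero} x y = tt
      dist {suc n} (a , x) (b , y) = distribˡ c a b , dist x y
      swap : ∀ {n} k (x : KV n) → c *ᵛ (k *ᵛ x) ≈ᵛ k *ᵛ (c *ᵛ x)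
      swap {zero} k x = tt
      swap {suc n} k (a , x) = solve 3 (λ c k a → c :* (k :* a) := k :* (c :* a)) refl c k a , swap k x

  data Find {n} (φs : List (Functional (suc n))) : Set where
    kills : All (λ φ → fn φ e₀ ≈ 0#) φs → Find φs
    pivot : ∀ φ rest → ¬ (fn φ e₀ ≈ 0#) → length φs ≡ suc (length rest) → (∀ x → fn φ x ≈ 0# → All (λ ψ → fn ψ x ≈ 0#) rest → All (λ ψ → fn ψ x ≈ 0#) φs) → Find φs

  find : ∀ {n} (φs : List (Functional (suc n))) → ¬ ¬ Find φs
  find [] = return (kills [])
  find (φ ∷ φs) = lem {A = fn φ e₀ ≈ 0#} >>= λ
    { (inj₂ n) → return (pivot φ φs n ≡.refl λ x e es → e ∷ es)
    ; (inj₁ z) → find φs >>= λ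
       { (kills zs) → return (kills (z ∷ zs))
       ; (pivot ψ rest n l f) → return (pivot ψ (φ ∷ rest) n (≡.cong suc l) λ { x e (e' ∷ es) → e' ∷ f x e es }) } }
  -- Each elimination spends one functional and one dimension; if all functionals kill e₀, it is a
  -- solution. Whether a value is zero is known only up to double negation, and so is the result.
  common-zero : ∀ n (φs : List (Functional n)) → length φs ℕ.< n → ¬ ¬ (∃ λ x → ¬ (x ≈ᵛ 0ᵛ) × All (λ φ → fn φ x ≈ 0#) φs)
  common-zero (suc n) φs l = find φs >>= λ
    { (kills zs) → return (e₀ , (λ e → 1≉0 (proj₁ e)) , zs)
    ; (pivot φ rest ne le f) → let open Pivot φ in
        common-zero n (map pull rest) (≡.subst (ℕ._< n) (≡.sym (Listₚ.length-map pull rest)) (ℕₚ.≤-pred (≡.subst (ℕ._< suc n) le l))) >>= λ (x , nz , zs) →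
        return (B x , (λ e → nz (*ᵛ-cancel ne (proj₂ e))) , f (B x) (φB x) (Allₚ.map⁻ zs)) }

-- The space of compatible functions on an interval.

module Families (DC : OrderedDomainWithCosines) {c ℓ : Level} (C : CoxeterSystem c ℓ) where
  open import Defs
  open OrderedDomains
  open import Level using (Level; _⊔_)
  open import Algebra.Bundles using (Group)
  open import Data.Product using (_×_; _,_; proj₁; proj₂)
  open CoxeterSystem C hiding (W)
  open CS C using (eval; Carrier; _∙_) renaming (_≈_ to _≈ᴳ_)
  private module G = Group (CoxeterSystem.W C)
  open CoxeterGroups DC C using (len; IsRefl; refl-gen; refl²; refl-sts; Gen; _≟_; odd; odd-refl)
  open BruhatOrder DC C hiding (nil)
  open BruhatOrder DC C using (nil)
  open Cancellation DC C using (left-mul; Reduced; []; _∷_)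
  open Percolations DC C using (d)
  open GeometricRepresentation DC I m m-diag m-sym m-off using (Vect; ht; pr; _≋_; ≋i; ht≈; pr≈; ≋-refl; ≋-sym; ≋-trans; _⊞_; _•_; ⊞-cong; •-cong; α; act; act-cong; act-⊞; act-•; act-invol; pr-act-s)
  open Eigenspaces DC C
  open OD (proj₁ DC) hiding (zero)
  open LinearAlgebra (proj₁ DC)
  open GroupSolver (CoxeterSystem.W C) using (grp; inv; _⊙_; g₀; v₀; v₁)
  open import Data.Nat as ℕ using (ℕ; zero; suc)
  import Data.Nat.Properties as ℕₚ
  open import Data.Bool using (true; false; not)
  open import Data.Integer using (+_)
  open import Data.Sum using (_⊎_; inj₁; inj₂; swap)
  open import Data.Unit using (⊤; tt)
  open import Data.Empty using (⊥; ⊥-elim)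
  open import Data.List using ([]; _∷_)
  open import Data.Vec using ([]; _∷_)
  open import Relation.Nullary using (¬_; Dec; yes; no)
  open import Relation.Nullary.Decidable using (toSum)
  open import Relation.Binary.Definitions using (tri<; tri≈; tri>)
  import Relation.Binary.PropositionalEquality as ≡
  open ≡ using (_≡_)

  private
    :0 :1 : ∀ {n} → Polynomial n
    :0 = con (+ 0)
    :1 = con (+ 1)

  -- The two lengths differ because reflections change parity.
  edge-either : ∀ {t x} → IsRefl t → (x ⟶ t ∙ x) ⊎ (t ∙ x ⟶ x)
  edge-either {t} {x} r with ℕₚ.<-cmp (len x) (len (t ∙ x))
  ... | tri< lt _ _ = inj₁ (edge r G.refl lt)
  ... | tri> _ _ gt = inj₂ (edge r (G.sym (G.trans (G.sym (G.assoc t t x)) (G.trans (G.∙-congʳ (refl² r)) (G.identityˡ x)))) gt)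
  ... | tri≈ _ e _ = ⊥-elim (b≢not (odd (len x)) (≡.trans (≡.cong odd e) (odd-refl r x)))
    where b≢not : ∀ b → ¬ (b ≡ not b)
          b≢not true ()
          b≢not false ()

  C-cong : ∀ {t t' x x' y y'} → t ≈ᴳ t' → x ≋ x' → y ≋ y' → Compat t x y → Compat t' x' y'
  C-cong e f g h = ≋-trans (⊞-cong (▹-cong (G.sym e) (≋-sym f)) (≋-sym f)) (≋-trans h (⊞-cong (▹-cong e g) g))

  swap⊞ : ∀ x y → x ⊞ y ≋ y ⊞ x
  swap⊞ x y = ≋i (+-comm _ _) λ i → +-comm _ _

  interchange : ∀ a b c d → (a ⊞ b) ⊞ (c ⊞ d) ≋ (a ⊞ c) ⊞ (b ⊞ d)
  interchange a b c d = ≋i (k (ht a) (ht b) (ht c) (ht d)) λ i → k (pr a i) (pr b i) (pr c i) (pr d i)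
    where k : ∀ a b c d → (a + b) + (c + d) ≈ (a + c) + (b + d)
          k = solve 4 (λ a b c d → (a :+ b) :+ (c :+ d) := (a :+ c) :+ (b :+ d)) refl

  C-⊞ : ∀ {t x y x' y'} → Compat t x y → Compat t x' y' → Compat t (x ⊞ x') (y ⊞ y')
  C-⊞ {t} {x} {y} {x'} {y'} h h' = ≋-trans (⊞-cong (▹-⊞ t x x') ≋-refl) (≋-trans (interchange _ _ _ _) (≋-trans (⊞-cong h h') (≋-trans (interchange _ _ _ _) (⊞-cong (≋-sym (▹-⊞ t y y')) ≋-refl))))

  C-conj : ∀ {t x y} s → Compat t x y → Compat (gen s ∙ t ∙ gen s) (act s x) (act s y)
  C-conj {t} {x} {y} s h = ≋-trans (move x) (≋-trans (act-cong s h) (≋-sym (move y)))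
    where
    move : ∀ x → (gen s ∙ t ∙ gen s) ▹ act s x ⊞ act s x ≋ act s (t ▹ x ⊞ x)
    move x = ≋-trans (⊞-cong (≋-trans (▹-cong G.refl (≋-sym (▹-gen s x))) (≋-trans (≋-sym (▹-∙ _ (gen s) x)) (≋-trans (▹-cong (grp (Gen s ∷ []) (t ∷ []) (g₀ ⊙ v₀ ⊙ g₀ ⊙ g₀) (g₀ ⊙ v₀) ≡.refl) ≋-refl)
       (≋-trans (▹-∙ (gen s) t x) (▹-gen s (t ▹ x)))))) ≋-refl) (≋-sym (act-⊞ s (t ▹ x) x))

  C-act : ∀ s x → Compat (gen s) x (act s x)
  C-act s x = ≋-trans (⊞-cong (▹-gen s x) (≋-sym (act-invol s x))) (≋-trans (swap⊞ _ _) (⊞-cong (≋-sym (▹-gen s (act s x))) ≋-refl) )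

  C-α : ∀ {s} k → Compat (gen s) 𝟘 (k • α s)
  C-α {s} k = ≋-trans (≋-trans (⊞-cong (▹-𝟘 _) ≋-refl) (≋i (+-identityˡ _) λ i → +-identityˡ _)) (≋-sym
    (≋-trans (⊞-cong (▹-• (gen s) k (α s)) ≋-refl) (≋-trans (≋i (sym (distribˡ k _ _)) λ i → sym (distribˡ k _ _)) (≋-trans (•-cong refl (α-E s)) (≋i (zeroʳ k) λ i → zeroʳ k)))))

  ⊞𝟘 : ∀ x → x ⊞ 𝟘 ≋ x
  ⊞𝟘 x = ≋i (+-identityʳ _) λ i → +-identityʳ _

  C-self : ∀ {s} k x → Compat (gen s) x (act s x ⊞ k • α s)
  C-self {s} k x = C-cong G.refl (⊞𝟘 x) ≋-refl (C-⊞ (C-act s x) (C-α k))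

  -- An n-dimensional space of functions on [u,v] whose difference along every edge
  -- lies in the line of its reflection, meeting the constants trivially.
  record Family (u v : Carrier) (n : ℕ) : Set (c ⊔ ℓ) where
    field
      f : KV n → Carrier → Vect
      f-cong : ∀ {a b x y} → a ≈ᵛ b → x ≈ᴳ y → f a x ≋ f b y
      f-+ : ∀ a b x → f (a +ᵛ b) x ≋ f a x ⊞ f b x
      f-* : ∀ k a x → f (k *ᵛ a) x ≋ k • f a x
      compat : ∀ a {t x} → IsRefl t → u ≼ x → x ≼ v → u ≼ t ∙ x → t ∙ x ≼ v → Compat t (f a x) (f a (t ∙ x))
      indep : ∀ a → (∀ x → u ≼ x → x ≼ v → f a x ≋ f a v) → a ≈ᵛ 0ᵛ

  Linear : ∀ {n} → (KV n → K) → Set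
  Linear {n} g = (∀ {a b} → a ≈ᵛ b → g a ≈ g b) × (∀ a b → g (a +ᵛ b) ≈ g a + g b) × (∀ k a → g (k *ᵛ a) ≈ k * g a)

  -- Old values are kept, and a new element x receives the reflected value of k x plus γ α_k, which
  -- makes the edge between x and k x compatible whatever γ is. The three uses take γ zero, γ a free
  -- coordinate, and γ forced by the old values.
  module Glue {u q n} (F : Family u q n) (k : I) {n'}
    (base : KV n' → KV n) (base-cong : ∀ {a b} → a ≈ᵛ b → base a ≈ᵛ base b)
    (base-+ : ∀ a b → base (a +ᵛ b) ≈ᵛ base a +ᵛ base b) (base-* : ∀ r a → base (r *ᵛ a) ≈ᵛ r *ᵛ base a)
    (γ : KV n' → K) (γ-linear : Linear γ)
    {p p'} (In : Carrier → Set p) (Out : Carrier → Set p') (dec : ∀ x → In x ⊎ Out x) (excl : ∀ {x} → In x → Out x → ⊥)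
    (in-cong : ∀ {x y} → x ≈ᴳ y → In x → In y) where
    open Family F

    opp : KV n' → Carrier → Vect
    opp a x = act k (f (base a) (k · x)) ⊞ γ a • α k

    opp-cong : ∀ {a b x y} → a ≈ᵛ b → x ≈ᴳ y → opp a x ≋ opp b y
    opp-cong e h = ⊞-cong (act-cong k (f-cong (base-cong e) (·-cong k h))) (•-cong (proj₁ γ-linear e) ≋-refl)

    private
      pick : ∀ {x} → In x ⊎ Out x → Vect → Vect → Vect
      pick (inj₁ _) y z = y
      pick (inj₂ _) y z = z

    abstract
      g : KV n' → Carrier → Vect
      g a x = pick (dec x) (f (base a) x) (opp a x)

      at-in : ∀ a {x} → In x → g a x ≋ f (base a) x
      at-in a {x} i with dec x
      ... | inj₁ _ = ≋-refl
      ... | inj₂ o = ⊥-elim (excl i o)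

      at-out : ∀ a {x} → Out x → g a x ≋ opp a x
      at-out a {x} o with dec x
      ... | inj₁ i = ⊥-elim (excl i o)
      ... | inj₂ _ = ≋-refl

      g-cong : ∀ {a b x y} → a ≈ᵛ b → x ≈ᴳ y → g a x ≋ g b y
      g-cong {a} {b} {x} {y} e h with dec x | dec y
      ... | inj₁ _ | inj₁ _ = f-cong (base-cong e) h
      ... | inj₂ _ | inj₂ _ = opp-cong e h
      ... | inj₁ i | inj₂ o = ⊥-elim (excl (in-cong h i) o)
      ... | inj₂ o | inj₁ i = ⊥-elim (excl (in-cong (G.sym h) i) o)

      g-+ : ∀ a b x → g (a +ᵛ b) x ≋ g a x ⊞ g b x
      g-+ a b x with dec x
      ... | inj₁ _ = ≋-trans (f-cong (base-+ a b) G.refl) (f-+ _ _ x)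
      ... | inj₂ _ = ≋-trans (⊞-cong (≋-trans (act-cong k (≋-trans (f-cong (base-+ a b) G.refl) (f-+ _ _ _))) (act-⊞ k _ _)) (≋-trans (•-cong (proj₁ (proj₂ γ-linear) a b) ≋-refl) (≋i (distribʳ _ _ _) λ i → distribʳ _ _ _))) (interchange _ _ _ _)

      g-* : ∀ r a x → g (r *ᵛ a) x ≋ r • g a x
      g-* r a x with dec x
      ... | inj₁ _ = ≋-trans (f-cong (base-* r a) G.refl) (f-* r _ x)
      ... | inj₂ _ = ≋-trans (⊞-cong (≋-trans (act-cong k (≋-trans (f-cong (base-* r a) G.refl) (f-* r _ _))) (act-• k r _)) (≋-trans (•-cong (proj₂ (proj₂ γ-linear) r a) ≋-refl) (≋i (*-assoc _ _ _) λ i → *-assoc _ _ _)))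
                         (≋i (sym (distribˡ r _ _)) λ i → sym (distribˡ r _ _))

    opp-compat : ∀ a {t x} → IsRefl t → u ≼ k · x → k · x ≼ q → u ≼ k · (t ∙ x) → k · (t ∙ x) ≼ q → Compat t (opp a x) (opp a (t ∙ x))
    opp-compat a {t} {x} r h₁ h₂ h₃ h₄ = C-⊞ (C-cong (grp (Gen k ∷ []) (t ∷ []) (g₀ ⊙ (g₀ ⊙ v₀ ⊙ g₀) ⊙ g₀) v₀ ≡.refl) ≋-refl (act-cong k (f-cong ≈ᵛ-refl e))
        (C-conj k (compat (base a) (refl-sts k r) h₁ h₂ (≼-congʳ (G.sym e) h₃) (≼-congˡ (G.sym e) h₄)))) ≋-refl
      where e : gen k ∙ t ∙ gen k ∙ (k · x) ≈ᴳ k · (t ∙ x)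
            e = grp (Gen k ∷ []) (t ∷ x ∷ []) (g₀ ⊙ v₀ ⊙ g₀ ⊙ (g₀ ⊙ v₁)) (g₀ ⊙ (v₀ ⊙ v₁)) ≡.refl

    in-out : ∀ a {t x} → t ≈ᴳ gen k → In x → Out (t ∙ x) → Compat t (g a x) (g a (t ∙ x))
    in-out a {t} {x} e i o = C-cong (G.sym e) (≋-sym (at-in a i)) (≋-sym (≋-trans (at-out a o) (⊞-cong (act-cong k (f-cong ≈ᵛ-refl (G.trans (·-cong k (G.∙-congʳ e)) (cancel k x)))) ≋-refl)))
      (C-self (γ a) (f (base a) x))

    out-in : ∀ a {t x} → t ≈ᴳ gen k → Out x → In (t ∙ x) → Compat t (g a x) (g a (t ∙ x))
    out-in a {t} {x} e o i = C-cong (G.sym e) (≋-sym (≋-trans (at-out a o) (⊞-cong (act-cong k (f-cong ≈ᵛ-refl (G.sym (G.∙-congʳ e)))) ≋-refl))) (≋-sym (at-in a i))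
      (≋-sym (C-self (γ a) (f (base a) (t ∙ x))))

  module Extend {k q} (q-up : Up k q) where
    v : Carrier
    v = k · q
    v-down : Down k v
    v-down = up⇒down q-up
    q≼v : q ≼ v
    q≼v = ⟶⇒≼ (up-edge q-up)
    to-q : ∀ {x} → x ≼ k · v → x ≼ q
    to-q = ≼-congʳ (cancel k q)
    up≼q : ∀ {x} → Up k x → x ≼ v → x ≼ q
    up≼q ux h = to-q (lift-down k h ux v-down)
    down≼q : ∀ {x} → Down k x → x ≼ v → k · x ≼ q
    down≼q dx h = to-q (lift-both k h dx v-down)

    -- every element of [u,v] is moved down by k
    transport : ∀ {u n} → Down k u → ¬ (u ≼ q) → Family (k · u) q n → Family u v n
    transport {u} {n} du u⋠q F = record
      { f = g ; f-cong = g-cong ; f-+ = g-+ ; f-* = g-*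
      ; compat = λ a r h₁ h₂ h₃ h₄ → C-cong G.refl (≋-sym (at-out a tt)) (≋-sym (at-out a tt)) (opp-compat a r (lower h₁ h₂) (down≼q (all-down h₁ h₂) h₂) (lower h₃ h₄) (down≼q (all-down h₃ h₄) h₄))
      ; indep = λ a h → indep a λ x hx xq → back a (h (k · x) (≼-congˡ (cancel k u) (left-mul k hx (q-ups hx xq))) (left-mul k xq q-up)) }
      where
      open Family F
      open Glue F k (λ a → a) (λ e → e) (λ _ _ → ≈ᵛ-refl) (λ _ _ → ≈ᵛ-refl) (λ _ → 0#) ((λ _ → refl) , (λ _ _ → sym (+-identityˡ 0#)) , λ r _ → sym (zeroʳ r)) (λ _ → ⊥) (λ _ → ⊤) (λ _ → inj₂ tt) (λ ()) (λ _ ())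
      all-down : ∀ {x} → u ≼ x → x ≼ v → Down k x
      all-down {x} h h' with up⊎down k x
      ... | inj₂ dx = dx
      ... | inj₁ ux = ⊥-elim (u⋠q (≼-trans h (up≼q ux h')))
      lower : ∀ {x} → u ≼ x → x ≼ v → k · u ≼ k · x
      lower h h' = lift-both k h du (all-down h h')
      q-ups : ∀ {x} → k · u ≼ x → x ≼ q → Up k x
      q-ups {x} h h' with up⊎down k x
      ... | inj₁ ux = ux
      ... | inj₂ dx = ⊥-elim (u⋠q (≼-trans (≼-congˡ (cancel k u) (lift-up k h (down⇒up du) dx)) h'))
      back : ∀ a {x} → g a (k · x) ≋ g a v → f a x ≋ f a q
      back a {x} e = ≋-trans (peel (k · x) x (cancel k x)) (≋-trans (act-cong k e) (≋-sym (peel v q (cancel k q))))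
        where peel : ∀ y z → k · y ≈ᴳ z → f a z ≋ act k (g a y)
              peel y z e = ≋-trans (f-cong ≈ᵛ-refl (G.sym e)) (≋-trans (≋-sym (act-invol k _)) (act-cong k (≋-sym (≋-trans (at-out a tt) (≋-trans (⊞-cong ≋-refl (0•≋ (α k) refl)) (⊞𝟘 _))))))

    -- [u,v] is the disjoint union of [u,q] and its image under k
    double : ∀ {u n} → Up k u → u ≼ q → ¬ (k · u ≼ q) → Family u q n → Family u v (suc n)
    double {u} {n} uu u≼q ku⋠q F = record
      { f = g ; f-cong = g-cong ; f-+ = g-+ ; f-* = g-*
      ; compat = compat'
      ; indep = indep' }
      where
      open Family F
      open Glue F k {suc n} proj₂ proj₂ (λ _ _ → ≈ᵛ-refl) (λ _ _ → ≈ᵛ-refl) proj₁ (proj₁ , (λ _ _ → refl) , (λ _ _ → refl)) (Up k) (Down k) (up⊎down k) up-down up-cong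
      mixed : ∀ {x y} → Up k x → Down k y → u ≼ x → x ≼ v → u ≼ y → y ≼ v → ¬ (y ≈ᴳ k · x) → (x ⟶ y) ⊎ (y ⟶ x) → ⊥
      mixed ux dy hx xv hy yv ne (inj₁ e) with edge-step k e
      ... | inj₁ h = ne h
      ... | inj₂ h = ku⋠q (≼-trans (lift-ups k hx uu ux) (≼-trans (⟶⇒≼ h) (down≼q dy yv)))
      mixed ux dy hx xv hy yv ne (inj₂ e) = ku⋠q (≼-trans (lift-up k hy uu dy) (≼-trans (⟶⇒≼ e) (up≼q ux xv)))
      compat' : ∀ a {t x} → IsRefl t → u ≼ x → x ≼ v → u ≼ t ∙ x → t ∙ x ≼ v → Compat t (g a x) (g a (t ∙ x))
      compat' a {t} {x} r h₁ h₂ h₃ h₄ with t ≟ gen k | up⊎down k x | up⊎down k (t ∙ x)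
      ... | yes e | inj₁ ux | inj₂ dy = in-out a e ux dy
      ... | yes e | inj₂ dx | inj₁ uy = out-in a e dx uy
      ... | yes e | inj₁ ux | inj₁ uy = ⊥-elim (up-down uy (down-cong (G.∙-congʳ (G.sym e)) (up⇒down ux)))
      ... | yes e | inj₂ dx | inj₂ dy = ⊥-elim (up-down (up-cong (G.∙-congʳ (G.sym e)) (down⇒up dx)) dy)
      ... | no ne | inj₁ ux | inj₁ uy = C-cong G.refl (≋-sym (at-in a ux)) (≋-sym (at-in a uy)) (compat (proj₂ a) r h₁ (up≼q ux h₂) h₃ (up≼q uy h₄))
      ... | no ne | inj₂ dx | inj₂ dy = C-cong G.refl (≋-sym (at-out a dx)) (≋-sym (at-out a dy)) (opp-compat a r (to-low h₁ dx) (down≼q dx h₂) (to-low h₃ dy) (down≼q dy h₄))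
        where to-low : ∀ {x} → u ≼ x → Down k x → u ≼ k · x
              to-low h dx = lift-down k h uu dx
      ... | no ne | inj₁ ux | inj₂ dy = ⊥-elim (mixed ux dy h₁ h₂ h₃ h₄ (λ e → ne (cancelʳ e)) (edge-either r))
        where cancelʳ : t ∙ x ≈ᴳ k · x → t ≈ᴳ gen k
              cancelʳ e = G.trans (grp [] (t ∷ x ∷ []) v₀ (v₀ ⊙ v₁ ⊙ inv v₁) ≡.refl) (G.trans (G.∙-congʳ e) (grp [] (gen k ∷ x ∷ []) (v₀ ⊙ v₁ ⊙ inv v₁) v₀ ≡.refl))
      ... | no ne | inj₂ dx | inj₁ uy = ⊥-elim (mixed uy dx h₃ h₄ h₁ h₂ (λ e → ne (cancelʳ (·-swap k e))) (swap (edge-either r)))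
        where cancelʳ : k · x ≈ᴳ t ∙ x → t ≈ᴳ gen k
              cancelʳ e = G.trans (grp [] (t ∷ x ∷ []) v₀ (v₀ ⊙ v₁ ⊙ inv v₁) ≡.refl) (G.trans (G.∙-congʳ (G.sym e)) (grp [] (gen k ∷ x ∷ []) (v₀ ⊙ v₁ ⊙ inv v₁) v₀ ≡.refl))
      indep' : ∀ a → (∀ x → u ≼ x → x ≼ v → g a x ≋ g a v) → a ≈ᵛ 0ᵛ
      indep' a h = c≈0 , b≈0
        where
        q-const : ∀ x → u ≼ x → x ≼ q → Up k x → f (proj₂ a) x ≋ g a v
        q-const x hx xq ux = ≋-trans (≋-sym (at-in a ux)) (h x hx (≼-trans xq q≼v))
        ups : ∀ {x} → u ≼ x → x ≼ q → Up k x
        ups {x} hx xq with up⊎down k x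
        ... | inj₁ ux = ux
        ... | inj₂ dx = ⊥-elim (ku⋠q (≼-trans (lift-up k hx uu dx) xq))
        b≈0 : proj₂ a ≈ᵛ 0ᵛ
        b≈0 = indep (proj₂ a) λ x hx xq → ≋-trans (q-const x hx xq (ups hx xq)) (≋-sym (q-const q u≼q ≼-refl q-up))
        f0 : ∀ x → f (proj₂ a) x ≋ 𝟘
        f0 x = ≋-trans (f-cong b≈0 G.refl) (≋-trans (f-cong (0≈*0 0#) G.refl) (≋-trans (f-* 0# 0ᵛ x) (0•≋ _ refl)))
        c≈0 : proj₁ a ≈ 0#
        c≈0 = trans (sym (trans (+-cong (k0 (ht≈ z) (pr≈ z k)) (*-identityʳ _)) (+-identityˡ _))) (ht≈ (≋-trans (≋-sym (at-out a v-down)) (≋-trans (≋-sym (q-const q u≼q ≼-refl q-up)) (f0 q))))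
          where z = f0 (k · v)
                k0 : ∀ {x y} → x ≈ 0# → y ≈ 0# → x - y ≈ 0#
                k0 e e' = trans (+-cong e (-‿cong e')) (-‿inverseʳ 0#)

    -- k and both u, k·u lie in the lower half: the values on [u,q] determine those on the rest of [u,v]
    module Stretch {u n} (uu : Up k u) (ku≼q : k · u ≼ q) (F : Family u q n) where
      open Family F
      u≼q : u ≼ q
      u≼q = ≼-trans (⟶⇒≼ (up-edge uu)) ku≼q

      -- For `Good` x this is the coefficient in f(k x) - k f(x) = κ α_k, found by pairing with the
      -- coroot of k; the half undoes the pairing of α_k with it, which is 2.
      κ : KV n → Carrier → K
      κ a x = half * (pr (f a (k · x)) k + pr (f a x) k)

      κ-cong : ∀ {a b x y} → a ≈ᵛ b → x ≈ᴳ y → κ a x ≈ κ b y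
      κ-cong e h = *-congˡ (+-cong (pr≈ (f-cong e (·-cong k h)) k) (pr≈ (f-cong e h) k))

      κ-sym : ∀ a x → κ a (k · x) ≈ κ a x
      κ-sym a x = *-congˡ (trans (+-comm _ _) (+-congˡ (pr≈ (f-cong ≈ᵛ-refl (cancel k x)) k)))

      abstract
        κ-linear : ∀ x → Linear (λ a → κ a x)
        κ-linear x = (λ e → κ-cong e G.refl) ,
          (λ a b → trans (*-congˡ (+-cong (pr≈ (f-+ a b _) k) (pr≈ (f-+ a b _) k))) (solve 5 (λ h p q r s → h :* ((p :+ q) :+ (r :+ s)) := h :* (p :+ r) :+ h :* (q :+ s)) refl half _ _ _ _)) ,
          (λ r a → trans (*-congˡ (+-cong (pr≈ (f-* r a _) k) (pr≈ (f-* r a _) k))) (solve 4 (λ h r p q → h :* (r :* p :+ r :* q) := r :* (h :* (p :+ q))) refl half r _ _))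

      Good : Carrier → Set (c ⊔ ℓ)
      Good x = u ≼ x × x ≼ q × k · x ≼ q

      u≼k· : ∀ {x} → u ≼ x → u ≼ k · x
      u≼k· {x} h with up⊎down k x
      ... | inj₁ ux = ≼-trans h (⟶⇒≼ (up-edge ux))
      ... | inj₂ dx = lift-down k h uu dx

      A : KV n → Carrier → Vect
      A a x = f a (k · x) ⊟ act k (f a x)

      A-E : ∀ a {x} → Good x → E (gen k) (A a x)
      A-E a {x} (h , xq , kxq) = Compat⇒E (≋-trans (≋-sym (compat a (refl-gen k) h xq (u≼k· h) kxq)) (C-act k (f a x)))

      A≋ : ∀ a {x} → Good x → A a x ≋ κ a x • α k
      A≋ a {x} g = ≋-trans (E-gen k (A a x) (A-E a g)) (•-cong (*-congˡ (+-congˡ (trans (*-congˡ (pr-act-s k (f a x))) (solve 1 (λ p → (:- :1) :* (:- p) := p) refl _)))) ≋-refl)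

      rearrange : ∀ a b c d → (a ⊟ b) ⊟ act k (c ⊟ d) ≋ (a ⊟ act k c) ⊟ (b ⊟ act k d)
      rearrange a b c d = ≋-trans (⊞-cong ≋-refl (•-cong refl (≋-trans (act-⊞ k c _) (⊞-cong ≋-refl (act-• k _ d)))))
        (≋i (j (ht a) (ht b) (ht (act k c)) (ht (act k d))) λ i → j (pr a i) (pr b i) (pr (act k c) i) (pr (act k d) i))
        where j : ∀ a b c d → (a + (- 1#) * b) + (- 1#) * (c + (- 1#) * d) ≈ (a + (- 1#) * c) + (- 1#) * (b + (- 1#) * d)
              j = solve 4 (λ a b c d → (a :+ (:- :1) :* b) :+ (:- :1) :* (c :+ (:- :1) :* d) := (a :+ (:- :1) :* c) :+ (:- :1) :* (b :+ (:- :1) :* d)) refl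

      -- Multiplied by α_k, the difference of the two coefficients lies on the line of k. It is also
      -- built from differences along edges whose transported label is k t k, hence lies on that
      -- line too. The lines are distinct, so it vanishes.
      κ-edge : ∀ a {x y} → Good x → Good y → x ⟶ y → κ a y ≈ κ a x
      κ-edge a {x} {y} gx gy (edge {t} r p _) with t ≟ gen k
      ... | yes e = trans (κ-cong ≈ᵛ-refl (G.trans p (G.∙-congʳ e))) (κ-sym a x)
      ... | no ne = trans (solve 2 (λ a b → a := b :+ (a :* :1 :+ (:- :1) :* (b :* :1))) refl (κ a y) (κ a x)) (trans (+-congˡ (ht≈ zero-diff)) (+-identityʳ _))
        where
        t' = gen k ∙ t ∙ gen k
        e' : t' ∙ (k · x) ≈ᴳ k · y
        e' = G.trans (grp (Gen k ∷ []) (t ∷ x ∷ []) (g₀ ⊙ v₀ ⊙ g₀ ⊙ (g₀ ⊙ v₁)) (g₀ ⊙ (v₀ ⊙ v₁)) ≡.refl) (·-cong k (G.sym p))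
        E₁ : E t' (f a (k · y) ⊟ f a (k · x))
        E₁ = Compat⇒E (≋-sym (C-cong G.refl ≋-refl (f-cong ≈ᵛ-refl e') (compat a (refl-sts k r) (u≼k· (proj₁ gx)) (proj₂ (proj₂ gx)) (≼-congʳ (G.sym e') (u≼k· (proj₁ gy))) (≼-congˡ (G.sym e') (proj₂ (proj₂ gy))))))
        E₂ : E t (f a y ⊟ f a x)
        E₂ = Compat⇒E (≋-sym (C-cong G.refl ≋-refl (f-cong ≈ᵛ-refl (G.sym p)) (compat a r (proj₁ gx) (proj₁ (proj₂ gx)) (≼-congʳ p (proj₁ gy)) (≼-congˡ p (proj₁ (proj₂ gy))))))
        E₂' : E t' (act k (f a y ⊟ f a x))
        E₂' = E-cong (grp (Gen k ∷ []) (t ∷ []) (g₀ ⊙ v₀ ⊙ inv g₀) (g₀ ⊙ v₀ ⊙ g₀) ≡.refl) (▹-gen k _) (E-conj (gen k) E₂)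
        Et' : E t' (A a y ⊟ A a x)
        Et' = E-cong G.refl (rearrange _ _ _ _) (E-⊟ E₁ E₂')
        t'≉ : ¬ (gen k ≈ᴳ t')
        t'≉ h = ne (G.trans (grp (Gen k ∷ []) (t ∷ []) v₀ (g₀ ⊙ (g₀ ⊙ v₀ ⊙ g₀) ⊙ g₀) ≡.refl) (G.trans (G.∙-congʳ (G.∙-congˡ (G.sym h))) (grp (Gen k ∷ []) [] (g₀ ⊙ g₀ ⊙ g₀) g₀ ≡.refl)))
        zero-diff : (κ a y • α k) ⊟ (κ a x • α k) ≋ 𝟘
        zero-diff = ≋-trans (⊞-cong (≋-sym (A≋ a gy)) (•-cong refl (≋-sym (A≋ a gx)))) (E-disjoint (refl-gen k) (refl-sts k r) t'≉ (E-⊟ (A-E a gy) (A-E a gx)) Et')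

      κ-chain : ∀ a {x z} → x ≼ z → u ≼ x → Up k z → k · z ≼ q → κ a z ≈ κ a x
      κ-chain a (nil e) h uz kzq = κ-cong ≈ᵛ-refl (G.sym e)
      κ-chain a {x} {z} (_◅_ {y} e p) h uz kzq = trans (κ-chain a p (≼-trans h (⟶⇒≼ e)) uz kzq) (κ-edge a (good (e ◅ p) h) (good p (≼-trans h (⟶⇒≼ e))) e)
        where good : ∀ {x} → x ≼ z → u ≼ x → Good x
              good xz hx = hx , ≼-trans xz (≼-trans (⟶⇒≼ (up-edge uz)) kzq) , ≼-trans (left-mul k xz uz) kzq

      κ-const : ∀ a {x} → Good x → κ a (k · x) ≈ κ a u
      κ-const a {x} (h , xq , kxq) with up⊎down k x
      ... | inj₁ ux = trans (κ-sym a x) (κ-chain a h ≼-refl ux kxq)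
      ... | inj₂ dx = κ-chain a (u≼k· h) ≼-refl (down⇒up dx) (≼-congˡ (G.sym (cancel k x)) xq)

      open Glue F k (λ a → a) (λ e → e) (λ _ _ → ≈ᵛ-refl) (λ _ _ → ≈ᵛ-refl) (λ a → κ a u) (κ-linear u) (_≼ q) (λ x → ¬ (x ≼ q))
        (λ x → toSum (x ≼? q)) (λ p np → np p) ≼-congˡ public
        renaming (g to ext)

      -- Constancy of κ makes the reflected formula agree with the old values where both apply, so
      -- an edge between old and new part can be checked among reflected values.
      consistent : ∀ a {x} → Good x → f a x ≋ opp a x
      consistent a {x} (h , xq , kxq) = ≋i (j (ht X) (ht Y) (κ a u * 1#) (ht≈ eq)) λ i → j (pr X i) (pr Y i) (κ a u * pr (α k) i) (pr≈ eq i)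
        where
        X = f a x
        Y = act k (f a (k · x))
        eq : f a x ⊟ act k (f a (k · x)) ≋ κ a u • α k
        eq = ≋-trans (⊞-cong (f-cong ≈ᵛ-refl (G.sym (cancel k x))) ≋-refl) (≋-trans (A≋ a (u≼k· h , kxq , ≼-congˡ (G.sym (cancel k x)) xq)) (•-cong (κ-const a (h , xq , kxq)) ≋-refl))
        j : ∀ x y z → x + (- 1#) * y ≈ z → x ≈ y + z
        j x y z e = trans (solve 2 (λ x y → x := y :+ (x :+ (:- :1) :* y)) refl x y) (+-congˡ e)

      ext-opp : ∀ a {x} → u ≼ x → x ≼ v → k · x ≼ q → ext a x ≋ opp a x
      ext-opp a {x} h xv kxq with x ≼? q
      ... | yes xq = ≋-trans (at-in a xq) (consistent a (h , xq , kxq))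
      ... | no nq = at-out a nq

      out-down : ∀ {x} → x ≼ v → ¬ (x ≼ q) → Down k x
      out-down {x} xv nq with up⊎down k x
      ... | inj₂ dx = dx
      ... | inj₁ ux = ⊥-elim (nq (up≼q ux xv))

      mixed : ∀ {x y} → x ≼ q → ¬ (k · x ≼ q) → y ≼ v → ¬ (y ≼ q) → ¬ (y ≈ᴳ k · x) → (x ⟶ y) ⊎ (y ⟶ x) → ⊥
      mixed xq nkx yv ny ne (inj₂ e) = ny (≼-trans (⟶⇒≼ e) xq)
      mixed xq nkx yv ny ne (inj₁ e) with edge-step k e
      ... | inj₁ h = ne h
      ... | inj₂ h = nkx (≼-trans (⟶⇒≼ h) (down≼q (out-down yv ny) yv))

      ext-compat : ∀ a {t x} → IsRefl t → u ≼ x → x ≼ v → u ≼ t ∙ x → t ∙ x ≼ v → Compat t (ext a x) (ext a (t ∙ x))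
      ext-compat a {t} {x} r h₁ h₂ h₃ h₄ with x ≼? q | t ∙ x ≼? q
      ... | yes xq | yes yq = C-cong G.refl (≋-sym (at-in a xq)) (≋-sym (at-in a yq)) (compat a r h₁ xq h₃ yq)
      ... | no nx | no ny = C-cong G.refl (≋-sym (at-out a nx)) (≋-sym (at-out a ny)) (opp-compat a r (u≼k· h₁) (down≼q (out-down h₂ nx) h₂) (u≼k· h₃) (down≼q (out-down h₄ ny) h₄))
      ... | yes xq | no ny with k · x ≼? q
      ...   | yes kxq = C-cong G.refl (≋-sym (ext-opp a h₁ h₂ kxq)) (≋-sym (at-out a ny)) (opp-compat a r (u≼k· h₁) kxq (u≼k· h₃) (down≼q (out-down h₄ ny) h₄))
      ...   | no nkx with t ≟ gen k
      ...     | yes e = in-out a e xq ny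
      ...     | no ne = ⊥-elim (mixed xq nkx h₄ ny (λ e → ne (G.trans (grp [] (t ∷ x ∷ []) v₀ (v₀ ⊙ v₁ ⊙ inv v₁) ≡.refl) (G.trans (G.∙-congʳ e) (grp [] (gen k ∷ x ∷ []) (v₀ ⊙ v₁ ⊙ inv v₁) v₀ ≡.refl)))) (edge-either r))
      ext-compat a {t} {x} r h₁ h₂ h₃ h₄ | no nx | yes yq with k · (t ∙ x) ≼? q
      ...   | yes kyq = C-cong G.refl (≋-sym (at-out a nx)) (≋-sym (ext-opp a h₃ h₄ kyq)) (opp-compat a r (u≼k· h₁) (down≼q (out-down h₂ nx) h₂) (u≼k· h₃) kyq)
      ...   | no nky with t ≟ gen k
      ...     | yes e = out-in a e nx yq
      ...     | no ne = ⊥-elim (mixed yq nky h₂ nx (λ e → ne (G.trans (grp [] (t ∷ x ∷ []) v₀ (v₀ ⊙ v₁ ⊙ inv v₁) ≡.refl) (G.trans (G.∙-congʳ (G.sym (·-swap k e))) (grp [] (gen k ∷ x ∷ []) (v₀ ⊙ v₁ ⊙ inv v₁) v₀ ≡.refl)))) (swap (edge-either r)))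

      stretch : Family u v n
      stretch = record { f = ext ; f-cong = g-cong ; f-+ = g-+ ; f-* = g-* ; compat = ext-compat
        ; indep = λ a h → indep a λ x hx xq → ≋-trans (≋-sym (at-in a xq)) (≋-trans (h x hx (≼-trans xq q≼v)) (≋-trans (≋-sym (h q u≼q q≼v)) (at-in a ≼-refl))) }

      -- A function constant on [k·u,v] is constant on all of [u,q].
      restrict : Family (k · u) v n
      restrict = record { f = ext ; f-cong = g-cong ; f-+ = g-+ ; f-* = g-*
        ; compat = λ a r h₁ h₂ h₃ h₄ → ext-compat a r (≼-trans u≼ku h₁) h₂ (≼-trans u≼ku h₃) h₄
        ; indep = λ a h → indep a λ x hx xq → ≋-trans (value a h x hx xq) (≋-sym (value a h q u≼q ≼-refl)) }
        where
        u≼ku : u ≼ k · u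
        u≼ku = ⟶⇒≼ (up-edge uu)
        value : ∀ a → (∀ x → k · u ≼ x → x ≼ v → ext a x ≋ ext a v) → ∀ x → u ≼ x → x ≼ q → f a x ≋ ext a v
        value a h x hx xq with up⊎down k x
        ... | inj₂ dx = ≋-trans (≋-sym (at-in a xq)) (h x (lift-up k hx uu dx) (≼-trans xq q≼v))
        ... | inj₁ ux = ≋-trans same-as-q (≋-trans (≋-sym (at-in a ≼-refl)) (h q ku≼q q≼v))
          where
          kx≼v : k · x ≼ v
          kx≼v = left-mul k xq q-up
          e₁ : opp a (k · x) ≋ ext a v
          e₁ = ≋-trans (≋-sym (ext-opp a (u≼k· hx) kx≼v (≼-congˡ (G.sym (cancel k x)) xq))) (h (k · x) (left-mul k hx ux) kx≼v)
          e₂ : opp a v ≋ ext a v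
          e₂ = ≋-sym (ext-opp a (≼-trans u≼q q≼v) ≼-refl (≼-congˡ (G.sym (cancel k q)) ≼-refl))
          acts : act k (f a (k · k · x)) ≋ act k (f a (k · v))
          acts = ≋i (j (ht X) (ht Y) (κ a u * 1#) (ht≈ e₃)) λ i → j (pr X i) (pr Y i) (κ a u * pr (α k) i) (pr≈ e₃ i)
            where X = act k (f a (k · k · x))
                  Y = act k (f a (k · v))
                  e₃ : opp a (k · x) ≋ opp a v
                  e₃ = ≋-trans e₁ (≋-sym e₂)
                  j : ∀ x y z → x + z ≈ y + z → x ≈ y
                  j x y z e = trans (solve 2 (λ x z → x := (x :+ z) :- z) refl x z) (trans (+-congʳ e) (solve 2 (λ y z → (y :+ z) :- z := y) refl y z))
          same-as-q : f a x ≋ f a q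
          same-as-q = ≋-trans (f-cong ≈ᵛ-refl (G.sym (cancel k x))) (≋-trans (≋-sym (act-invol k _)) (≋-trans (act-cong k acts) (≋-trans (act-invol k _) (f-cong ≈ᵛ-refl (cancel k q)))))

  family : ∀ w → Reduced w → ∀ u → u ≼ eval w → Family u (eval w) (d u w)
  family [] _ u p = record { f = λ _ _ → 𝟘 ; f-cong = λ _ _ → ≋-refl ; f-+ = λ _ _ _ → ≋-sym (⊞𝟘 𝟘) ; f-* = λ k _ _ → ≋i (sym (zeroʳ k)) λ i → sym (zeroʳ k)
    ; compat = λ _ _ _ _ _ _ → ≋-refl ; indep = λ _ _ → tt }
  family (k ∷ w) (q-up ∷ red) u p with up⊎down k u
  ... | inj₂ du = go (u ≼? eval w)
    where
    open Extend q-up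
    F : Family (k · u) (eval w) (d (k · u) w)
    F = family w red (k · u) (down≼q du p)
    go : Dec (u ≼ eval w) → Family u (k · eval w) (d (k · u) w)
    go (no n) = transport du n F
    -- Here u = k u' lies below q: the family on [u', q] is stretched to [u', v] and then restricted
    -- to [u, v], which keeps it independent.
    go (yes h) = record { Family R ; compat = λ a r h₁ h₂ h₃ h₄ → Family.compat R a r (≼-congˡ e h₁) h₂ (≼-congˡ e h₃) h₄ ; indep = λ a h → Family.indep R a λ x hx xv → h x (≼-congˡ (cancel k u) hx) xv }
      where e : u ≈ᴳ k · k · u
            e = G.sym (cancel k u)
            R = Stretch.restrict (down⇒up du) (≼-congˡ e h) F
  ... | inj₁ uu with k · u ≼? eval w
  ...   | yes h = Extend.Stretch.stretch q-up uu h (family w red u (Extend.up≼q q-up uu p))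
  ...   | no n = Extend.double q-up uu (Extend.up≼q q-up uu p) n (family w red u (Extend.up≼q q-up uu p))

-- The two bounds on diamond-generating sets.

module DEqualsG (DC : OrderedDomainWithCosines) {c ℓ : Level} (C : CoxeterSystem c ℓ) where
  open import Defs
  open OrderedDomains
  open import Level using (Level; _⊔_; Lift; lift; lower)
  open import Algebra.Bundles using (Group)
  open import Data.Product using (Σ; _×_; _,_; proj₁; proj₂)
  open CoxeterSystem C hiding (W)
  open CS C
  private module G = Group (CoxeterSystem.W C)
  open CoxeterGroups DC C using (len; len-cong; IsRefl; refl²; hasLength⇒; word; eval-word; _≟_)
  open BruhatOrder DC C
  open Percolations DC C using (d; cover-above; Percolating; percolate; Percolation)
  open RPolynomials DC C
  open GeometricRepresentation DC I m m-diag m-sym m-off using (ht; _≋_; ht≈; ≋-sym; ≋-trans; ≋-refl)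
  open Eigenspaces DC C using (E; Compat; E-ht; E-disjoint; Compat⇒E; _⊟_; ⊟-0)
  open Families DC C using (Family; family; C-cong)
  open OD (proj₁ DC) using (+-cong; -‿cong; refl; trans; sym; 0#; solve; _:=_; _:+_; _:*_; _:-_; :-_; con) renaming (_≈_ to _≈ᴷ_; _-_ to _-ᴷ_)
  open LinearAlgebra (proj₁ DC)
  open import Data.Nat as ℕ using (ℕ; zero; suc; _≤_; _<_; _+_; _∸_)
  import Data.Nat.Properties as ℕₚ
  open import Data.Integer using (ℤ) renaming (+_ to pos)
  open import Data.Sum using (inj₁; inj₂)
  open import Data.Empty using (⊥-elim)
  open import Data.List using (List; []; _∷_; length; map)
  import Data.List.Properties as Listₚ
  open import Data.List.Relation.Unary.All as All using (All; []; _∷_)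
  import Data.List.Relation.Unary.All.Properties as Allₚ
  open import Data.List.Relation.Unary.Any as Any using (any?)
  open import Data.List.Relation.Unary.AllPairs as AllPairs using (AllPairs; []; _∷_)
  import Data.List.Relation.Unary.AllPairs.Properties as AllPairsₚ
  open import Relation.Nullary using (¬_; yes; no)
  import Relation.Binary.PropositionalEquality as ≡
  open ≡ using (_≡_)

  module Bounds (u v : Carrier) (u≼v : u ≼ v) where
    open Interval u v

    adj : ∀ {x y} → u ≼ x → x ⟶ y → y ≼ v → Adj x y
    adj ux e yv = (≼⇒≤B ux , ≼⇒≤B (≼-trans (⟶⇒≼ e) yv)) , (≼⇒≤B (≼-trans ux (⟶⇒≼ e)) , ≼⇒≤B yv) , inj₁ (toB e)

    adj-sym : ∀ {x y} → Adj x y → Adj y x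
    adj-sym (a , b , inj₁ e) = b , a , inj₂ e
    adj-sym (a , b , inj₂ e) = b , a , inj₁ e

    in-cong : ∀ {x y} → x ≈ y → InInt x → InInt y
    in-cong e (a , b) = ≼⇒≤B (≼-congʳ e (≤B⇒≼ a)) , ≼⇒≤B (≼-congˡ e (≤B⇒≼ b))

    adj-cong : ∀ {x x' y y'} → x ≈ x' → y ≈ y' → Adj x y → Adj x' y'
    adj-cong e f (a , b , inj₁ h) = in-cong e a , in-cong f b , inj₁ (toB (⟶-cong e f (fromB h)))
    adj-cong e f (a , b , inj₂ h) = in-cong e a , in-cong f b , inj₂ (toB (⟶-cong f e (fromB h)))

    record Label (x y : Carrier) : Set (c ⊔ ℓ) where
      constructor label
      field
        t : Carrier
        isRefl : IsRefl t
        y≈ : y ≈ t ∙ x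
        x≈ : x ≈ t ∙ y

    labelOf : ∀ {x y} → Adj x y → Label x y
    labelOf {x} {y} (_ , _ , inj₁ ((t , r , p) , _)) = label t r p (flip r p)
      where flip : ∀ {t x y} → IsRefl t → y ≈ t ∙ x → x ≈ t ∙ y
            flip r p = G.sym (G.trans (G.∙-congˡ p) (G.trans (G.sym (G.assoc _ _ _)) (G.trans (G.∙-congʳ (refl² r)) (G.identityˡ _))))
    labelOf {x} {y} (_ , _ , inj₂ ((t , r , p) , _)) = label t r (flip r p) p
      where flip : ∀ {t x y} → IsRefl t → y ≈ t ∙ x → x ≈ t ∙ y
            flip r p = G.sym (G.trans (G.∙-congˡ p) (G.trans (G.sym (G.assoc _ _ _)) (G.trans (G.∙-congʳ (refl² r)) (G.identityˡ _))))

    module Space {n} (F : Family u v n) where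
      open Family F

      along′ : ∀ a {x y} (A : Adj x y) → Compat (Label.t (labelOf A)) (f a x) (f a y)
      along′ a {x} {y} A@((ux , xv) , (uy , yv) , _) = C-cong G.refl ≋-refl (f-cong ≈ᵛ-refl (G.sym e))
          (compat a (Label.isRefl L) (≤B⇒≼ ux) (≤B⇒≼ xv) (≼-congʳ (Label.y≈ L) (≤B⇒≼ uy)) (≼-congˡ (Label.y≈ L) (≤B⇒≼ yv)))
        where
        L = labelOf A
        e = Label.y≈ L

      along : ∀ a {x y} (A : Adj x y) → E (Label.t (labelOf A)) (f a x ⊟ f a y)
      along a A = Compat⇒E (along′ a A)

      -- By `E-ht` this scalar vanishes only if the function takes equal values at both ends of the
      -- edge.
      height : Carrier × Carrier → Functional n
      height (x , y) = record
        { fn = λ a → ht (f a x) -ᴷ ht (f a y)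
        ; fn-cong = λ e → +-cong (ht≈ (f-cong e G.refl)) (-‿cong (ht≈ (f-cong e G.refl)))
        ; fn-+ = λ a b → trans (+-cong (ht≈ (f-+ a b x)) (-‿cong (ht≈ (f-+ a b y)))) (solve 4 (λ p q r s → (p :+ q) :- (r :+ s) := (p :- r) :+ (q :- s)) refl _ _ _ _)
        ; fn-* = λ k a → trans (+-cong (ht≈ (f-* k a x)) (-‿cong (ht≈ (f-* k a y)))) (solve 3 (λ k p q → k :* p :- k :* q := k :* (p :- q)) refl _ _ _) }

      module Zeros (a : KV n) where
        Level-set : Carrier → Carrier → Set (c ⊔ ℓ)
        Level-set x y = Adj x y × Lift (c ⊔ ℓ) (f a x ≋ f a y)

        edge-subset : IsEdgeSubset Level-set
        edge-subset = record
          { sub = λ _ _ → proj₁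
          ; symm = λ { _ _ (A , lift e) → adj-sym A , lift (≋-sym e) }
          ; resp = λ { e h (A , lift z) → adj-cong e h A , lift (≋-trans (f-cong ≈ᵛ-refl (G.sym e)) (≋-trans z (f-cong ≈ᵛ-refl h))) } }

        -- Distinct reflections have disjoint (−1)-eigenspaces.
        closed : DiamondClosed Level-set
        closed x y z w ((xy , yz , zw , wx) , (_ , x≉z , _ , _ , _ , _)) (_ , lift e) (_ , lift e') =
          (zw , lift z≋w) , (wx , lift (≋-trans (≋-sym z≋w) (≋-sym (≋-trans e e'))))
          where
          L₁ = labelOf zw
          L₂ = labelOf (adj-sym wx)
          distinct : ¬ (Label.t L₁ ≈ Label.t L₂)
          distinct h = x≉z (G.trans (Label.x≈ L₂) (G.trans (G.∙-congʳ (G.sym h)) (G.sym (Label.x≈ L₁))))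
          z≋w : f a z ≋ f a w
          z≋w = ⊟-0 (E-disjoint (Label.isRefl L₁) (Label.isRefl L₂) distinct (along a zw)
                   (Compat⇒E (C-cong G.refl (≋-trans e e') ≋-refl (along′ a (adj-sym wx)))))

        contains : ∀ {F} → All (λ e → Adj (proj₁ e) (proj₂ e)) F → All (λ φ → Functional.fn φ a ≈ᴷ 0#) (map height F) → All (λ e → Level-set (proj₁ e) (proj₂ e)) F
        contains [] [] = []
        contains (A ∷ As) (z ∷ zs) = (A , lift (⊟-0 (E-ht (Label.isRefl (labelOf A)) (along a A) (trans (solve 2 (λ p q → p :+ (:- con (pos 1)) :* q := p :- q) refl _ _) z)))) ∷ contains As zs

        trivial : (∀ x y → Adj x y → Level-set x y) → a ≈ᵛ 0ᵛ
        trivial h = indep a λ x ux xv → go ux xv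
          where
          go : ∀ {x} → u ≼ x → x ≼ v → f a x ≋ f a v
          go ux (nil e) = f-cong ≈ᵛ-refl e
          go ux (e ◅ p) = ≋-trans (lower (proj₂ (h _ _ (adj ux e p)))) (go (≼-trans ux (⟶⇒≼ e)) p)

      -- The nonzero solution exists up to double negation, which suffices for an inequality of
      -- natural numbers.
      lower-bound : ∀ F → ValidEdgeList F → DiamondGenerating F → n ≤ length F
      lower-bound F (valid , _) gen with n ℕ.≤? length F
      ... | yes p = p
      ... | no np = ⊥-elim (common-zero n (map height F) (≡.subst (_< n) (≡.sym (Listₚ.length-map height F)) (ℕₚ.≰⇒> np)) λ (a , a≉0 , zs) →
            a≉0 (Zeros.trivial a (gen (Zeros.Level-set a) (Zeros.edge-subset a) (Zeros.closed a) (Zeros.contains a valid zs))))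

    module Closure {D : Carrier → Carrier → Set (c ⊔ ℓ)} (ES : IsEdgeSubset D) (closed : DiamondClosed D) where
      open IsEdgeSubset ES renaming (resp to D-resp)

      Full : Carrier → Set (c ⊔ ℓ)
      Full x = ∀ {y z} → x ≼ y → y ⟶ z → z ≼ v → D y z

      full-cong : ∀ {x y} → x ≈ y → Full x → Full y
      full-cong e h p = h (≼-congˡ (G.sym e) p)

      full-upper : ∀ {x y} → x ≼ y → Full x → Full y
      full-upper p h q = h (≼-trans p q)

      <⇒≉ : ∀ {x y} → len x < len y → ¬ (x ≈ y)
      <⇒≉ lt e = ℕₚ.<-irrefl (len-cong e) lt

      four : ∀ {y a z b} → y ⋖ a → y ⋖ b → a ⋖ z → b ⋖ z → u ≼ y → z ≼ v → ¬ (a ≈ b) → FourCycle y a z b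
      four ya yb az bz uy zv ne =
        (adj uy (⋖⇒⟶ ya) (≼-trans (⋖⇒≼ az) zv) , adj (≼-trans uy (⋖⇒≼ ya)) (⋖⇒⟶ az) zv , adj-sym (adj (≼-trans uy (⋖⇒≼ yb)) (⋖⇒⟶ bz) zv) , adj-sym (adj uy (⋖⇒⟶ yb) (≼-trans (⋖⇒≼ bz) zv))) ,
        (<⇒≉ (len< (⋖⇒⟶ ya)) , <⇒≉ (ℕₚ.<-trans (len< (⋖⇒⟶ ya)) (len< (⋖⇒⟶ az))) , <⇒≉ (len< (⋖⇒⟶ yb)) , <⇒≉ (len< (⋖⇒⟶ az)) , ne , λ e → <⇒≉ (len< (⋖⇒⟶ bz)) (G.sym e))

      -- One atom a of [y,v] with D y a and [a,v] full suffices: the other atoms are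
      -- reached through joins, and longer edges from y close up a path of length three.
      full-below : ∀ n {y a} → len v ≤ n + len y → u ≼ y → y ⋖ a → a ≼ v → Full a → D y a → Full y
      full-below zero l uy ya av fa da = ⊥-elim (ℕₚ.<⇒≱ (ℕₚ.<-≤-trans (len< (⋖⇒⟶ ya)) (≼-len av)) l)
      full-below (suc n) {y} {a} l uy ya av fa da = full-y
        where
        Φ : Carrier → Set (c ⊔ ℓ)
        Φ b = Full b × D y b
        joins : JoinClosed y v Φ
        joins = record
          { resp = λ e (h , k) → full-cong e h , D-resp G.refl e k
          ; join = λ {a} {b} {z} ya yb az bz zv ne (fa , da) →
              let zb , by = closed _ _ _ _ (four ya yb az bz uy zv ne) da (fa ≼-refl (⋖⇒⟶ az) zv)
              in full-below n (≡.subst (len v ≤_) (≡.trans (≡.sym (ℕₚ.+-suc n _)) (≡.cong (n +_) (≡.sym (len-suc yb)))) l) (≼-trans uy (⋖⇒≼ yb)) bz zv (full-upper (⋖⇒≼ az) fa) (symm _ _ zb) , symm _ _ by }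
        atoms : ∀ {b} → y ⋖ b → b ≼ v → Φ b
        atoms yb bv = atoms-connected (len v) Φ ℕₚ.≤-refl joins ya av (fa , da) yb bv
        strictly-above : ∀ {y' z} → y ≼ y' → ¬ (y ≈ y') → y' ⟶ z → z ≼ v → D y' z
        strictly-above p ne e zv with cover-above _ ℕₚ.≤-refl p ne
        ... | b , yb , by' = proj₁ (atoms yb (≼-trans by' (≼-trans (⟶⇒≼ e) zv))) by' e zv
        from-y : ∀ {z} → y ⟶ z → z ≼ v → D y z
        from-y {z} e zv with suc (len y) ℕ.<? len z
        ... | no np = proj₂ (atoms (cov e (ℕₚ.≤-antisym (ℕₚ.≮⇒≥ np) (len< e))) zv)
        ... | yes p with long-edge _ ℕₚ.≤-refl e p
        ...   | path₃ {p₁} {p₂} e₁ e₂ e₃ = symm _ _ (proj₁ (closed p₁ p₂ z y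
                  ((adj up₁ e₂ (≼-trans (⟶⇒≼ e₃) zv) , adj (≼-trans up₁ (⟶⇒≼ e₂)) e₃ zv , adj-sym (adj uy e zv) , adj uy e₁ p₁v) ,
                   (<⇒≉ (len< e₂) , <⇒≉ (ℕₚ.<-trans (len< e₂) (len< e₃)) , (λ h → <⇒≉ (len< e₁) (G.sym h)) , <⇒≉ (len< e₃) , (λ h → <⇒≉ (ℕₚ.<-trans (len< e₁) (len< e₂)) (G.sym h)) , λ h → <⇒≉ (len< e) (G.sym h)))
                  (strictly-above (⟶⇒≼ e₁) (<⇒≉ (len< e₁)) e₂ (≼-trans (⟶⇒≼ e₃) zv))
                  (strictly-above (≼-trans (⟶⇒≼ e₁) (⟶⇒≼ e₂)) (<⇒≉ (ℕₚ.<-trans (len< e₁) (len< e₂))) e₃ zv)))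
          where
          up₁ = ≼-trans uy (⟶⇒≼ e₁)
          p₁v = ≼-trans (⟶⇒≼ e₂) (≼-trans (⟶⇒≼ e₃) zv)
        full-y : Full y
        full-y {y'} p e zv with y ≟ y'
        ... | yes h = D-resp h G.refl (from-y (⟶-cong (G.sym h) G.refl e) zv)
        ... | no ne = strictly-above p ne e zv

      percolating : Percolating u v Full
      percolating = record
        { resp = full-cong
        ; top = λ p e zv → ⊥-elim (ℕₚ.<⇒≱ (len< e) (ℕₚ.≤-trans (≼-len zv) (≼-len p)))
        ; upper = λ _ p _ → full-upper p
        ; diamond = λ {y} {a} {b} {z} uy ya yb az bz zv ne fa fb fz →
            -- The two upper edges of the diamond are in D, hence so are the lower ones, and a is an
            -- atom to which `full-below` applies.
            let dya = proj₂ (closed a z b y (rotate (four ya yb az bz uy zv ne)) (fa ≼-refl (⋖⇒⟶ az) zv) (symm _ _ (fb ≼-refl (⋖⇒⟶ bz) zv)))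
            in full-below (len v) (ℕₚ.m≤m+n (len v) (len y)) uy ya (≼-trans (⋖⇒≼ az) zv) fa dya }
        where
        rotate : ∀ {a b c d} → FourCycle a b c d → FourCycle b c d a
        rotate ((ab , bc , cd , da) , (ab' , ac' , ad' , bc' , bd' , cd')) = (bc , cd , da , ab) , (bc' , bd' , (λ e → ab' (G.sym e)) , cd' , (λ e → ac' (G.sym e)) , (λ e → ad' (G.sym e)))

      full-coatom : ∀ {h} → h ⋖ v → D h v → Full h
      full-coatom hv dv p e zv = D-resp y≈ z≈ dv
        where
        y≈ = ≼-≥ p (ℕₚ.≤-pred (ℕₚ.≤-trans (len< e) (ℕₚ.≤-trans (≼-len zv) (ℕₚ.≤-reflexive (len-suc hv)))))
        z≈ = G.sym (≼-≥ zv (ℕₚ.≤-trans (ℕₚ.≤-reflexive (len-suc hv)) (ℕₚ.≤-trans (ℕ.s≤s (≼-len p)) (len< e))))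

      everything : Full u → ∀ x y → Adj x y → D x y
      everything h x y ((ux , _) , (_ , yv) , inj₁ e) = h (≤B⇒≼ ux) (fromB e) (≤B⇒≼ yv)
      everything h x y ((_ , xv) , (uy , _) , inj₂ e) = symm _ _ (h (≤B⇒≼ uy) (fromB e) (≤B⇒≼ xv))

    -- Nothing prevents two seeds from coinciding, whereas a valid edge list must not repeat an
    -- edge.
    record Deduplicated {p} (P : Carrier → Set p) (A : List Carrier) : Set (Level.suc (c ⊔ ℓ) ⊔ p) where
      field
        list : List Carrier
        all : All P list
        distinct : AllPairs (λ x y → ¬ (x ≈ y)) list
        short : length list ≤ length A
        back : ∀ {T : Carrier → Set (c ⊔ ℓ)} → (∀ {x y} → x ≈ y → T x → T y) → All T list → All T A

    deduplicate : ∀ {p} {P : Carrier → Set p} {A} → All P A → Deduplicated P A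
    deduplicate [] = record { list = [] ; all = [] ; distinct = [] ; short = ℕ.z≤n ; back = λ _ _ → [] }
    deduplicate {A = h ∷ A} (p ∷ ps) with deduplicate ps
    ... | R with any? (h ≟_) (Deduplicated.list R)
    ...   | yes q = record { list = list ; all = all ; distinct = distinct ; short = ℕₚ.≤-trans short (ℕₚ.n≤1+n _)
              ; back = λ resp ts → resp (G.sym (proj₂ (All.lookupAny ts q))) (proj₁ (All.lookupAny ts q)) ∷ back resp ts }
      where open Deduplicated R
    ...   | no nq = record { list = h ∷ list ; all = p ∷ all ; distinct = Allₚ.¬Any⇒All¬ list nq ∷ distinct ; short = ℕ.s≤s short
              ; back = λ { resp (t ∷ ts) → t ∷ back resp ts } }
      where open Deduplicated R

    w : List I
    w = word v

    v′≈v : eval w ≈ v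
    v′≈v = eval-word v

    red = minimal⇒reduced w (len-cong (G.sym v′≈v))

    fam : Family u v (d u w)
    fam = record { Family F ; compat = λ a r h₁ h₂ h₃ h₄ → Family.compat F a r h₁ (≼-congʳ (G.sym v′≈v) h₂) h₃ (≼-congʳ (G.sym v′≈v) h₄)
                 ; indep = λ a h → Family.indep F a λ x ux xv → ≋-trans (h x ux (≼-congʳ v′≈v xv)) (Family.f-cong F ≈ᵛ-refl (G.sym v′≈v)) }
      where F = family w red u (≼-congʳ (G.sym v′≈v) u≼v)

    per : Percolation u w []
    per = percolate w red u (≼-congʳ (G.sym v′≈v) u≼v) [] []

    seeds : Deduplicated (λ h → h ⋖ v × u ≼ h) (Percolation.seeds per)
    seeds = deduplicate (All.map (λ (hv , uh) → ⋖-cong G.refl v′≈v hv , uh) (Percolation.are-seeds per))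
    open Deduplicated seeds

    F₀ : List (Carrier × Carrier)
    F₀ = map (_, v) list

    valid : ValidEdgeList F₀
    valid = Allₚ.map⁺ (All.map (λ (hv , uh) → adj uh (⋖⇒⟶ hv) ≼-refl) all) , AllPairsₚ.map⁺ (pairs all distinct)
      where
      pairs : ∀ {A} → All (λ h → h ⋖ v × u ≼ h) A → AllPairs (λ x y → ¬ (x ≈ y)) A → AllPairs (λ x y → ¬ SameEdge (x , v) y v) A
      pairs [] [] = []
      pairs ((hv , _) ∷ as) (n ∷ ns) = All.map (λ { ne (inj₁ (e , _)) → ne e ; ne (inj₂ (e , _)) → ℕₚ.<-irrefl (len-cong e) (len< (⋖⇒⟶ hv)) }) n ∷ pairs as ns

    generating : DiamondGenerating F₀
    generating D ES closed ds = everything (Percolation.percolates per (percolating' ) [] (back full-cong (coatoms all (Allₚ.map⁻ ds))))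
      where
      open Closure ES closed
      coatoms : ∀ {A} → All (λ h → h ⋖ v × u ≼ h) A → All (λ h → D h v) A → All Full A
      coatoms [] [] = []
      coatoms ((hv , _) ∷ as) (e ∷ es) = full-coatom hv e ∷ coatoms as es
      percolating' : Percolating u (eval w) Full
      percolating' = record { Percolating percolating
        ; top = full-cong (G.sym v′≈v) (Percolating.top percolating)
        ; upper = λ ux p q → Percolating.upper percolating ux p (≼-congʳ v′≈v q)
        ; diamond = λ uy ya yb az bz zv → Percolating.diamond percolating uy ya yb az bz (≼-congʳ v′≈v zv) }

    isG : IsG (d u w)
    -- Removing repetitions could only shorten the list below d, and the lower bound forbids that.
    isG = (F₀ , valid , generating , ℕₚ.≤-antisym upper (Space.lower-bound fam F₀ valid generating)) , Space.lower-bound fam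
      where
      upper : length F₀ ≤ d u w
      upper = ℕₚ.≤-trans (ℕₚ.≤-reflexive (Listₚ.length-map (_, v) list)) (ℕₚ.≤-trans short (ℕₚ.≤-trans (ℕₚ.m≤m+n _ 0) (Percolation.bound per)))

  d≡g : (u v : Carrier) → u ≤B v → (R : Carrier → Carrier → ℕ → ℤ) → IsRFamily R → (lu lv : ℕ) → HasLength u lu → HasLength v lv →
    Σ ℕ (λ g → Interval.IsG u v g × dInv R u v (lv ∸ lu) ≡ pos g)
  d≡g u v uv R F lu lv hu hv = d u (word v) , Bounds.isG u v (≤B⇒≼ uv) ,
    ≡.subst₂ (λ a b → dInv R u v (b ∸ a) ≡ pos (d u (word v))) (hasLength⇒ hu) (hasLength⇒ hv) (dInv≡d F (≤B⇒≼ uv))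

open import Data.Nat using (_∸_)
open import Data.Integer using (ℤ; +_)
open import Data.Product using (Σ; _×_)

theorem1p2 : ∀ {c ℓ : Level} (C : CoxeterSystem c ℓ) (u v : CS.Carrier C) →
    CS._≤B_ C u v →
    (R : CS.Carrier C → CS.Carrier C → ℕ → ℤ) → CS.IsRFamily C R →
    (lu lv : ℕ) → CS.HasLength C u lu → CS.HasLength C v lv →
    Σ ℕ (λ g → CS.Interval.IsG C u v g × CS.dInv C R u v (lv ∸ lu) ≡ + g)
theorem1p2 = DEqualsG.d≡g Cosines.ℝ-with-cosines
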